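{- Let $n \geq 5$ be an integer and let $\mathbb{I}_n$ be the $n$-dimensional hypercube graph, regarded as a metric space with the shortest-path distance. Then the reduced integral homology $\tilde{H}_i(\mathcal{VR}(\mathbb{I}_n;3);\mathbb{Z})$ is nonzero if and only if $i \in \{4,7\}$.
   Context: The $n$-dimensional hypercube graph $\mathbb{I}_n$ has vertex set $\{0,1\}^n$ (strings $x_1\ldots x_n$ with $x_i\in\{0,1\}$), two vertices being adjacent iff they differ in exactly one coordinate; the graph distance between two vertices is the number of coordinates in which they differ. For a metric space $(X,d)$ and $r\ge 0$, the Vietoris–Rips complex $\mathcal{VR}(X;r)$ is the simplicial complex on vertex set $X$ whose simplices are the finite subsets $\sigma\subseteq X$ with $d(x,y)\le r$ for all $x,y\in\sigma$. Complexes are identified with their geometric realizations. -}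

module Defs where

open import Data.Bool using (Bool; true; false)
open import Data.Nat using (ℕ; zero; suc; _+_; _≤_)
open import Data.Integer using (ℤ; 0ℤ; 1ℤ; -1ℤ) renaming (_+_ to _+ℤ_; _*_ to _*ℤ_)
open import Data.Fin using (Fin; zero; suc; toℕ)
open import Data.Vec using (Vec; []; _∷_; lookup; insertAt)
open import Data.List using (List; []; _∷_; map; concatMap; foldr)
open import Data.Product using (Σ; _×_; _,_; proj₁; ∃-syntax)
open import Data.Sum using (_⊎_)
open import Data.Empty using (⊥)
open import Data.Unit using (⊤)
open import Relation.Nullary using (¬_)
open import Relation.Binary.PropositionalEquality using (_≡_)

-- The hypercube I_n : vertices {0,1}^n, graph (= Hamming) distance.

Vertex : ℕ → Set
Vertex n = Vec Bool n

hamming : ∀ {n} → Vertex n → Vertex n → ℕ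
hamming []            []            = 0
hamming (true ∷ xs)   (true ∷ ys)   = hamming xs ys
hamming (false ∷ xs)  (false ∷ ys)  = hamming xs ys
hamming (true ∷ xs)   (false ∷ ys)  = suc (hamming xs ys)
hamming (false ∷ xs)  (true ∷ ys)   = suc (hamming xs ys)

allVertices : (n : ℕ) → List (Vertex n)
allVertices zero    = [] ∷ []
allVertices (suc n) = concatMap (λ v → (false ∷ v) ∷ (true ∷ v) ∷ []) (allVertices n)

-- a fixed total order on vertices (lexicographic, 0 < 1), used to orient simplices
_<ᵛ_ : ∀ {n} → Vertex n → Vertex n → Set
[]       <ᵛ []       = ⊥
(x ∷ xs) <ᵛ (y ∷ ys) = (x ≡ false × y ≡ true) ⊎ (x ≡ y × xs <ᵛ ys)

-- Vietoris–Rips complex VR(I_n; r).  An oriented k-simplex is written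
-- uniquely as a strictly increasing (w.r.t. _<ᵛ_) tuple of k+1 vertices.

Increasing : ∀ {n k} → Vec (Vertex n) k → Set
Increasing []           = ⊤
Increasing (v ∷ [])     = ⊤
Increasing (v ∷ w ∷ σ)  = v <ᵛ w × Increasing (w ∷ σ)

IsVRSimplex : (n r : ℕ) {k : ℕ} → Vec (Vertex n) (suc k) → Set
IsVRSimplex n r {k} σ =
  Increasing σ × (∀ (a b : Fin (suc k)) → hamming (lookup σ a) (lookup σ b) ≤ r)

Chain : (n r k : ℕ) → Set
Chain n r k = Σ (Vec (Vertex n) (suc k) → ℤ)
                (λ c → ∀ σ → ¬ IsVRSimplex n r σ → c σ ≡ 0ℤ)

sumℤ : List ℤ → ℤ
sumℤ = foldr _+ℤ_ 0ℤ

sign : ∀ {m} → Fin m → ℤ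
sign zero          = 1ℤ
sign (suc zero)    = -1ℤ
sign (suc (suc j)) = sign j

allFin : (m : ℕ) → List (Fin m)
allFin zero    = []
allFin (suc m) = zero ∷ map suc (allFin m)

-- simplicial boundary ∂ : C_{k+1} → C_k, written coefficientwise:
-- (∂c)(τ) = Σ_{v} Σ_{j} (-1)^j c(τ with v inserted at position j),
-- i.e. ∂[v_0,…,v_{k+1}] = Σ_j (-1)^j [v_0,…,v̂_j,…,v_{k+1}].
∂ : (n : ℕ) {k : ℕ} → (Vec (Vertex n) (suc (suc k)) → ℤ) → (Vec (Vertex n) (suc k) → ℤ)
∂ n {k} c τ =
  sumℤ (concatMap (λ v → map (λ j → sign j *ℤ c (insertAt τ j v)) (allFin (suc (suc k))))
                  (allVertices n))

augmentation : (n : ℕ) → (Vec (Vertex n) 1 → ℤ) → ℤ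
augmentation n c = sumℤ (map (λ v → c (v ∷ [])) (allVertices n))

IsReducedCycle : (n r k : ℕ) → Chain n r k → Set
IsReducedCycle n r zero    c = augmentation n (proj₁ c) ≡ 0ℤ
IsReducedCycle n r (suc k) c = ∀ τ → ∂ n (proj₁ c) τ ≡ 0ℤ

IsBoundary : (n r k : ℕ) → Chain n r k → Set
IsBoundary n r k c = Σ (Chain n r (suc k)) (λ d → ∀ τ → ∂ n (proj₁ d) τ ≡ proj₁ c τ)

ReducedHomologyNonzero : (n r k : ℕ) → Set
ReducedHomologyNonzero n r k = Σ (Chain n r k) (λ c → IsReducedCycle n r k c × ¬ IsBoundary n r k c)

-- Encode oriented simplices by alternating functions and write V(S) for the vanishing of the relative
-- homology of a convex set S of simplices. V(S) holds whenever S is closed under adding and removing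
-- a fixed vertex, and the long exact sequence relates V of a set to V of its upper and lower parts.
--
-- Cliques of diameter at most 3 spanning at least five dimensions carry no relative homology. If such
-- a clique contains two odd vertices p and q, then one of the two common neighbours of p and q can
-- be toggled. If it has a single odd vertex p and two even vertices at distance 3 from p, a neighbour
-- of p can be toggled; otherwise the even vertices form a star whose odd centre can be toggled.
--
-- What remains are the cliques contained in 4-dimensional subcubes. The sets of vertices spanning at
-- most four dimensions have the homology of the 4-skeleton of the cube, because the sets spanning a
-- given d-cube have relative homology in dimension d only. The non-cliques among them live in single
-- 4-cubes, where the cliques form the boundary of a cross-polytope, that is, a 7-sphere.
-- Hence only dimensions 4 and 7 occur. Conversely the 4-skeleton of the 5-cube and the cross-polytope
-- in the 4-cube give nontrivial classes, which persist in larger cubes since these retract onto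
-- their faces.

module Submission where

open import Defs
open import Data.Bool using (Bool; true; false; not; _∧_; _xor_; if_then_else_)
import Data.Bool.Properties as 𝔹
open import Data.Nat using (ℕ; zero; suc; _+_; _*_; _≤_; _<_; z≤n; s≤s; _≤?_)
import Data.Nat.Properties as ℕₚ
import Data.Nat.Tactic.RingSolver as ℕ-Solver
open import Data.Integer using (ℤ; 0ℤ; 1ℤ) renaming (_+_ to _⊕_; _*_ to _⊛_; -_ to ⊖_)
import Data.Integer.Properties as ℤₚ
import Data.Integer.Tactic.RingSolver as ℤ-Solver
open import Data.Fin using (Fin; zero; suc)
import Data.Fin.Properties as Finₚ
open import Data.Vec using (Vec; []; _∷_; lookup; insertAt; toList; _[_]≔_)
import Data.Vec as Vec
import Data.Vec.Properties as Vecₚ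
open import Data.List using (List; []; _∷_; _++_; map; concatMap; length; cartesianProduct)
import Data.List.Properties as Listₚ
open import Data.List.Membership.Propositional using (_∈_; _∉_; find; lose)
import Data.List.Membership.Propositional.Properties as ∈ₚ
open import Data.List.Relation.Binary.Subset.Propositional using (_⊆_)
import Data.List.Relation.Binary.Subset.Propositional.Properties as ⊆ₚ
open import Data.List.Relation.Unary.Any using (Any; here; there; any?)
import Data.List.Relation.Unary.Any as Any
open import Data.List.Relation.Unary.All using (All; []; _∷_; all?)
import Data.List.Relation.Unary.All as All
open import Data.List.Relation.Unary.AllPairs using ([]; _∷_)
open import Data.List.Relation.Unary.Unique.Propositional using (Unique)
import Data.List.Relation.Unary.Unique.Propositional.Properties as Uniqueₚ
open import Data.Product using (Σ; ∃; _×_; _,_; proj₁; proj₂)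
open import Data.Sum using (_⊎_; inj₁; inj₂; [_,_]′)
open import Data.Empty using (⊥; ⊥-elim)
open import Data.Unit using (⊤; tt)
open import Function using (_∘_; id; case_of_)
open import Function.Bundles using (_⇔_; mk⇔)
open import Relation.Nullary using (¬_; Dec; yes; no; does; contradiction; _×-dec_; _⊎-dec_; ¬?; decidable-stable)
open import Relation.Nullary.Decidable using (True; toWitness; map′; dec-true; dec-false)
open import Relation.Binary.PropositionalEquality using (_≡_; _≢_; refl; sym; trans; cong; cong₂; subst; module ≡-Reasoning)

-- The vertex to toggle depends on the clique, so toggling it must not disturb the choice that
-- produced it. The searches therefore fix one pair or triple of a list and exclude all later ones.
-- The toggled vertex has the parity opposite to that of the fixed pair or, for a tripod, is
-- adjacent to the only odd vertex, so it changes none of the candidates of its search. It also lies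
-- in the subcube spanned by the other vertices, so the spanned dimension does not change. The bound
-- five enters through one fact: a clique spanning five dimensions has, for any three of its
-- vertices, a further vertex with a value at some coordinate that none of the three takes. That
-- vertex is fed into linear inequalities between Hamming distances, and parity sharpens the bounds
-- enough for a contradiction. Degrees count vertices: the dimensions 4 and 7 appear as 5 and 8, and
-- the non-cliques contribute in degree 9, one above 8, because of the connecting map.

variable
  n k : ℕ

-- Sums and delta functions on the vertices of the cube

Σᵛ : (Vertex n → ℤ) → ℤ
Σᵛ {zero}  f = f []
Σᵛ {suc n} f = Σᵛ (λ v → f (false ∷ v) ⊕ f (true ∷ v))

Σᵛ-cong : {f g : Vertex n → ℤ} → (∀ v → f v ≡ g v) → Σᵛ f ≡ Σᵛ g
Σᵛ-cong {zero}  f≗g = f≗g []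
Σᵛ-cong {suc n} f≗g = Σᵛ-cong {n} (λ v → cong₂ _⊕_ (f≗g (false ∷ v)) (f≗g (true ∷ v)))

Σᵛ-0 : {f : Vertex n → ℤ} → (∀ v → f v ≡ 0ℤ) → Σᵛ f ≡ 0ℤ
Σᵛ-0 {zero}  f≗0 = f≗0 []
Σᵛ-0 {suc n} f≗0 = Σᵛ-0 {n} (λ v → cong₂ _⊕_ (f≗0 (false ∷ v)) (f≗0 (true ∷ v)))

⊕-interchange : ∀ a b c d → (a ⊕ b) ⊕ (c ⊕ d) ≡ (a ⊕ c) ⊕ (b ⊕ d)
⊕-interchange = ℤ-Solver.solve-∀

Σᵛ-⊕ : (f g : Vertex n → ℤ) → Σᵛ (λ v → f v ⊕ g v) ≡ Σᵛ f ⊕ Σᵛ g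
Σᵛ-⊕ {zero}  f g = refl
Σᵛ-⊕ {suc n} f g = trans
  (Σᵛ-cong λ v → ⊕-interchange (f (false ∷ v)) (g (false ∷ v)) (f (true ∷ v)) (g (true ∷ v)))
  (Σᵛ-⊕ (λ v → f (false ∷ v) ⊕ f (true ∷ v)) (λ v → g (false ∷ v) ⊕ g (true ∷ v)))

Σᵛ-⊖ : (f : Vertex n → ℤ) → Σᵛ (λ v → ⊖ f v) ≡ ⊖ Σᵛ f
Σᵛ-⊖ {zero}  f = refl
Σᵛ-⊖ {suc n} f = trans (Σᵛ-cong λ v → sym (ℤₚ.neg-distrib-+ (f (false ∷ v)) (f (true ∷ v))))
                       (Σᵛ-⊖ (λ v → f (false ∷ v) ⊕ f (true ∷ v)))

Σᵛ-swap : ∀ {m} (f : Vertex n → Vertex m → ℤ) →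
          Σᵛ (λ v → Σᵛ (λ w → f v w)) ≡ Σᵛ (λ w → Σᵛ (λ v → f v w))
Σᵛ-swap {zero}  f = refl
Σᵛ-swap {suc n} f = trans (Σᵛ-cong λ v → sym (Σᵛ-⊕ (f (false ∷ v)) (f (true ∷ v))))
                          (Σᵛ-swap (λ v w → f (false ∷ v) w ⊕ f (true ∷ v) w))

_≟ᵛ_ : (v w : Vertex n) → Dec (v ≡ w)
_≟ᵛ_ = Vecₚ.≡-dec 𝔹._≟_

δ : Vertex n → Vertex n → ℤ → ℤ
δ v w a = if does (v ≟ᵛ w) then a else 0ℤ

δ-yes : {v w : Vertex n} {a : ℤ} → v ≡ w → δ v w a ≡ a
δ-yes {v = v} {w} {a} v≡w = cong (if_then a else 0ℤ) (dec-true (v ≟ᵛ w) v≡w)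

δ-no : {v w : Vertex n} {a : ℤ} → v ≢ w → δ v w a ≡ 0ℤ
δ-no {v = v} {w} {a} v≢w = cong (if_then a else 0ℤ) (dec-false (v ≟ᵛ w) v≢w)

δ-⊖ : (v w : Vertex n) (a : ℤ) → δ v w (⊖ a) ≡ ⊖ δ v w a
δ-⊖ v w a with does (v ≟ᵛ w)
... | true  = refl
... | false = refl

Σᵛ-δ : (v : Vertex n) (f : Vertex n → ℤ) → Σᵛ (λ w → δ w v (f w)) ≡ f v
Σᵛ-δ []          f = refl
Σᵛ-δ {suc n} (false ∷ v) f = trans (Σᵛ-cong {n} λ w → ℤₚ.+-identityʳ _) (Σᵛ-δ v (f ∘ (false ∷_)))
Σᵛ-δ {suc n} (true ∷ v)  f = trans (Σᵛ-cong {n} λ w → ℤₚ.+-identityˡ _) (Σᵛ-δ v (f ∘ (true ∷_)))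

self-neg⇒0 : ∀ a → a ≡ ⊖ a → a ≡ 0ℤ
self-neg⇒0 (ℤ.pos zero)    _ = refl
self-neg⇒0 (ℤ.pos (suc _)) ()
self-neg⇒0 (ℤ.negsuc _)    ()

-- Alternating chains and cones

-- Oriented simplices are encoded by alternating functions on tuples of vertices; this makes
-- everything independent of the order of the vertices, and the boundary becomes a plain sum.

Tuple : ℕ → Set
Tuple n = List (Vertex n)

-- Adjacent transpositions suffice. Vanishing on tuples with repeated vertices follows because ℤ has
-- no 2-torsion.
Alternating : (Tuple n → ℤ) → Set
Alternating f = ∀ ρ x y τ → f (ρ ++ x ∷ y ∷ τ) ≡ ⊖ f (ρ ++ y ∷ x ∷ τ)

Graded : ℕ → (Tuple n → ℤ) → Set
Graded k f = ∀ σ → length σ ≢ k → f σ ≡ 0ℤ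

record Alt (n k : ℕ) : Set where
  constructor mkAlt
  field
    fun   : Tuple n → ℤ
    alt   : Alternating fun
    grade : Graded k fun
open Alt public

bd : (Tuple n → ℤ) → Tuple n → ℤ
bd f τ = Σᵛ (λ v → f (v ∷ τ))

bd-⊕ : (f g : Tuple n → ℤ) (τ : Tuple n) → bd (λ σ → f σ ⊕ g σ) τ ≡ bd f τ ⊕ bd g τ
bd-⊕ f g τ = Σᵛ-⊕ (λ v → f (v ∷ τ)) (λ v → g (v ∷ τ))

bd-⊖ : (f : Tuple n → ℤ) (τ : Tuple n) → bd (λ σ → ⊖ f σ) τ ≡ ⊖ bd f τ
bd-⊖ f τ = Σᵛ-⊖ (λ v → f (v ∷ τ))

-- Exchanging the two inserted vertices permutes the summands and changes their sign, so the value
-- equals its own negative.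
bd∘bd : (c : Tuple n → ℤ) → Alternating c → ∀ τ → bd (bd c) τ ≡ 0ℤ
bd∘bd c c-alt τ = self-neg⇒0 _ (begin
  bd (bd c) τ                                 ≡⟨ Σᵛ-swap (λ v w → c (w ∷ v ∷ τ)) ⟩
  Σᵛ (λ w → Σᵛ (λ v → c (w ∷ v ∷ τ)))         ≡⟨ Σᵛ-cong (λ w → Σᵛ-cong (λ v → c-alt [] w v τ)) ⟩
  Σᵛ (λ w → Σᵛ (λ v → ⊖ c (v ∷ w ∷ τ)))       ≡⟨ Σᵛ-cong (λ w → Σᵛ-⊖ (λ v → c (v ∷ w ∷ τ))) ⟩
  Σᵛ (λ w → ⊖ bd c (w ∷ τ))                   ≡⟨ Σᵛ-⊖ (λ w → bd c (w ∷ τ)) ⟩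
  ⊖ bd (bd c) τ                               ∎)
  where open ≡-Reasoning

bdᴬ : Alt n (suc k) → Alt n k
bdᴬ (mkAlt f a g) = mkAlt (bd f)
  (λ ρ x y τ → trans (Σᵛ-cong λ v → a (v ∷ ρ) x y τ) (Σᵛ-⊖ (λ v → f (v ∷ ρ ++ y ∷ x ∷ τ))))
  (λ σ σ≢k → Σᵛ-0 λ v → g (v ∷ σ) (σ≢k ∘ ℕₚ.suc-injective))

_⊝_ : Alt n k → Alt n k → Alt n k
mkAlt f fa fg ⊝ mkAlt g ga gg = mkAlt (λ σ → f σ ⊕ ⊖ g σ)
  (λ ρ x y τ → trans (cong₂ (λ a b → a ⊕ ⊖ b) (fa ρ x y τ) (ga ρ x y τ))
                     (sym (ℤₚ.neg-distrib-+ (f (ρ ++ y ∷ x ∷ τ)) (⊖ g (ρ ++ y ∷ x ∷ τ)))))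
  (λ σ σ≢k → cong₂ (λ a b → a ⊕ ⊖ b) (fg σ σ≢k) (gg σ σ≢k))

bd-⊝ : (c d : Alt n k) (τ : Tuple n) → bd (fun (c ⊝ d)) τ ≡ bd (fun c) τ ⊕ ⊖ bd (fun d) τ
bd-⊝ c d τ = trans (bd-⊕ (fun c) (λ σ → ⊖ fun d σ) τ) (cong (bd (fun c) τ ⊕_) (bd-⊖ (fun d) τ))

-- cone v c is the exterior product of the vertex v with c.
cone : Vertex n → (Tuple n → ℤ) → Tuple n → ℤ
cone v c []      = 0ℤ
cone v c (w ∷ τ) = δ w v (c τ) ⊕ ⊖ cone v (λ σ → c (w ∷ σ)) τ

cone-cong : (v : Vertex n) {c d : Tuple n → ℤ} → (∀ σ → c σ ≡ d σ) → ∀ τ → cone v c τ ≡ cone v d τ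
cone-cong v c≗d []      = refl
cone-cong v c≗d (w ∷ τ) = cong₂ (λ a b → δ w v a ⊕ ⊖ b) (c≗d τ) (cone-cong v (λ σ → c≗d (w ∷ σ)) τ)

cone-⊖ : (v : Vertex n) (c : Tuple n → ℤ) → ∀ τ → cone v (λ σ → ⊖ c σ) τ ≡ ⊖ cone v c τ
cone-⊖ v c []      = refl
cone-⊖ v c (w ∷ τ) = trans
  (cong₂ (λ a b → a ⊕ ⊖ b) (δ-⊖ w v (c τ)) (cone-⊖ v (λ σ → c (w ∷ σ)) τ))
  (sym (ℤₚ.neg-distrib-+ (δ w v (c τ)) _))

δ-0 : (v w : Vertex n) → δ v w 0ℤ ≡ 0ℤ
δ-0 v w with does (v ≟ᵛ w)
... | true  = refl
... | false = refl

-- The value of `cone v c` at `σ` is a signed sum over the occurrences of `v` in `σ`, each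
-- contributing `c` of the tuple with that occurrence deleted.
cone-zero : (v : Vertex n) (c : Tuple n → ℤ) (σ : Tuple n) →
            (∀ ρ τ → σ ≡ ρ ++ v ∷ τ → c (ρ ++ τ) ≡ 0ℤ) → cone v c σ ≡ 0ℤ
cone-zero v c []      _ = refl
cone-zero v c (w ∷ τ) h = cong₂ (λ a b → a ⊕ ⊖ b) head-term
  (cone-zero v (λ σ → c (w ∷ σ)) τ (λ ρ τ′ eq → h (w ∷ ρ) τ′ (cong (w ∷_) eq)))
  where
  head-term : δ w v (c τ) ≡ 0ℤ
  head-term with w ≟ᵛ v
  ... | yes w≡v = h [] τ (cong (_∷ τ) w≡v)
  ... | no  w≢v = refl

cone-Σᵛ : (v : Vertex n) (f : Vertex n → Tuple n → ℤ) (τ : Tuple n) →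
          Σᵛ (λ w → cone v (f w) τ) ≡ cone v (λ σ → Σᵛ (λ w → f w σ)) τ
cone-Σᵛ {n} v f []      = Σᵛ-0 {n} λ _ → refl
cone-Σᵛ {n} v f (u ∷ τ) = trans
  (Σᵛ-⊕ (λ w → δ u v (f w τ)) (λ w → ⊖ cone v (λ σ → f w (u ∷ σ)) τ))
  (cong₂ _⊕_ δ-Σ (trans (Σᵛ-⊖ {n} _) (cong ⊖_ (cone-Σᵛ v (λ w σ → f w (u ∷ σ)) τ))))
  where
  δ-Σ : Σᵛ (λ w → δ u v (f w τ)) ≡ δ u v (Σᵛ (λ w → f w τ))
  δ-Σ with does (u ≟ᵛ v)
  ... | true  = refl
  ... | false = Σᵛ-0 {n} λ _ → refl

-- The Leibniz rule for the exterior product with a vertex; it is the contracting homotopy behind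
-- `toggle`.
bd-cone : (v : Vertex n) (c : Tuple n → ℤ) (τ : Tuple n) →
          bd (cone v c) τ ≡ c τ ⊕ ⊖ cone v (bd c) τ
bd-cone {n} v c τ = trans (Σᵛ-⊕ (λ w → δ w v (c τ)) _)
  (cong₂ _⊕_ (Σᵛ-δ v (λ _ → c τ))
             (trans (Σᵛ-⊖ {n} _) (cong ⊖_ (cone-Σᵛ v (λ w σ → c (w ∷ σ)) τ))))

cone-alt : (v : Vertex n) (c : Tuple n → ℤ) → Alternating c → Alternating (cone v c)
cone-alt v c a []      x y τ = trans
  (cong (λ z → δ x v (c (y ∷ τ)) ⊕ ⊖ (δ y v (c (x ∷ τ)) ⊕ ⊖ z))
        (trans (cone-cong v (λ σ → a [] x y σ) τ) (cone-⊖ v (λ σ → c (y ∷ x ∷ σ)) τ)))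
  (arith (δ x v (c (y ∷ τ))) (δ y v (c (x ∷ τ))) _)
  where
  arith : ∀ p q r → p ⊕ ⊖ (q ⊕ ⊖ (⊖ r)) ≡ ⊖ (q ⊕ ⊖ (p ⊕ ⊖ r))
  arith = ℤ-Solver.solve-∀
cone-alt v c a (w ∷ ρ) x y τ = trans
  (cong₂ (λ p q → p ⊕ ⊖ q)
    (trans (cong (δ w v) (a ρ x y τ)) (δ-⊖ w v _))
    (cone-alt v (λ σ → c (w ∷ σ)) (λ ρ′ → a (w ∷ ρ′)) ρ x y τ))
  (sym (ℤₚ.neg-distrib-+ (δ w v (c (ρ ++ y ∷ x ∷ τ))) _))

coneᴬ : Vertex n → Alt n k → Alt n (suc k)
coneᴬ {n} v (mkAlt c a g) = mkAlt (cone v c) (cone-alt v c a) (graded _ c g)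
  where
  graded : ∀ k (c : Tuple n → ℤ) → Graded k c → Graded (suc k) (cone v c)
  graded k c g []      _   = refl
  graded zero c g (w ∷ τ) ≢k = cong₂ (λ p q → p ⊕ ⊖ q)
    (trans (cong (δ w v) (g τ (≢k ∘ cong suc))) (δ-0 w v))
    (cone-zero v (λ σ → c (w ∷ σ)) τ (λ ρ τ′ _ → g (w ∷ ρ ++ τ′) (λ ())))
  graded (suc k) c g (w ∷ τ) ≢k = cong₂ (λ p q → p ⊕ ⊖ q)
    (trans (cong (δ w v) (g τ (≢k ∘ cong suc))) (δ-0 w v))
    (graded k (λ σ → c (w ∷ σ)) (λ σ ≢k′ → g (w ∷ σ) (≢k′ ∘ ℕₚ.suc-injective)) τ (≢k ∘ cong suc))

-- The second `x` is moved leftwards until it meets the first one, where transposing the two negates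
-- the value.
alt-repeat : (c : Tuple n → ℤ) → Alternating c → ∀ ρ x ρ′ τ → c (ρ ++ x ∷ ρ′ ++ x ∷ τ) ≡ 0ℤ
alt-repeat c a ρ x []       τ = self-neg⇒0 _ (a ρ x x τ)
alt-repeat c a ρ x (y ∷ ρ′) τ = trans (a ρ x y (ρ′ ++ x ∷ τ)) (cong ⊖_
  (subst (λ σ → c σ ≡ 0ℤ) (Listₚ.++-assoc ρ (y ∷ []) _) (alt-repeat c a (ρ ++ y ∷ []) x ρ′ τ)))

alt-nonunique : (c : Tuple n → ℤ) → Alternating c → ∀ σ → ¬ Unique σ → c σ ≡ 0ℤ
alt-nonunique c a []      ¬u = contradiction [] ¬u
alt-nonunique c a (x ∷ σ) ¬u with any? (x ≟ᵛ_) σ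
... | yes x∈σ with ρ′ , τ , eq ← ∈ₚ.∈-∃++ x∈σ =
          subst (λ σ′ → c (x ∷ σ′) ≡ 0ℤ) (sym eq) (alt-repeat c a [] x ρ′ τ)
... | no  x∉σ = alt-nonunique (λ τ → c (x ∷ τ)) (λ ρ → a (x ∷ ρ)) σ
          (λ u → ¬u (All.tabulate (λ {y} y∈σ x≡y → x∉σ (lose y∈σ x≡y)) ∷ u))

_⊞_ : Alt n k → Alt n k → Alt n k
mkAlt f fa fg ⊞ mkAlt g ga gg = mkAlt (λ σ → f σ ⊕ g σ)
  (λ ρ x y τ → trans (cong₂ _⊕_ (fa ρ x y τ) (ga ρ x y τ))
                     (sym (ℤₚ.neg-distrib-+ (f (ρ ++ y ∷ x ∷ τ)) (g (ρ ++ y ∷ x ∷ τ)))))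
  (λ σ σ≢k → cong₂ _⊕_ (fg σ σ≢k) (gg σ σ≢k))

-- Up-sets, regions and relative homology

-- List inclusion ignores order and multiplicity, so membership depends on the underlying vertex set
-- only. The complement of an up-set is a simplicial complex.
record UpSet (n : ℕ) : Set₁ where
  constructor mkUp
  field
    Holds  : Tuple n → Set
    holds? : ∀ σ → Dec (Holds σ)
    mono   : ∀ {σ τ} → σ ⊆ τ → Holds σ → Holds τ
open UpSet public

_∩_ _∪_ : UpSet n → UpSet n → UpSet n
mkUp P p? pm ∩ mkUp Q q? qm = mkUp (λ σ → P σ × Q σ) (λ σ → p? σ ×-dec q? σ)
                                   (λ s (p , q) → pm s p , qm s q)
mkUp P p? pm ∪ mkUp Q q? qm = mkUp (λ σ → P σ ⊎ Q σ) (λ σ → p? σ ⊎-dec q? σ)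
                                   (λ { s (inj₁ p) → inj₁ (pm s p) ; s (inj₂ q) → inj₂ (qm s q) })

everything nothing : UpSet n
everything = mkUp (λ _ → ⊤) (λ _ → yes tt) (λ _ _ → tt)
nothing    = mkUp (λ _ → ⊥) (λ _ → no λ ()) (λ _ ())

infixr 7 _∩_
infixr 6 _∪_
infix  5 _∖_

-- The chains on a region U ∖ N are the relative chains of the pair of simplicial complexes formed
-- by the complements of N and of N ∪ U.
record Region (n : ℕ) : Set₁ where
  constructor _∖_
  field
    above below : UpSet n

_∈ʳ_ : Tuple n → Region n → Set
σ ∈ʳ (U ∖ N) = Holds U σ × ¬ Holds N σ

abstract
  _∈ʳ?_ : (σ : Tuple n) (R : Region n) → Dec (σ ∈ʳ R)
  σ ∈ʳ? (U ∖ N) = holds? U σ ×-dec ¬? (holds? N σ)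

∈ʳ-resp : (R : Region n) {σ τ : Tuple n} → σ ⊆ τ → τ ⊆ σ → σ ∈ʳ R → τ ∈ʳ R
∈ʳ-resp (U ∖ N) s t (u , ¬n) = mono U s u , λ n → ¬n (mono N t n)

-- This convexity is what makes the boundary cut off at the region square to zero.
∈ʳ-convex : (R : Region n) {v w : Vertex n} {τ : Tuple n} →
            τ ∈ʳ R → (w ∷ v ∷ τ) ∈ʳ R → (v ∷ τ) ∈ʳ R
∈ʳ-convex (U ∖ N) (u , _) (_ , ¬n) = mono U there u , λ n → ¬n (mono N there n)

swap-⊆ : ∀ (ρ : Tuple n) x y τ → (ρ ++ x ∷ y ∷ τ) ⊆ (ρ ++ y ∷ x ∷ τ)
swap-⊆ []      x y τ (here p)          = there (here p)
swap-⊆ []      x y τ (there (here p))  = here p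
swap-⊆ []      x y τ (there (there p)) = there (there p)
swap-⊆ (z ∷ ρ) x y τ (here p)          = here p
swap-⊆ (z ∷ ρ) x y τ (there p)         = there (swap-⊆ ρ x y τ p)

move-front : ∀ (ρ : Tuple n) v τ → (ρ ++ v ∷ τ) ⊆ (v ∷ ρ ++ τ)
move-front []      v τ p         = p
move-front (z ∷ ρ) v τ (here p)  = there (here p)
move-front (z ∷ ρ) v τ (there p) with move-front ρ v τ p
... | here q  = here q
... | there q = there (there q)

move-back : ∀ (ρ : Tuple n) v τ → (v ∷ ρ ++ τ) ⊆ (ρ ++ v ∷ τ)
move-back []      v τ p                 = p
move-back (z ∷ ρ) v τ (here p)          = there (move-back ρ v τ (here p))
move-back (z ∷ ρ) v τ (there (here p))  = here p
move-back (z ∷ ρ) v τ (there (there p)) = there (move-back ρ v τ (there p))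

cut : Region n → (Tuple n → ℤ) → Tuple n → ℤ
cut R f σ = if does (σ ∈ʳ? R) then f σ else 0ℤ

cut-in : (R : Region n) (f : Tuple n → ℤ) {σ : Tuple n} → σ ∈ʳ R → cut R f σ ≡ f σ
cut-in R f {σ} σ∈R = cong (if_then f σ else 0ℤ) (dec-true (σ ∈ʳ? R) σ∈R)

cut-out : (R : Region n) (f : Tuple n → ℤ) {σ : Tuple n} → ¬ σ ∈ʳ R → cut R f σ ≡ 0ℤ
cut-out R f {σ} σ∉R = cong (if_then f σ else 0ℤ) (dec-false (σ ∈ʳ? R) σ∉R)

cutᴬ : Region n → Alt n k → Alt n k
cutᴬ {n} R (mkAlt f a g) = mkAlt (cut R f) cut-alt cut-grade
  where
  cut-alt : Alternating (cut R f)
  cut-alt ρ x y τ with (ρ ++ x ∷ y ∷ τ) ∈ʳ? R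
  ... | yes p = trans (a ρ x y τ)
                  (cong ⊖_ (sym (cut-in R f (∈ʳ-resp R (swap-⊆ ρ x y τ) (swap-⊆ ρ y x τ) p))))
  ... | no ¬p = cong ⊖_ (sym (cut-out R f (λ p → ¬p (∈ʳ-resp R (swap-⊆ ρ y x τ) (swap-⊆ ρ x y τ) p))))
  cut-grade : Graded _ (cut R f)
  cut-grade σ σ≢k with does (σ ∈ʳ? R)
  ... | true  = g σ σ≢k
  ... | false = refl

On : Region n → Alt n k → Set
On R c = ∀ σ → ¬ σ ∈ʳ R → fun c σ ≡ 0ℤ

cut-on : (R : Region n) (c : Alt n k) → On R (cutᴬ R c)
cut-on R c σ = cut-out R (fun c)

-- When `[]` belongs to the region, the condition at `[]` is the augmentation, so homology of
-- complexes comes out reduced.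
CycleOn : Region n → Alt n k → Set
CycleOn R c = ∀ τ → τ ∈ʳ R → bd (fun c) τ ≡ 0ℤ

BoundsOn : Region n → Alt n k → Set
BoundsOn {n} {k} R c =
  Σ (Alt n (suc k)) λ e → On R e × (∀ τ → τ ∈ʳ R → bd (fun e) τ ≡ fun c τ)

-- Here k is the number of vertices, so these concern the relative homology of R in dimension k - 1.
Vanish NonVanish : Region n → ℕ → Set
Vanish    {n} R k = (c : Alt n k) → On R c → CycleOn R c → BoundsOn R c
NonVanish {n} R k = Σ (Alt n k) λ c → On R c × CycleOn R c × ¬ BoundsOn R c

a⊖a≡0 : ∀ a {b} → a ≡ b → a ⊕ ⊖ b ≡ 0ℤ
a⊖a≡0 a refl = ℤₚ.+-inverseʳ a

-- By convexity no coface of `v ∷ τ` can return to the region, so every summand is zero.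
bd-out : (R : Region n) (e : Alt n k) → On R e → ∀ {τ v} → τ ∈ʳ R → ¬ (v ∷ τ) ∈ʳ R →
         bd (fun e) (v ∷ τ) ≡ 0ℤ
bd-out {n} R e e-on {τ} {v} τ∈R vτ∉R = Σᵛ-0 {n} λ w → e-on (w ∷ v ∷ τ) (λ wvτ∈R → vτ∉R (∈ʳ-convex R τ∈R wvτ∈R))

-- Seen from inside the region, the cut removes only values that were already zero, so the absolute
-- identity `bd∘bd` applies.
bd-cut-bd : (R : Region n) (e : Alt n (suc k)) → On R e → CycleOn R (cutᴬ R (bdᴬ e))
bd-cut-bd R e e-on τ τ∈R = trans (Σᵛ-cong pointwise) (bd∘bd (fun e) (alt e) τ)
  where
  pointwise : ∀ v → cut R (bd (fun e)) (v ∷ τ) ≡ bd (fun e) (v ∷ τ)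
  pointwise v with (v ∷ τ) ∈ʳ? R
  ... | yes _    = refl
  ... | no  vτ∉R = sym (bd-out R e e-on τ∈R vτ∉R)

-- c ⊝ bdᴬ e need not lie on R, but the part outside R is invisible to the boundary.
module _ (R : Region n) (c : Alt n k) (e : Alt n (suc k)) (c-on : On R c) (e-on : On R e) where

  reduced : Alt n k
  reduced = cutᴬ R (c ⊝ bdᴬ e)

  bd-reduced : ∀ τ → τ ∈ʳ R → bd (fun reduced) τ ≡ bd (fun c) τ
  bd-reduced τ τ∈R = begin
    bd (fun reduced) τ                          ≡⟨ Σᵛ-cong pointwise ⟩
    bd (fun (c ⊝ bdᴬ e)) τ                      ≡⟨ bd-⊝ c (bdᴬ e) τ ⟩
    bd (fun c) τ ⊕ ⊖ bd (bd (fun e)) τ          ≡⟨ cong (λ z → bd (fun c) τ ⊕ ⊖ z) (bd∘bd (fun e) (alt e) τ) ⟩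
    bd (fun c) τ ⊕ 0ℤ                           ≡⟨ ℤₚ.+-identityʳ _ ⟩
    bd (fun c) τ                                ∎
    where
    open ≡-Reasoning
    pointwise : ∀ v → fun reduced (v ∷ τ) ≡ fun (c ⊝ bdᴬ e) (v ∷ τ)
    pointwise v with (v ∷ τ) ∈ʳ? R
    ... | yes _    = refl
    ... | no  vτ∉R = sym (cong₂ (λ a b → a ⊕ ⊖ b) (c-on _ vτ∉R) (bd-out R e e-on τ∈R vτ∉R))

vanish-resp : {R R′ : Region n} → (∀ σ → σ ∈ʳ R → σ ∈ʳ R′) → (∀ σ → σ ∈ʳ R′ → σ ∈ʳ R) →
              Vanish R k → Vanish R′ k
vanish-resp to from V c c-on c-cyc =
  let e , e-on , ∂e = V c (λ σ σ∉R → c-on σ (σ∉R ∘ from σ)) (λ τ → c-cyc τ ∘ to τ)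
  in  e , (λ σ σ∉R′ → e-on σ (σ∉R′ ∘ to σ)) , (λ τ → ∂e τ ∘ from τ)

nonvanish-resp : {R R′ : Region n} → (∀ σ → σ ∈ʳ R → σ ∈ʳ R′) → (∀ σ → σ ∈ʳ R′ → σ ∈ʳ R) →
                 NonVanish R k → NonVanish R′ k
nonvanish-resp to from (c , c-on , c-cyc , ¬b) =
  c , (λ σ σ∉R′ → c-on σ (σ∉R′ ∘ to σ)) , (λ τ → c-cyc τ ∘ from τ) ,
  λ (e , e-on , ∂e) → ¬b (e , (λ σ σ∉R → e-on σ (σ∉R ∘ from σ)) , (λ τ → ∂e τ ∘ to τ))

0ᴬ : Alt n k
0ᴬ = mkAlt (λ _ → 0ℤ) (λ _ _ _ _ → refl) (λ _ _ → refl)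

vanish-null : {R : Region n} → ((c : Alt n k) → On R c → ∀ σ → σ ∈ʳ R → fun c σ ≡ 0ℤ) → Vanish R k
vanish-null {n} null c c-on c-cyc =
  0ᴬ , (λ _ _ → refl) , (λ τ τ∈R → trans (Σᵛ-0 {n} λ _ → refl) (sym (null c c-on τ τ∈R)))

vanish-empty : {R : Region n} → (∀ σ → length σ ≡ k → ¬ σ ∈ʳ R) → Vanish R k
vanish-empty {R = R} empty = vanish-null {R = R} λ c c-on σ σ∈R → grade c σ (λ eq → empty σ eq σ∈R)

-- The cone from `v` fills `c`. Its error term `cone v (bd c)` evaluates `bd c` only at tuples with
-- `v` removed; these stay in the region, where `c` is a cycle.
toggle : {R : Region n} (v : Vertex n) →
         (∀ τ → τ ∈ʳ R → (v ∷ τ) ∈ʳ R) → (∀ τ → (v ∷ τ) ∈ʳ R → τ ∈ʳ R) → Vanish R k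
toggle {n} {R = R} v add remove c c-on c-cyc =
  coneᴬ v c , cone-on , λ τ τ∈R → trans (bd-cone v (fun c) τ)
    (trans (cong (λ z → fun c τ ⊕ ⊖ z) (cone-zero v (bd (fun c)) τ λ ρ τ′ eq →
              c-cyc _ (remove _ (∈ʳ-resp R (move-front ρ v τ′) (move-back ρ v τ′) (subst (_∈ʳ R) eq τ∈R)))))
           (ℤₚ.+-identityʳ _))
  where
  cone-on : On R (coneᴬ v c)
  cone-on σ σ∉R = cone-zero v (fun c) σ λ ρ τ eq →
    c-on _ λ ρτ∈R → σ∉R (subst (_∈ʳ R) (sym eq) (∈ʳ-resp R (move-back ρ v τ) (move-front ρ v τ) (add _ ρτ∈R)))

-- The long exact sequence of the splitting of a region along an up-set.
module _ (U N P : UpSet n) where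

  private
    -- Cofaces in `S` of tuples of `Up` stay in `Up`, so chains on `Lo` form a subcomplex of those
    -- on `S`, with the chains on `Up` as quotient.
    S Up Lo : Region n
    S  = U ∖ N
    Up = U ∩ P ∖ N
    Lo = U ∖ N ∪ P

    up-or-lo : ∀ {σ} → σ ∈ʳ S → σ ∈ʳ Up ⊎ σ ∈ʳ Lo
    up-or-lo {σ} (u , ¬n) with holds? P σ
    ... | yes p = inj₁ ((u , p) , ¬n)
    ... | no ¬p = inj₂ (u , [ ¬n , ¬p ]′)

    up⇒S : ∀ {σ} → σ ∈ʳ Up → σ ∈ʳ S
    up⇒S ((u , _) , ¬n) = u , ¬n

    lo⇒S : ∀ {σ} → σ ∈ʳ Lo → σ ∈ʳ S
    lo⇒S (u , ¬np) = u , ¬np ∘ inj₁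

    up∧lo⇒⊥ : ∀ {σ} → σ ∈ʳ Up → ¬ σ ∈ʳ Lo
    up∧lo⇒⊥ ((_ , p) , _) (_ , ¬np) = ¬np (inj₂ p)

    coface-up : ∀ {v τ} → τ ∈ʳ Up → (v ∷ τ) ∈ʳ S → (v ∷ τ) ∈ʳ Up
    coface-up ((_ , p) , _) (u , ¬n) = (u , mono P there p) , ¬n

    on-up⇒S : (c : Alt n k) → On Up c → On S c
    on-up⇒S c c-on σ σ∉S = c-on σ (σ∉S ∘ up⇒S)

    on-lo⇒S : (c : Alt n k) → On Lo c → On S c
    on-lo⇒S c c-on σ σ∉S = c-on σ (σ∉S ∘ lo⇒S)

    on-S⇒lo : (c : Alt n k) → On S c → (∀ σ → σ ∈ʳ Up → fun c σ ≡ 0ℤ) → On Lo c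
    on-S⇒lo c c-on zero-up σ σ∉Lo with σ ∈ʳ? S
    ... | no  σ∉S = c-on σ σ∉S
    ... | yes σ∈S = [ zero-up σ , (λ σ∈Lo → contradiction σ∈Lo σ∉Lo) ]′ (up-or-lo σ∈S)

    bd-cut-up : (c : Alt n k) → On S c → ∀ τ → τ ∈ʳ Up → bd (cut Up (fun c)) τ ≡ bd (fun c) τ
    bd-cut-up c c-on τ τ∈Up = Σᵛ-cong pointwise
      where
      pointwise : ∀ v → cut Up (fun c) (v ∷ τ) ≡ fun c (v ∷ τ)
      pointwise v with (v ∷ τ) ∈ʳ? Up
      ... | yes _     = refl
      ... | no  vτ∉Up = sym (c-on _ (vτ∉Up ∘ coface-up τ∈Up))

    bd-lo-up : (c : Alt n k) → On Lo c → ∀ τ → τ ∈ʳ Up → bd (fun c) τ ≡ 0ℤ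
    bd-lo-up c c-on τ τ∈Up =
      Σᵛ-0 {n} λ v → c-on (v ∷ τ) λ vτ∈Lo → up∧lo⇒⊥ (coface-up τ∈Up (lo⇒S vτ∈Lo)) vτ∈Lo

    extend-cycle : (c : Alt n k) → On Lo c → CycleOn Lo c → CycleOn S c
    extend-cycle c c-on c-cyc τ τ∈S = [ bd-lo-up c c-on τ , c-cyc τ ]′ (up-or-lo τ∈S)

    cut-cycle : (c : Alt n k) → On S c → CycleOn S c → CycleOn Up (cutᴬ Up c)
    cut-cycle c c-on c-cyc τ τ∈Up = trans (bd-cut-up c c-on τ τ∈Up) (c-cyc τ (up⇒S τ∈Up))

    -- The connecting map from the quotient `Up` to the subcomplex `Lo`.
    connect : Alt n (suc k) → Alt n k
    connect c = cutᴬ Lo (bdᴬ c)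

    module _ (c : Alt n (suc k)) (c-on : On Up c) (c-cyc : CycleOn Up c) where

      connect-cycle : CycleOn Lo (connect c)
      connect-cycle τ τ∈Lo = trans (Σᵛ-cong pointwise) (bd-cut-bd S c (on-up⇒S c c-on) τ (lo⇒S τ∈Lo))
        where
        pointwise : ∀ v → cut Lo (bd (fun c)) (v ∷ τ) ≡ cut S (bd (fun c)) (v ∷ τ)
        pointwise v with (v ∷ τ) ∈ʳ? S
        ... | no  ∉S = cut-out Lo (bd (fun c)) (∉S ∘ lo⇒S)
        ... | yes ∈S with up-or-lo ∈S
        ...   | inj₂ ∈Lo = cut-in Lo (bd (fun c)) ∈Lo
        ...   | inj₁ ∈Up = trans (cut-out Lo (bd (fun c)) (up∧lo⇒⊥ ∈Up)) (sym (c-cyc _ ∈Up))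

      -- On `Lo` the boundaries of `c` and `f` agree and cancel; on `Up` both vanish.
      lift-cycle : (f : Alt n (suc k)) → On Lo f →
                   (∀ τ → τ ∈ʳ Lo → bd (fun f) τ ≡ fun (connect c) τ) → CycleOn S (c ⊝ f)
      lift-cycle f f-on ∂f τ τ∈S = trans (bd-⊝ c f τ) (a⊖a≡0 _ (eq (up-or-lo τ∈S)))
        where
        eq : τ ∈ʳ Up ⊎ τ ∈ʳ Lo → bd (fun c) τ ≡ bd (fun f) τ
        eq (inj₁ ∈Up) = trans (c-cyc τ ∈Up) (sym (bd-lo-up f f-on τ ∈Up))
        eq (inj₂ ∈Lo) = trans (sym (cut-in Lo (bd (fun c)) ∈Lo)) (sym (∂f τ ∈Lo))

      lift-on : (f : Alt n (suc k)) → On Lo f → On S (c ⊝ f)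
      lift-on f f-on σ σ∉S =
        cong₂ (λ a b → a ⊕ ⊖ b) (on-up⇒S c c-on σ σ∉S) (on-lo⇒S f f-on σ σ∉S)

      lift-bounds : (f : Alt n (suc k)) → On Lo f → BoundsOn S (c ⊝ f) → BoundsOn Up c
      lift-bounds f f-on (h , h-on , ∂h) = cutᴬ Up h , cut-on Up h , λ τ τ∈Up → begin
        bd (cut Up (fun h)) τ   ≡⟨ bd-cut-up h h-on τ τ∈Up ⟩
        bd (fun h) τ            ≡⟨ ∂h τ (up⇒S τ∈Up) ⟩
        fun c τ ⊕ ⊖ fun f τ     ≡⟨ cong (λ z → fun c τ ⊕ ⊖ z) (f-on τ (up∧lo⇒⊥ τ∈Up)) ⟩
        fun c τ ⊕ 0ℤ            ≡⟨ ℤₚ.+-identityʳ _ ⟩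
        fun c τ                 ∎
        where open ≡-Reasoning

    module _ (c : Alt n k) (c-on : On S c) (a : Alt n (suc k)) (a-on : On Up a)
             (∂a : ∀ τ → τ ∈ʳ Up → bd (fun a) τ ≡ cut Up (fun c) τ) where

      remainder : Alt n k
      remainder = reduced S c a c-on (on-up⇒S a a-on)

      remainder-on : On Lo remainder
      remainder-on = on-S⇒lo remainder (cut-on S (c ⊝ bdᴬ a)) λ σ σ∈Up →
        trans (cut-in S (fun (c ⊝ bdᴬ a)) (up⇒S σ∈Up))
              (a⊖a≡0 _ (sym (trans (∂a σ σ∈Up) (cut-in Up (fun c) σ∈Up))))

      remainder-bounds : BoundsOn Lo remainder → BoundsOn S c
      remainder-bounds (f , f-on , ∂f) = a ⊞ f ,
        (λ σ σ∉S → cong₂ _⊕_ (on-up⇒S a a-on σ σ∉S) (on-lo⇒S f f-on σ σ∉S)) ,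
        λ τ τ∈S → trans (bd-⊕ (fun a) (fun f) τ) (eq τ (up-or-lo τ∈S))
        where
        eq : ∀ τ → τ ∈ʳ Up ⊎ τ ∈ʳ Lo → bd (fun a) τ ⊕ bd (fun f) τ ≡ fun c τ
        eq τ (inj₁ ∈Up) = trans
          (cong₂ _⊕_ (trans (∂a τ ∈Up) (cut-in Up (fun c) ∈Up)) (bd-lo-up f f-on τ ∈Up))
          (ℤₚ.+-identityʳ _)
        eq τ (inj₂ ∈Lo) = trans
          (cong (bd (fun a) τ ⊕_) (trans (∂f τ ∈Lo) (cut-in S (fun (c ⊝ bdᴬ a)) (lo⇒S ∈Lo))))
          (arith (bd (fun a) τ) (fun c τ))
          where
          arith : ∀ x y → x ⊕ (y ⊕ ⊖ x) ≡ y
          arith = ℤ-Solver.solve-∀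

  -- Exactness at `S`: a filling over `Up` moves the cycle into `Lo`, where the remainder is filled.
  vanish-split : Vanish Up k → Vanish Lo k → Vanish S k
  vanish-split V-up V-lo c c-on c-cyc =
    let a , a-on , ∂a = V-up (cutᴬ Up c) (cut-on Up c) (cut-cycle c c-on c-cyc)
    in  remainder-bounds c c-on a a-on ∂a
          (V-lo (remainder c c-on a a-on ∂a) (remainder-on c c-on a a-on ∂a)
            (λ τ τ∈Lo → trans (bd-reduced S c a c-on (on-up⇒S a a-on) τ (lo⇒S τ∈Lo))
                              (c-cyc τ (lo⇒S τ∈Lo))))

  private
    -- A cycle of Lo bounding in S bounds in Lo as soon as the cut-off of the filling bounds in Up.
    push-down : (c : Alt n k) → On Lo c → (a : Alt n (suc k)) (a-on : On S a) →
                (∀ τ → τ ∈ʳ S → bd (fun a) τ ≡ fun c τ) → BoundsOn Up (cutᴬ Up a) → BoundsOn Lo c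
    push-down c c-on a a-on ∂a (b , b-on , ∂b) =
      remainder a a-on b b-on ∂b , remainder-on a a-on b b-on ∂b ,
      λ τ τ∈Lo → trans (bd-reduced S a b a-on (on-up⇒S b b-on) τ (lo⇒S τ∈Lo)) (∂a τ (lo⇒S τ∈Lo))

    filling-cycle : (c : Alt n k) → On Lo c → (a : Alt n (suc k)) → On S a →
                    (∀ τ → τ ∈ʳ S → bd (fun a) τ ≡ fun c τ) → CycleOn Up (cutᴬ Up a)
    filling-cycle c c-on a a-on ∂a τ τ∈Up =
      trans (bd-cut-up a a-on τ τ∈Up) (trans (∂a τ (up⇒S τ∈Up)) (c-on τ (up∧lo⇒⊥ τ∈Up)))

  -- Exactness at `Lo`.
  vanish-lower : Vanish S k → Vanish Up (suc k) → Vanish Lo k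
  vanish-lower V-S V-up c c-on c-cyc =
    let a , a-on , ∂a = V-S c (on-lo⇒S c c-on) (extend-cycle c c-on c-cyc)
    in  push-down c c-on a a-on ∂a
          (V-up (cutᴬ Up a) (cut-on Up a) (filling-cycle c c-on a a-on ∂a))

  -- Exactness at `Up`.
  vanish-upper : Vanish S (suc k) → Vanish Lo k → Vanish Up (suc k)
  vanish-upper V-S V-lo c c-on c-cyc =
    let f , f-on , ∂f = V-lo (connect c) (cut-on Lo (bdᴬ c)) (connect-cycle c c-on c-cyc)
    in  lift-bounds c c-on c-cyc f f-on
          (V-S (c ⊝ f) (lift-on c c-on c-cyc f f-on) (lift-cycle c c-on c-cyc f f-on ∂f))

  -- The connecting map is onto because `S` has no homology in degree `k`.
  nonvanish-up-from-lo : Vanish S k → NonVanish Lo k → NonVanish Up (suc k)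
  nonvanish-up-from-lo V-S (c , c-on , c-cyc , ¬b) =
    let a , a-on , ∂a = V-S c (on-lo⇒S c c-on) (extend-cycle c c-on c-cyc)
    in  cutᴬ Up a , cut-on Up a , filling-cycle c c-on a a-on ∂a , ¬b ∘ push-down c c-on a a-on ∂a

  -- The connecting map is injective because `S` has no homology in degree `suc k`.
  nonvanish-lo-from-up : Vanish S (suc k) → NonVanish Up (suc k) → NonVanish Lo k
  nonvanish-lo-from-up V-S (c , c-on , c-cyc , ¬b) =
    connect c , cut-on Lo (bdᴬ c) , connect-cycle c c-on c-cyc , λ (f , f-on , ∂f) →
      ¬b (lift-bounds c c-on c-cyc f f-on
           (V-S (c ⊝ f) (lift-on c c-on c-cyc f f-on) (lift-cycle c c-on c-cyc f f-on ∂f)))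

  -- The map from `Lo` to `S` is injective in degree `k`.
  nonvanish-from-lo : Vanish Up (suc k) → NonVanish Lo k → NonVanish S k
  nonvanish-from-lo V-up (c , c-on , c-cyc , ¬b) =
    c , on-lo⇒S c c-on , extend-cycle c c-on c-cyc , λ (a , a-on , ∂a) →
      ¬b (push-down c c-on a a-on ∂a
           (V-up (cutᴬ Up a) (cut-on Up a) (filling-cycle c c-on a a-on ∂a)))

  -- The map from `S` to `Up` is onto, since the connecting map has target zero.
  nonvanish-from-up : Vanish Lo k → NonVanish Up (suc k) → NonVanish S (suc k)
  nonvanish-from-up V-lo (c , c-on , c-cyc , ¬b) =
    let f , f-on , ∂f = V-lo (connect c) (cut-on Lo (bdᴬ c)) (connect-cycle c c-on c-cyc)
    in  c ⊝ f , lift-on c c-on c-cyc f f-on , lift-cycle c c-on c-cyc f f-on ∂f ,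
        ¬b ∘ lift-bounds c c-on c-cyc f f-on

  -- The map from `Lo` to `S` is onto in degree `k`, so a nonzero class of `S` comes from one of
  -- `Lo`.
  nonvanish-to-lo : Vanish Up k → NonVanish S k → NonVanish Lo k
  nonvanish-to-lo V-up (c , c-on , c-cyc , ¬b) =
    let a , a-on , ∂a = V-up (cutᴬ Up c) (cut-on Up c) (cut-cycle c c-on c-cyc)
    in  remainder c c-on a a-on ∂a , remainder-on c c-on a a-on ∂a ,
        (λ τ τ∈Lo → trans (bd-reduced S c a c-on (on-up⇒S a a-on) τ (lo⇒S τ∈Lo))
                          (c-cyc τ (lo⇒S τ∈Lo))) ,
        ¬b ∘ remainder-bounds c c-on a a-on ∂a

⋃ : {I : Set} → (I → UpSet n) → List I → UpSet n
⋃ P is = mkUp (λ σ → Any (λ i → Holds (P i) σ) is) (λ σ → any? (λ i → holds? (P i) σ) is)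
              (λ s → Any.map (λ {i} → mono (P i) s))

-- Simplices are sorted by the last index of the list at which `P` holds: in `found`, the list `js`
-- stands for the indices after `i`, which are excluded. Simplices satisfying no `P i` are left to
-- the final hypothesis.
vanish-search : {I : Set} (P : I → UpSet n) (U N : UpSet n) (is : List I) →
                (∀ i js → Vanish (U ∩ P i ∖ N ∪ ⋃ P js) k) → Vanish (U ∖ N ∪ ⋃ P is) k →
                Vanish (U ∖ N) k
vanish-search P U N []       found none =
  vanish-resp {R = U ∖ N ∪ ⋃ P []} {R′ = U ∖ N} (λ σ (u , ¬n) → u , ¬n ∘ inj₁) (λ σ (u , ¬n) → u , [ ¬n , (λ ()) ]′) none
vanish-search P U N (i ∷ is) found none = vanish-search P U N is found
  (vanish-split U (N ∪ ⋃ P is) (P i) (found i is)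
    (vanish-resp {R = U ∖ N ∪ ⋃ P (i ∷ is)} {R′ = U ∖ (N ∪ ⋃ P is) ∪ P i}
    (λ σ (u , ¬n) → u , [ [ ¬n ∘ inj₁ , ¬n ∘ inj₂ ∘ there ]′ , ¬n ∘ inj₂ ∘ here ]′)
    (λ σ (u , ¬n) → u , [ ¬n ∘ inj₁ ∘ inj₁ , (λ { (here p) → ¬n (inj₂ p)
                                                ; (there p) → ¬n (inj₁ (inj₂ p)) }) ]′)
    none))

-- Fillings can be chosen separately on each fibre of a locally constant κ.
vanish-fibres : {K : Set} (κ : Tuple n → K) (R : Region n) (Rₖ : K → Region n) →
                (∀ σ → σ ∈ʳ R → σ ∈ʳ Rₖ (κ σ)) → (∀ q σ → σ ∈ʳ Rₖ q → σ ∈ʳ R × κ σ ≡ q) →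
                (∀ v τ → τ ∈ʳ R → (v ∷ τ) ∈ʳ R → κ (v ∷ τ) ≡ κ τ) →
                (∀ q → Vanish (Rₖ q) k) → Vanish R k
vanish-fibres {n} {k} κ R Rₖ to from const V c c-on c-cyc =
  e , (λ σ → cut-out R piece) , λ τ τ∈R → trans (Σᵛ-cong (e-near τ τ∈R))
    (trans (proj₂ (proj₂ (filling (κ τ))) τ (to τ τ∈R)) (cut-in (Rₖ (κ τ)) (fun c) (to τ τ∈R)))
  where
  bd-cut : ∀ q τ → τ ∈ʳ Rₖ q → bd (cut (Rₖ q) (fun c)) τ ≡ bd (fun c) τ
  bd-cut q τ τ∈q = Σᵛ-cong pointwise
    where
    pointwise : ∀ v → cut (Rₖ q) (fun c) (v ∷ τ) ≡ fun c (v ∷ τ)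
    pointwise v with (v ∷ τ) ∈ʳ? Rₖ q
    ... | yes _ = refl
    ... | no ∉q = sym (c-on _ λ ∈R →
      let τ∈R , κτ≡q = from q τ τ∈q
      in  ∉q (subst (λ p → (v ∷ τ) ∈ʳ Rₖ p) (trans (const v τ τ∈R ∈R) κτ≡q) (to _ ∈R)))

  filling : ∀ q → BoundsOn (Rₖ q) (cutᴬ (Rₖ q) c)
  filling q = V q (cutᴬ (Rₖ q) c) (cut-on (Rₖ q) c) λ τ τ∈q →
    trans (bd-cut q τ τ∈q) (c-cyc τ (proj₁ (from q τ τ∈q)))

  piece : Tuple n → ℤ
  piece σ = fun (proj₁ (filling (κ σ))) σ

  e : Alt n (suc k)
  e = mkAlt (cut R piece) e-alt e-grade
    where
    e-alt : Alternating (cut R piece)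
    e-alt ρ x y τ with (ρ ++ x ∷ y ∷ τ) ∈ʳ? R
    ... | no ∉R = cong ⊖_ (sym (cut-out R piece
                    (λ p → ∉R (∈ʳ-resp R (swap-⊆ ρ y x τ) (swap-⊆ ρ x y τ) p))))
    ... | yes ∈R =
      let swapped∈ = ∈ʳ-resp (Rₖ _) (swap-⊆ ρ x y τ) (swap-⊆ ρ y x τ) (to _ ∈R)
          ∈R′ , κ≡ = from _ _ swapped∈
      in  trans (alt (proj₁ (filling _)) ρ x y τ) (cong ⊖_ (sym
            (trans (cut-in R piece ∈R′)
                   (cong (λ q → fun (proj₁ (filling q)) (ρ ++ y ∷ x ∷ τ)) κ≡))))
    e-grade : Graded (suc k) (cut R piece)
    e-grade σ σ≢k with does (σ ∈ʳ? R)
    ... | true  = grade (proj₁ (filling (κ σ))) σ σ≢k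
    ... | false = refl

  e-near : ∀ τ → τ ∈ʳ R → ∀ v → cut R piece (v ∷ τ) ≡ fun (proj₁ (filling (κ τ))) (v ∷ τ)
  e-near τ τ∈R v with (v ∷ τ) ∈ʳ? R
  ... | yes ∈R = cong (λ q → fun (proj₁ (filling q)) (v ∷ τ)) (const v τ τ∈R ∈R)
  ... | no  ∉R = sym (proj₁ (proj₂ (filling (κ τ))) _ (∉R ∘ proj₁ ∘ from _ _))

-- Subcubes and the subcube spanned by a tuple

-- A pattern records for each coordinate which of the values false and true are allowed; the
-- subcubes are the patterns allowing at least one value everywhere, and their weight is n plus
-- their dimension.

Pattern : ℕ → Set
Pattern n = Vec (Bool × Bool) n

pick : Bool → Bool × Bool → Bool
pick false = proj₁
pick true  = proj₂

allows : Pattern n → Fin n → Bool → Bool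
allows p j b = pick b (lookup p j)

_⊑_ : Pattern n → Pattern n → Set
p ⊑ q = ∀ j b → allows p j b ≡ true → allows q j b ≡ true

_∈ᵖ_ : Vertex n → Pattern n → Set
x ∈ᵖ q = ∀ j → allows q j (lookup x j) ≡ true

_∈ᵖ?_ : (x : Vertex n) (q : Pattern n) → Dec (x ∈ᵖ q)
x ∈ᵖ? q = Finₚ.all? λ j → allows q j (lookup x j) 𝔹.≟ true

bit : Bool → ℕ
bit false = 0
bit true  = 1

weight : Pattern n → ℕ
weight []            = 0
weight ((a , b) ∷ p) = bit a + bit b + weight p

bit-mono : ∀ {a b} → (a ≡ true → b ≡ true) → bit a ≤ bit b
bit-mono {false} _ = z≤n
bit-mono {true}  h = ℕₚ.≤-reflexive (cong bit (sym (h refl)))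

weight-mono : {p q : Pattern n} → p ⊑ q → weight p ≤ weight q
weight-mono {p = []}    {[]}    _   = z≤n
weight-mono {p = _ ∷ p} {_ ∷ q} p⊑q =
  ℕₚ.+-mono-≤ (ℕₚ.+-mono-≤ (bit-mono (p⊑q zero false)) (bit-mono (p⊑q zero true)))
              (weight-mono {p = p} {q} (p⊑q ∘ suc))

weight-strict : {p q : Pattern n} → p ⊑ q → ∀ j b → allows q j b ≡ true → allows p j b ≡ false →
                weight p < weight q
weight-strict {p = (a , b) ∷ p} {(c , d) ∷ q} h zero false refl refl =
  s≤s (ℕₚ.+-mono-≤ (bit-mono (h zero true)) (weight-mono {p = p} {q} (h ∘ suc)))
weight-strict {p = (a , b) ∷ p} {(c , d) ∷ q} h zero true refl refl = begin-strict
  bit a + 0 + weight p     ≡⟨ cong (_+ weight p) (ℕₚ.+-identityʳ (bit a)) ⟩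
  bit a + weight p         ≤⟨ ℕₚ.+-mono-≤ (bit-mono (h zero false)) (weight-mono {p = p} {q} (h ∘ suc)) ⟩
  bit c + weight q         <⟨ ℕₚ.≤-refl ⟩
  suc (bit c + weight q)   ≡⟨ cong (_+ weight q) (ℕₚ.+-comm 1 (bit c)) ⟩
  bit c + 1 + weight q     ∎
  where open ℕₚ.≤-Reasoning
weight-strict {p = _ ∷ p} {_ ∷ q} h (suc j) b q-on p-off =
  ℕₚ.+-mono-≤-< (ℕₚ.+-mono-≤ (bit-mono (h zero false)) (bit-mono (h zero true)))
                (weight-strict {p = p} {q} (h ∘ suc) j b q-on p-off)

⊑-antisym : {p q : Pattern n} → p ⊑ q → q ⊑ p → p ≡ q
⊑-antisym {p = []}    {[]}    _   _   = refl
⊑-antisym {p = (a , b) ∷ p} {(c , d) ∷ q} h g =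
  cong₂ _∷_ (cong₂ _,_ (bool (h zero false) (g zero false)) (bool (h zero true) (g zero true)))
            (⊑-antisym (h ∘ suc) (g ∘ suc))
  where
  bool : ∀ {a b} → (a ≡ true → b ≡ true) → (b ≡ true → a ≡ true) → a ≡ b
  bool {false} {false} _ _ = refl
  bool {false} {true}  _ g = g refl
  bool {true}  {b}     h _ = sym (h refl)

-- Weight is strictly monotone. Hence `span` is locally constant on tuples of equal weight, which is
-- what `vanish-fibres` asks for.
⊑-weight⇒≡ : {p q : Pattern n} → p ⊑ q → weight q ≤ weight p → p ≡ q
⊑-weight⇒≡ {p = p} {q} p⊑q q≤p = ⊑-antisym p⊑q λ j b q-on →
  decidable-stable (allows p j b 𝔹.≟ true) λ p-off →
    contradiction q≤p (ℕₚ.<⇒≱ (weight-strict {p = p} {q} p⊑q j b q-on (𝔹.¬-not p-off)))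

weight≤2n : (p : Pattern n) → weight p ≤ n + n
weight≤2n []            = z≤n
weight≤2n {suc n} ((a , b) ∷ p) = subst (bit a + bit b + weight p ≤_) (cong suc (sym (ℕₚ.+-suc n n)))
  (ℕₚ.+-mono-≤ {x = bit a + bit b} {2} (ℕₚ.+-mono-≤ (bit≤1 a) (bit≤1 b)) (weight≤2n p))
  where
  bit≤1 : ∀ b → bit b ≤ 1
  bit≤1 false = z≤n
  bit≤1 true  = s≤s z≤n

put : Bool → Bool × Bool → Bool × Bool
put false (_ , b) = true , b
put true  (a , _) = a , true

span : Tuple n → Pattern n
span []      = Vec.replicate _ (false , false)
span (x ∷ σ) = Vec.zipWith put x (span σ)

Takes : Tuple n → Fin n → Bool → Set
Takes σ j b = Any (λ x → lookup x j ≡ b) σ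

span⇒takes : (σ : Tuple n) (j : Fin n) (b : Bool) → allows (span σ) j b ≡ true → Takes σ j b
span⇒takes [] j false eq = contradiction (trans (sym eq) (cong proj₁ (Vecₚ.lookup-replicate j (false , false)))) λ ()
span⇒takes [] j true  eq = contradiction (trans (sym eq) (cong proj₂ (Vecₚ.lookup-replicate j (false , false)))) λ ()
span⇒takes (x ∷ σ) j b eq = step b (lookup x j) refl
  (trans (sym (cong (pick b) (Vecₚ.lookup-zipWith put j x (span σ)))) eq)
  where
  step : ∀ b xj → lookup x j ≡ xj → pick b (put (lookup x j) (lookup (span σ) j)) ≡ true → Takes (x ∷ σ) j b
  step false false eq′ _   = here eq′
  step true  true  eq′ _   = here eq′
  step false true  eq′ on  = there (span⇒takes σ j false (trans (cong (λ c → pick false (put c (lookup (span σ) j))) (sym eq′)) on))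
  step true  false eq′ on  = there (span⇒takes σ j true (trans (cong (λ c → pick true (put c (lookup (span σ) j))) (sym eq′)) on))

takes⇒span : (σ : Tuple n) (j : Fin n) (b : Bool) → Takes σ j b → allows (span σ) j b ≡ true
takes⇒span (x ∷ σ) j b t = trans (cong (pick b) (Vecₚ.lookup-zipWith put j x (span σ))) (step b t)
  where
  step : ∀ b → Takes (x ∷ σ) j b → pick b (put (lookup x j) (lookup (span σ) j)) ≡ true
  step false (here eq) rewrite eq = refl
  step true  (here eq) rewrite eq = refl
  step false (there t) with lookup x j
  ... | false = refl
  ... | true  = takes⇒span σ j false t
  step true  (there t) with lookup x j
  ... | false = takes⇒span σ j true t
  ... | true  = refl

span-mono : {σ τ : Tuple n} → σ ⊆ τ → span σ ⊑ span τ
span-mono {σ = σ} {τ} s j b on = takes⇒span τ j b (⊆ₚ.Any-resp-⊆ s (span⇒takes σ j b on))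

∈⇒∈ᵖspan : {σ : Tuple n} {x : Vertex n} → x ∈ σ → x ∈ᵖ span σ
∈⇒∈ᵖspan {σ = σ} x∈σ j = takes⇒span σ j _ (lose x∈σ refl)

span⊑ : {σ : Tuple n} {q : Pattern n} → (∀ {x} → x ∈ σ → x ∈ᵖ q) → span σ ⊑ q
span⊑ {σ = σ} {q} h j b on with x , x∈σ , eq ← find (span⇒takes σ j b on) =
  subst (λ b → allows q j b ≡ true) eq (h x∈σ j)

span-∷ : {σ : Tuple n} {x : Vertex n} → x ∈ᵖ span σ → span (x ∷ σ) ⊑ span σ
span-∷ {σ = σ} {x} x∈ = span⊑ {σ = x ∷ σ} {span σ} λ { (here refl) → x∈ ; (there p) → ∈⇒∈ᵖspan p }

weight-[] : weight (span {n} []) ≡ 0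
weight-[] {zero}  = refl
weight-[] {suc n} = weight-[] {n}

weight-vertex : (x : Vertex n) → weight (span (x ∷ [])) ≡ n
weight-vertex []          = refl
weight-vertex (false ∷ x) = cong suc (weight-vertex x)
weight-vertex (true ∷ x)  = cong suc (weight-vertex x)

covers outside : Pattern n → UpSet n
covers q = mkUp (λ σ → q ⊑ span σ)
  (λ σ → Finₚ.all? λ j → map′ (λ { (f , t) false → f ; (f , t) true → t }) (λ h → h false , h true)
                              (imp j false σ ×-dec imp j true σ))
  (λ {σ} {τ} s q⊑ j b on → span-mono {σ = σ} {τ} s j b (q⊑ j b on))
  where
  imp : ∀ j b σ → Dec (allows q j b ≡ true → allows (span σ) j b ≡ true)
  imp j b σ with allows q j b | allows (span σ) j b
  ... | false | _     = yes λ ()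
  ... | true  | true  = yes λ _ → refl
  ... | true  | false = no λ h → contradiction (h refl) λ ()
outside q = mkUp (λ σ → Any (λ x → ¬ x ∈ᵖ q) σ) (λ σ → any? (λ x → ¬? (x ∈ᵖ? q)) σ) (λ s → ⊆ₚ.Any-resp-⊆ s)

¬outside⇒ : {q : Pattern n} {σ : Tuple n} → ¬ Holds (outside q) σ → ∀ {x} → x ∈ σ → x ∈ᵖ q
¬outside⇒ {q = q} ¬o {x} x∈σ = decidable-stable (x ∈ᵖ? q) (λ x∉q → ¬o (lose x∈σ x∉q))

⇒¬outside : {q : Pattern n} {σ : Tuple n} → (∀ {x} → x ∈ σ → x ∈ᵖ q) → ¬ Holds (outside q) σ
⇒¬outside h o with x , x∈σ , x∉q ← find o = x∉q (h x∈σ)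

weighs : ℕ → UpSet n
weighs w = mkUp (λ σ → w ≤ weight (span σ)) (λ σ → w ≤? weight (span σ))
  (λ {σ} {τ} s w≤ → ℕₚ.≤-trans w≤ (weight-mono {p = span σ} {span τ} (span-mono s)))

exactly : Pattern n → Region n
exactly q = covers q ∖ outside q

exactly⇒≡ : {q : Pattern n} {σ : Tuple n} → σ ∈ʳ exactly q → span σ ≡ q
exactly⇒≡ {q = q} {σ} (c , ¬o) = ⊑-antisym {p = span σ} {q} (span⊑ {σ = σ} {q} (¬outside⇒ {q = q} ¬o)) c

≡⇒exactly : {q : Pattern n} {σ : Tuple n} → span σ ≡ q → σ ∈ʳ exactly q
≡⇒exactly {σ = σ} refl = (λ j b on → on) , ⇒¬outside {q = span σ} ∈⇒∈ᵖspan

vertices-complete : (v : Vertex n) → v ∈ allVertices n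
vertices-complete []          = here refl
vertices-complete (false ∷ v) = ∈ₚ.∈-concatMap⁺ _ (Any.map (λ { refl → here refl }) (vertices-complete v))
vertices-complete (true ∷ v)  = ∈ₚ.∈-concatMap⁺ _ (Any.map (λ { refl → there (here refl) }) (vertices-complete v))

-- Relative homology of the tuples spanning a given cube

Star : Pattern n → Fin n → Set
Star q i = allows q i false ≡ true × allows q i true ≡ true

star? : (q : Pattern n) → Dec (∃ (Star q))
star? q = Finₚ.any? λ i → (allows q i false 𝔹.≟ true) ×-dec (allows q i true 𝔹.≟ true)

facet : Pattern n → Fin n → Pattern n
facet q i = q [ i ]≔ (false , true)

facet-at : (q : Pattern n) (i : Fin n) (b : Bool) → allows (facet q i) i b ≡ b
facet-at q i false = cong proj₁ (Vecₚ.lookup∘updateAt i q)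
facet-at q i true  = cong proj₂ (Vecₚ.lookup∘updateAt i q)

facet-off : (q : Pattern n) {i j : Fin n} (b : Bool) → j ≢ i → allows (facet q i) j b ≡ allows q j b
facet-off q {i} {j} b j≢i = cong (pick b) (Vecₚ.lookup∘updateAt′ j i j≢i q)

facet-weight : (q : Pattern n) (i : Fin n) → Star q i → weight q ≡ suc (weight (facet q i))
facet-weight ((true , true) ∷ q) zero    (refl , refl) = refl
facet-weight ((a , b) ∷ q)       (suc i) s             =
  trans (cong (bit a + bit b +_) (facet-weight q i s)) (ℕₚ.+-suc (bit a + bit b) _)

module _ (q : Pattern n) (i : Fin n) (star : Star q i) where

  facet⊑ : facet q i ⊑ q
  facet⊑ j b on with j Finₚ.≟ i
  ... | no  j≢i  = trans (sym (facet-off q b j≢i)) on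
  ... | yes refl with b
  ...   | false = proj₁ star
  ...   | true  = proj₂ star

  ∈facet : (x : Vertex n) → x ∈ᵖ q → lookup x i ≡ true → x ∈ᵖ facet q i
  ∈facet x x∈q xi j with j Finₚ.≟ i
  ... | no  j≢i  = trans (facet-off q (lookup x j) j≢i) (x∈q j)
  ... | yes refl = trans (facet-at q i (lookup x i)) xi

  facet⇒value : (x : Vertex n) → x ∈ᵖ facet q i → lookup x i ≡ true
  facet⇒value x x∈ = trans (sym (facet-at q i (lookup x i))) (x∈ i)

  covers-facet⇒ : {σ : Tuple n} → facet q i ⊑ span σ → Takes σ i false → q ⊑ span σ
  covers-facet⇒ {σ} c t j b on with j Finₚ.≟ i
  ... | no  j≢i  = c j b (trans (facet-off q b j≢i) on)
  ... | yes refl with b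
  ...   | false = takes⇒span σ i false t
  ...   | true  = c i true (facet-at q i true)

  private
    containing : Vertex n → UpSet n
    containing v = mkUp (λ σ → lookup v i ≡ true × v ∈ σ)
      (λ σ → (lookup v i 𝔹.≟ true) ×-dec any? (v ≟ᵛ_) σ) (λ s (vi , v∈) → vi , s v∈)

  -- The exact simplices of a cube together with those of one of its facets: pair (1,p) with (0,p).
  vanish-cube∪facet : Vanish (covers (facet q i) ∖ outside q) k
  vanish-cube∪facet = vanish-search containing (covers (facet q i)) (outside q) (allVertices n) found
    (vanish-empty {R = covers (facet q i) ∖ outside q ∪ ⋃ containing (allVertices n)} λ { σ _ (c , ¬n) →
      let x , x∈σ , xi = find (span⇒takes σ i true (c i true (facet-at q i true)))
      in  ¬n (inj₂ (lose (vertices-complete x) (xi , x∈σ))) })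
    where
    found : ∀ v ws → Vanish (covers (facet q i) ∩ containing v ∖ outside q ∪ ⋃ containing ws) _
    -- `v⁰` has the value false at `i`, so toggling it leaves the vertices with value true
    -- untouched; elsewhere it agrees with `v`, so the facet stays covered.
    found v ws = toggle {R = covers (facet q i) ∩ containing v ∖ outside q ∪ ⋃ containing ws} v⁰
      (λ τ ((c , vi , v∈) , ¬n) → (mono (covers (facet q i)) {τ} {v⁰ ∷ τ} there c , vi , there v∈) ,
        [ ⇒¬outside {q = q} (λ { (here refl) → v⁰∈q vi (¬outside⇒ {q = q} (¬n ∘ inj₁) v∈)
                               ; (there p) → ¬outside⇒ {q = q} (¬n ∘ inj₁) p })
        , ¬n ∘ inj₂ ∘ Any.map (λ { (wi , here refl) → contradiction (trans (sym wi) v⁰i) λ ()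
                                 ; (wi , there w∈) → wi , w∈ }) ]′)
      (λ τ ((c , vi , v∈) , ¬n) →
        let v∈τ = case v∈ of λ { (here v≡v⁰) → contradiction (trans (sym vi) (trans (cong (λ v → lookup v i) v≡v⁰) v⁰i)) λ ()
                               ; (there p) → p }
        in ((λ j b on → takes⇒span τ j b (drop j b on v∈τ (span⇒takes (v⁰ ∷ τ) j b (c j b on)))) , vi , v∈τ) ,
           [ ¬n ∘ inj₁ ∘ there , ¬n ∘ inj₂ ∘ Any.map (λ (wi , w∈) → wi , there w∈) ]′)
      where
      v⁰ : Vertex n
      v⁰ = v [ i ]≔ false
      v⁰i : lookup v⁰ i ≡ false
      v⁰i = Vecₚ.lookup∘updateAt i v
      v⁰∈q : lookup v i ≡ true → v ∈ᵖ q → v⁰ ∈ᵖ q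
      v⁰∈q vi v∈q j with j Finₚ.≟ i
      ... | no  j≢i  = subst (λ b → allows q j b ≡ true) (sym (Vecₚ.lookup∘updateAt′ j i j≢i v)) (v∈q j)
      ... | yes refl = subst (λ b → allows q i b ≡ true) (sym v⁰i) (proj₁ star)
      drop : ∀ {τ} j b → allows (facet q i) j b ≡ true → v ∈ τ → Takes (v⁰ ∷ τ) j b → Takes τ j b
      drop j b on v∈τ (there t) = t
      drop j b on v∈τ (here v⁰j) with j Finₚ.≟ i
      ... | no  j≢i  = lose v∈τ (trans (sym (Vecₚ.lookup∘updateAt′ j i j≢i v)) v⁰j)
      ... | yes refl = contradiction (trans (sym on) (trans (cong (allows (facet q i) i) (trans (sym v⁰j) v⁰i)) (facet-at q i false))) λ ()

  -- Splitting the acyclic region of `vanish-cube∪facet` along `covers q` leaves `exactly q` above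
  -- and `exactly (facet q i)` below. The connecting map thus lowers cube and degree together by
  -- one.
  upper⇒exactly : ∀ σ → σ ∈ʳ (covers (facet q i) ∩ covers q ∖ outside q) → σ ∈ʳ exactly q
  upper⇒exactly σ ((_ , c) , ¬o) = c , ¬o

  exactly⇒upper : ∀ σ → σ ∈ʳ exactly q → σ ∈ʳ (covers (facet q i) ∩ covers q ∖ outside q)
  exactly⇒upper σ (c , ¬o) = ((λ j b → c j b ∘ facet⊑ j b) , c) , ¬o

  lower⇒exactly : ∀ σ → σ ∈ʳ (covers (facet q i) ∖ outside q ∪ covers q) → σ ∈ʳ exactly (facet q i)
  lower⇒exactly σ (c , ¬n) = c , ⇒¬outside {q = facet q i} λ {x} x∈σ →
    ∈facet x (¬outside⇒ {q = q} (¬n ∘ inj₁) x∈σ)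
      (𝔹.¬-not λ xi → ¬n (inj₂ (covers-facet⇒ c (lose x∈σ xi))))

  exactly⇒lower : ∀ σ → σ ∈ʳ exactly (facet q i) → σ ∈ʳ (covers (facet q i) ∖ outside q ∪ covers q)
  exactly⇒lower σ (c , ¬o) = c , [ ⇒¬outside {q = q} (λ {x} x∈σ j → facet⊑ j (lookup x j) (¬outside⇒ {q = facet q i} ¬o x∈σ j))
                                 , (λ cq → let x , x∈σ , xi = find (span⇒takes σ i false (cq i false (proj₁ star)))
                                           in  contradiction (trans (sym xi) (facet⇒value x (¬outside⇒ {q = facet q i} ¬o x∈σ))) λ ()) ]′

vec-ext : {A : Set} {xs ys : Vec A n} → (∀ j → lookup xs j ≡ lookup ys j) → xs ≡ ys
vec-ext {xs = xs} {ys} h =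
  trans (sym (Vecₚ.tabulate∘lookup xs)) (trans (Vecₚ.tabulate-cong h) (Vecₚ.tabulate∘lookup ys))

no-star⇒≡ : {q : Pattern n} → ¬ ∃ (Star q) → (x y : Vertex n) → x ∈ᵖ q → y ∈ᵖ q → x ≡ y
no-star⇒≡ {q = q} ¬star x y x∈q y∈q = vec-ext λ j → eq j (lookup x j) (lookup y j) (x∈q j) (y∈q j)
  where
  eq : ∀ j a b → allows q j a ≡ true → allows q j b ≡ true → a ≡ b
  eq j false false _ _ = refl
  eq j true  true  _ _ = refl
  eq j false true  f t = contradiction (j , f , t) ¬star
  eq j true  false t f = contradiction (j , f , t) ¬star

-- The inequation says, without subtraction, that the dimension `w - n` of the cube differs from the
-- simplicial dimension `k`. Free coordinates are removed one at a time by the connecting map; a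
-- cube without any is a single vertex, and longer tuples in it repeat that vertex.
vanish-exactly : ∀ w (q : Pattern n) → weight q ≡ w → suc w ≢ n + suc k → Vanish (exactly q) (suc k)
vanish-exactly {n} {k} w q wq w≢ with star? q
vanish-exactly {n} {zero} w q wq w≢ | no ¬star = vanish-empty {R = exactly q} λ
  { [] () ; (_ ∷ _ ∷ _) () ; (x ∷ []) _ x∈ → w≢ (trans (cong suc (trans (sym wq) (trans (cong weight (sym (exactly⇒≡ {q = q} x∈))) (weight-vertex x))))
                              (ℕₚ.+-comm 1 n)) }
vanish-exactly {n} {suc k} w q wq w≢ | no ¬star = vanish-null {R = exactly q} λ
  { c c-on []          _ → grade c [] λ ()
  ; c c-on (x ∷ [])    _ → grade c (x ∷ []) λ ()
  ; c c-on (x ∷ y ∷ τ) (_ , ¬o) → subst (λ z → fun c (x ∷ z ∷ τ) ≡ 0ℤ)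
      (no-star⇒≡ {q = q} ¬star x y (¬outside⇒ {q = q} ¬o (here refl)) (¬outside⇒ {q = q} ¬o (there (here refl))))
      (alt-repeat (fun c) (alt c) [] x [] τ) }
vanish-exactly {n} {zero} w q wq w≢ | yes (i , on-f , on-t) = vanish-empty {R = exactly q} λ
  { [] () ; (_ ∷ _ ∷ _) () ; (x ∷ []) _ (c , _) → case span⇒takes (x ∷ []) i false (c i false on-f) , span⇒takes (x ∷ []) i true (c i true on-t) of λ
      { (here xf , here xt) → contradiction (trans (sym xf) xt) λ () } }
vanish-exactly {n} {suc k} zero q wq w≢ | yes (i , star) = contradiction (trans (sym wq) (facet-weight q i star)) λ ()
vanish-exactly {n} {suc k} (suc w) q wq w≢ | yes (i , star) =
  vanish-resp {R = covers (facet q i) ∩ covers q ∖ outside q} {exactly q} (upper⇒exactly q i star) (exactly⇒upper q i star)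
    (vanish-upper (covers (facet q i)) (outside q) (covers q) (vanish-cube∪facet q i star)
      (vanish-resp {R = exactly (facet q i)} {covers (facet q i) ∖ outside q ∪ covers q} (exactly⇒lower q i star) (lower⇒exactly q i star)
        (vanish-exactly w (facet q i) (ℕₚ.suc-injective (trans (sym (facet-weight q i star)) wq))
          (λ eq → w≢ (trans (cong suc eq) (sym (ℕₚ.+-suc n (suc k))))))))

-- Hamming geometry

hamming-refl : (x : Vertex n) → hamming x x ≡ 0
hamming-refl []          = refl
hamming-refl (true ∷ x)  = hamming-refl x
hamming-refl (false ∷ x) = hamming-refl x

hamming-sym : (x y : Vertex n) → hamming x y ≡ hamming y x
hamming-sym []          []          = refl
hamming-sym (true ∷ x)  (true ∷ y)  = hamming-sym x y
hamming-sym (false ∷ x) (false ∷ y) = hamming-sym x y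
hamming-sym (true ∷ x)  (false ∷ y) = cong suc (hamming-sym x y)
hamming-sym (false ∷ x) (true ∷ y)  = cong suc (hamming-sym x y)

hamming-0 : {x y : Vertex n} → hamming x y ≡ 0 → x ≡ y
hamming-0 {x = []}        {[]}        _  = refl
hamming-0 {x = true ∷ x}  {true ∷ y}  eq = cong (true ∷_) (hamming-0 eq)
hamming-0 {x = false ∷ x} {false ∷ y} eq = cong (false ∷_) (hamming-0 eq)

hamming-∷ : ∀ a b (x y : Vertex n) → hamming (a ∷ x) (b ∷ y) ≡ bit (a xor b) + hamming x y
hamming-∷ true  true  x y = refl
hamming-∷ false false x y = refl
hamming-∷ true  false x y = refl
hamming-∷ false true  x y = refl

fresh₁ : Bool → Bool → Bool → Bool → Bool
fresh₁ a b c z = (a xor z) ∧ (b xor z) ∧ (c xor z)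

-- The number of coordinates at which `z` takes a value that none of `a`, `b`, `c` takes. It is zero
-- exactly when `z` lies in the subcube spanned by these three.
fresh : (a b c z : Vertex n) → ℕ
fresh []      []      []      []      = 0
fresh (a ∷ p) (b ∷ q) (c ∷ r) (z ∷ s) = bit (fresh₁ a b c z) + fresh p q r s

-- Inequalities that are nonnegative combinations of Hamming distances hold as soon as they hold
-- for each coordinate, so they can be checked on the finitely many columns.
data Term (m : ℕ) : Set where
  dist : (i j : Fin m) → Term m
  frsh : (i j k l : Fin m) → Term m
  _⟨+⟩_ : Term m → Term m → Term m
  2·_  : Term m → Term m

infixr 6 _⟨+⟩_
infix  7 2·_

column : ∀ {m} → Term m → Vec Bool m → ℕ
column (dist i j)     c = bit (lookup c i xor lookup c j)
column (frsh i j k l) c = bit (fresh₁ (lookup c i) (lookup c j) (lookup c k) (lookup c l))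
column (s ⟨+⟩ t)      c = column s c + column t c
column (2· t)         c = 2 * column t c

⟦_⟧ : ∀ {m} → Term m → Vec (Vertex n) m → ℕ
⟦ dist i j     ⟧ vs = hamming (lookup vs i) (lookup vs j)
⟦ frsh i j k l ⟧ vs = fresh (lookup vs i) (lookup vs j) (lookup vs k) (lookup vs l)
⟦ s ⟨+⟩ t      ⟧ vs = ⟦ s ⟧ vs + ⟦ t ⟧ vs
⟦ 2· t         ⟧ vs = 2 * ⟦ t ⟧ vs

private
  lookup-split : ∀ {m} (vs : Vec (Vertex (suc n)) m) (i : Fin m) →
                 lookup vs i ≡ lookup (Vec.map Vec.head vs) i ∷ lookup (Vec.map Vec.tail vs) i
  lookup-split ((a ∷ x) ∷ vs) zero    = refl
  lookup-split (_ ∷ vs)       (suc i) = lookup-split vs i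

  ⟦⟧-zero : ∀ {m} (t : Term m) (vs : Vec (Vertex 0) m) → ⟦ t ⟧ vs ≡ 0
  ⟦⟧-zero (dist i j)     vs with [] ← lookup vs i | [] ← lookup vs j = refl
  ⟦⟧-zero (frsh i j k l) vs with [] ← lookup vs i | [] ← lookup vs j | [] ← lookup vs k | [] ← lookup vs l = refl
  ⟦⟧-zero (s ⟨+⟩ t)      vs = cong₂ _+_ (⟦⟧-zero s vs) (⟦⟧-zero t vs)
  ⟦⟧-zero (2· t)         vs = cong (2 *_) (⟦⟧-zero t vs)

  ⟦⟧-suc : ∀ {m} (t : Term m) (vs : Vec (Vertex (suc n)) m) →
           ⟦ t ⟧ vs ≡ column t (Vec.map Vec.head vs) + ⟦ t ⟧ (Vec.map Vec.tail vs)
  ⟦⟧-suc (dist i j) vs = trans (cong₂ hamming (lookup-split vs i) (lookup-split vs j))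
    (hamming-∷ (lookup (Vec.map Vec.head vs) i) _ _ _)
  ⟦⟧-suc (frsh i j k l) vs
    rewrite lookup-split vs i | lookup-split vs j | lookup-split vs k | lookup-split vs l = refl
  ⟦⟧-suc (s ⟨+⟩ t) vs = trans (cong₂ _+_ (⟦⟧-suc s vs) (⟦⟧-suc t vs)) (arith (column s _) _ _ _)
    where
    arith : ∀ a b c d → (a + b) + (c + d) ≡ (a + c) + (b + d)
    arith = ℕ-Solver.solve-∀
  ⟦⟧-suc (2· t) vs = trans (cong (2 *_) (⟦⟧-suc t vs)) (ℕₚ.*-distribˡ-+ 2 (column t _) _)

columnwise : ∀ {m} (s t : Term m) → True (all? (λ c → column s c ≤? column t c) (allVertices m)) →
             (vs : Vec (Vertex n) m) → ⟦ s ⟧ vs ≤ ⟦ t ⟧ vs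
columnwise {n} {m} s t checked = go n
  where
  go : ∀ n (vs : Vec (Vertex n) m) → ⟦ s ⟧ vs ≤ ⟦ t ⟧ vs
  go zero    vs = ℕₚ.≤-reflexive (trans (⟦⟧-zero s vs) (sym (⟦⟧-zero t vs)))
  go (suc n) vs = begin
    ⟦ s ⟧ vs                                                       ≡⟨ ⟦⟧-suc s vs ⟩
    column s (Vec.map Vec.head vs) + ⟦ s ⟧ (Vec.map Vec.tail vs)   ≤⟨ ℕₚ.+-mono-≤ (All.lookup (toWitness checked) (vertices-complete _)) (go n _) ⟩
    column t (Vec.map Vec.head vs) + ⟦ t ⟧ (Vec.map Vec.tail vs)   ≡⟨ ⟦⟧-suc t vs ⟨
    ⟦ t ⟧ vs                                                       ∎
    where open ℕₚ.≤-Reasoning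

#0 : ∀ {m} → Fin (1 + m)
#0 = zero
#1 : ∀ {m} → Fin (2 + m)
#1 = suc #0
#2 : ∀ {m} → Fin (3 + m)
#2 = suc #1
#3 : ∀ {m} → Fin (4 + m)
#3 = suc #2
#4 : ∀ {m} → Fin (5 + m)
#4 = suc #3
#5 : ∀ {m} → Fin (6 + m)
#5 = suc #4
#6 : ∀ {m} → Fin (7 + m)
#6 = suc #5

hamming-triangle : (x y z : Vertex n) → hamming x z ≤ hamming x y + hamming y z
hamming-triangle x y z =
  columnwise (dist #0 #2) (dist #0 #1 ⟨+⟩ dist #1 #2) _ (x ∷ y ∷ z ∷ [])

-- The next four inequalities are Farkas certificates for the geometric lemmas below.

square-inequality : (p q u v x y z : Vertex n) →
  2 * hamming p q + (2 * hamming u v + (2 * hamming x u + (2 * hamming y v + 2 * (2 * fresh p q x z)))) ≤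
  2 * hamming p u + (2 * hamming q u + (2 * hamming p v + (2 * hamming q v + (hamming y p + (hamming y q +
  (hamming x y + (hamming z p + (hamming z q + (hamming z x + hamming z y)))))))))
square-inequality p q u v x y z = columnwise
  (2· dist #0 #1 ⟨+⟩ 2· dist #2 #3 ⟨+⟩ 2· dist #4 #2 ⟨+⟩ 2· dist #5 #3 ⟨+⟩ 2· (2· frsh #0 #1 #4 #6))
  (2· dist #0 #2 ⟨+⟩ 2· dist #1 #2 ⟨+⟩ 2· dist #0 #3 ⟨+⟩ 2· dist #1 #3 ⟨+⟩ dist #5 #0 ⟨+⟩ dist #5 #1 ⟨+⟩
   dist #4 #5 ⟨+⟩ dist #6 #0 ⟨+⟩ dist #6 #1 ⟨+⟩ dist #6 #4 ⟨+⟩ dist #6 #5)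
  _ (p ∷ q ∷ u ∷ v ∷ x ∷ y ∷ z ∷ [])

tripod-inequality : (p a o r x z : Vertex n) →
  2 * hamming p o + (2 * hamming p r + (2 * hamming o r + (2 * hamming x a + 2 * (2 * fresh p o r z)))) ≤
  2 * hamming p a + (2 * hamming a o + (2 * hamming a r + (hamming x p + (hamming x o + (hamming x r +
  (hamming z p + (hamming z o + (hamming z r + hamming z x))))))))
tripod-inequality p a o r x z = columnwise
  (2· dist #0 #2 ⟨+⟩ 2· dist #0 #3 ⟨+⟩ 2· dist #2 #3 ⟨+⟩ 2· dist #4 #1 ⟨+⟩ 2· (2· frsh #0 #2 #3 #5))
  (2· dist #0 #1 ⟨+⟩ 2· dist #1 #2 ⟨+⟩ 2· dist #1 #3 ⟨+⟩ dist #4 #0 ⟨+⟩ dist #4 #2 ⟨+⟩ dist #4 #3 ⟨+⟩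
   dist #5 #0 ⟨+⟩ dist #5 #2 ⟨+⟩ dist #5 #3 ⟨+⟩ dist #5 #4)
  _ (p ∷ a ∷ o ∷ r ∷ x ∷ z ∷ [])

segment-inequality : (p o x z : Vertex n) →
  hamming p o + 2 * fresh p o x z ≤ hamming z p + hamming z o
segment-inequality p o x z = columnwise
  (dist #0 #1 ⟨+⟩ 2· frsh #0 #1 #2 #3) (dist #3 #0 ⟨+⟩ dist #3 #1) _ (p ∷ o ∷ x ∷ z ∷ [])

corner-inequality : (o r u p z : Vertex n) →
  2 * hamming o r + (hamming p u + 2 * fresh o r r z) ≤
  hamming o u + (hamming r u + (hamming p o + (hamming p r + (hamming z u + hamming z p))))
corner-inequality o r u p z = columnwise
  (2· dist #0 #1 ⟨+⟩ dist #3 #2 ⟨+⟩ 2· frsh #0 #1 #1 #4)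
  (dist #0 #2 ⟨+⟩ dist #1 #2 ⟨+⟩ dist #3 #0 ⟨+⟩ dist #3 #1 ⟨+⟩ dist #4 #2 ⟨+⟩ dist #4 #3)
  _ (o ∷ r ∷ u ∷ p ∷ z ∷ [])

private
  agree : ∀ {a b c z : Bool} → fresh₁ a b c z ≡ false → a ≡ z ⊎ b ≡ z ⊎ c ≡ z
  agree {false} {b} {c} {false} _ = inj₁ refl
  agree {true}  {b} {c} {true}  _ = inj₁ refl
  agree {false} {true}  {c} {true}  _ = inj₂ (inj₁ refl)
  agree {true}  {false} {c} {false} _ = inj₂ (inj₁ refl)
  agree {false} {false} {true}  {true}  _ = inj₂ (inj₂ refl)
  agree {true}  {true}  {false} {false} _ = inj₂ (inj₂ refl)

fresh-0⇒ : (a b c z : Vertex n) → fresh a b c z ≡ 0 → ∀ j →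
           lookup a j ≡ lookup z j ⊎ lookup b j ≡ lookup z j ⊎ lookup c j ≡ lookup z j
fresh-0⇒ (a ∷ p) (b ∷ q) (c ∷ r) (z ∷ s) eq zero with fresh₁ a b c z in h
... | false = agree h
fresh-0⇒ (a ∷ p) (b ∷ q) (c ∷ r) (z ∷ s) eq (suc j) = fresh-0⇒ p q r s (ℕₚ.m+n≡0⇒n≡0 (bit (fresh₁ a b c z)) eq) j

-- A coordinate at which the three vertices are not all equal separates exactly two of the three
-- pairs; this is the origin of the factor 2.
weight-triple : (a b c : Vertex n) →
  2 * weight (span (a ∷ b ∷ c ∷ [])) ≡ (n + n) + (hamming a b + hamming b c + hamming a c)
weight-triple {zero} [] [] [] = refl
weight-triple {suc n} (a ∷ x) (b ∷ y) (c ∷ z) = go a b c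
  where
  w = weight (span (x ∷ y ∷ z ∷ []))
  IH = weight-triple x y z
  A = hamming x y
  B = hamming y z
  C = hamming x z
  flat : 2 * (1 + w) ≡ (suc n + suc n) + (A + B + C)
  flat = trans (lhs w) (trans (cong (2 +_) IH) (rhs n A B C))
    where
    lhs : ∀ w → 2 * (1 + w) ≡ 2 + 2 * w
    lhs = ℕ-Solver.solve-∀
    rhs : ∀ n A B C → 2 + ((n + n) + (A + B + C)) ≡ (suc n + suc n) + (A + B + C)
    rhs = ℕ-Solver.solve-∀
  bent : ∀ {s} → s ≡ 2 + (A + B + C) → 2 * (2 + w) ≡ (suc n + suc n) + s
  bent refl = trans (lhs w) (trans (cong (4 +_) IH) (rhs n A B C))
    where
    lhs : ∀ w → 2 * (2 + w) ≡ 4 + 2 * w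
    lhs = ℕ-Solver.solve-∀
    rhs : ∀ n A B C → 4 + ((n + n) + (A + B + C)) ≡ (suc n + suc n) + (2 + (A + B + C))
    rhs = ℕ-Solver.solve-∀
  s₁ : ∀ A B C → suc A + B + suc C ≡ 2 + (A + B + C)
  s₁ = ℕ-Solver.solve-∀
  s₂ : ∀ A B C → suc A + suc B + C ≡ 2 + (A + B + C)
  s₂ = ℕ-Solver.solve-∀
  s₃ : ∀ A B C → A + suc B + suc C ≡ 2 + (A + B + C)
  s₃ = ℕ-Solver.solve-∀
  go : ∀ a b c → 2 * weight (span ((a ∷ x) ∷ (b ∷ y) ∷ (c ∷ z) ∷ [])) ≡
                 (suc n + suc n) + (hamming (a ∷ x) (b ∷ y) + hamming (b ∷ y) (c ∷ z) + hamming (a ∷ x) (c ∷ z))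
  go false false false = flat
  go true  true  true  = flat
  go false true  true  = bent (s₁ A B C)
  go true  false false = bent (s₁ A B C)
  go false true  false = bent (s₂ A B C)
  go true  false true  = bent (s₂ A B C)
  go false false true  = bent (s₃ A B C)
  go true  true  false = bent (s₃ A B C)

far : UpSet n
far = mkUp (λ σ → Any (λ x → Any (λ y → 4 ≤ hamming x y) σ) σ)
           (λ σ → any? (λ x → any? (λ y → 4 ≤? hamming x y) σ) σ)
           (λ s → ⊆ₚ.Any-resp-⊆ s ∘ Any.map (⊆ₚ.Any-resp-⊆ s))

close : {σ : Tuple n} → ¬ Holds far σ → ∀ {x y} → x ∈ σ → y ∈ σ → hamming x y ≤ 3
close ¬f x∈ y∈ = ℕₚ.≮⇒≥ λ d → ¬f (lose x∈ (lose y∈ d))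

close⇒¬far : {σ : Tuple n} → (∀ {x y} → x ∈ σ → y ∈ σ → hamming x y ≤ 3) → ¬ Holds far σ
close⇒¬far h f with x , x∈ , g ← find f with y , y∈ , d ← find g = ℕₚ.<⇒≱ d (h x∈ y∈)

close-∷ : {σ : Tuple n} {u : Vertex n} → ¬ Holds far σ → (∀ {x} → x ∈ σ → hamming x u ≤ 3) →
          ¬ Holds far (u ∷ σ)
close-∷ {σ = σ} {u} ¬f h = close⇒¬far λ
  { (here refl) (here refl) → subst (_≤ 3) (sym (hamming-refl u)) z≤n
  ; (here refl) (there y∈)  → subst (_≤ 3) (hamming-sym _ u) (h y∈)
  ; (there x∈)  (here refl) → h x∈
  ; (there x∈)  (there y∈)  → close {σ = σ} ¬f x∈ y∈ }

double-≤ : ∀ {a b} → 2 * a ≤ 2 * b → a ≤ b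
double-≤ = ℕₚ.*-cancelˡ-≤ 2

far-weight : {σ : Tuple n} {a b : Vertex n} → a ∈ σ → b ∈ σ → n + hamming a b ≤ weight (span σ)
far-weight {n} {σ} {a} {b} a∈ b∈ = ℕₚ.≤-trans
  (double-≤ (ℕₚ.≤-reflexive (sym (trans (weight-triple a b b)
    (trans (cong (λ z → (n + n) + (hamming a b + z + hamming a b)) (hamming-refl b)) (arith n (hamming a b)))))))
  (weight-mono {p = span (a ∷ b ∷ b ∷ [])} {span σ}
    (span-mono {σ = a ∷ b ∷ b ∷ []} λ { (here refl) → a∈ ; (there (here refl)) → b∈ ; (there (there (here refl))) → b∈ }))
  where
  arith : ∀ n d → (n + n) + (d + 0 + d) ≡ 2 * (n + d)
  arith = ℕ-Solver.solve-∀

Wide : Tuple n → Set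
Wide {n} σ = n + 5 ≤ weight (span σ)

-- Three vertices at mutual distance ≤ 3 span at most a 4-cube.
escape : {σ : Tuple n} → Wide σ → ¬ Holds far σ → ∀ {a b c} → a ∈ σ → b ∈ σ → c ∈ σ →
         ∃ λ z → z ∈ σ × 1 ≤ fresh a b c z
escape {n} {σ} wide ¬far {a} {b} {c} a∈ b∈ c∈ with any? (λ z → 1 ≤? fresh a b c z) σ
... | yes found = find found
... | no  none  = contradiction (begin
    2 * (n + 5)                                        ≤⟨ ℕₚ.*-monoʳ-≤ 2 (ℕₚ.≤-trans wide narrow) ⟩
    2 * weight (span (a ∷ b ∷ c ∷ []))                 ≡⟨ weight-triple a b c ⟩
    (n + n) + (hamming a b + hamming b c + hamming a c) ≤⟨ ℕₚ.+-monoʳ-≤ (n + n) (ℕₚ.+-mono-≤ (ℕₚ.+-mono-≤ (close {σ = σ} ¬far a∈ b∈) (close {σ = σ} ¬far b∈ c∈)) (close {σ = σ} ¬far a∈ c∈)) ⟩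
    (n + n) + 9                                        ∎) (ℕₚ.<⇒≱ (ℕₚ.≤-reflexive (arith n)))
  where
  open ℕₚ.≤-Reasoning
  arith : ∀ n → suc ((n + n) + 9) ≡ 2 * (n + 5)
  arith = ℕ-Solver.solve-∀
  narrow : weight (span σ) ≤ weight (span (a ∷ b ∷ c ∷ []))
  narrow = weight-mono {p = span σ} {span (a ∷ b ∷ c ∷ [])} (span⊑ {σ = σ} {span (a ∷ b ∷ c ∷ [])} λ {z} z∈ j →
    takes⇒span (a ∷ b ∷ c ∷ []) j (lookup z j)
      ([ here , [ there ∘ here , there ∘ there ∘ here ]′ ]′
        (fresh-0⇒ a b c z (ℕₚ.n<1⇒n≡0 (ℕₚ.≰⇒> λ f → none (lose z∈ f))) j)))

-- Parity, steps and squares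

odd : Vertex n → Bool
odd []      = false
odd (x ∷ v) = x xor odd v

parity : ℕ → Bool
parity zero    = false
parity (suc m) = not (parity m)

parity-hamming : (x y : Vertex n) → parity (hamming x y) ≡ odd x xor odd y
parity-hamming []          []          = refl
parity-hamming (true ∷ x)  (true ∷ y)  = trans (parity-hamming x y) (cancel (odd x) (odd y))
  where
  cancel : ∀ a b → a xor b ≡ not a xor not b
  cancel false b = sym (𝔹.not-involutive b)
  cancel true  b = refl
parity-hamming (false ∷ x) (false ∷ y) = parity-hamming x y
parity-hamming (true ∷ x)  (false ∷ y) = trans (cong not (parity-hamming x y)) (𝔹.not-distribˡ-xor (odd x) (odd y))
parity-hamming (false ∷ x) (true ∷ y)  = trans (cong not (parity-hamming x y)) (𝔹.not-distribʳ-xor (odd x) (odd y))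

module _ {x y : Vertex n} where

  same-parity : odd x ≡ odd y → parity (hamming x y) ≡ false
  same-parity eq = trans (parity-hamming x y) (trans (cong (_xor odd y) eq) (𝔹.xor-same (odd y)))

  opposite-parity : odd x ≢ odd y → parity (hamming x y) ≡ true
  opposite-parity neq = trans (parity-hamming x y) (go (odd x) (odd y) neq)
    where
    go : ∀ a b → a ≢ b → a xor b ≡ true
    go false false neq = contradiction refl neq
    go false true  _   = refl
    go true  false _   = refl
    go true  true  neq = contradiction refl neq

  same⇒≤2 : odd x ≡ odd y → hamming x y ≤ 3 → hamming x y ≤ 2
  same⇒≤2 eq d≤3 = go (hamming x y) d≤3 (same-parity eq)
    where
    go : ∀ d → d ≤ 3 → parity d ≡ false → d ≤ 2
    go 0 _ _ = z≤n
    go 2 _ _ = ℕₚ.≤-refl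
    go (suc (suc (suc (suc _)))) (s≤s (s≤s (s≤s ()))) _

  same-distinct⇒2 : odd x ≡ odd y → x ≢ y → hamming x y ≤ 3 → hamming x y ≡ 2
  same-distinct⇒2 eq x≢y d≤3 = go (hamming x y) refl d≤3 (same-parity eq)
    where
    go : ∀ d → hamming x y ≡ d → d ≤ 3 → parity d ≡ false → d ≡ 2
    go 0 d≡0 _ _ = contradiction (hamming-0 d≡0) x≢y
    go 2 _   _ _ = refl
    go (suc (suc (suc (suc _)))) _ (s≤s (s≤s (s≤s ()))) _

  opposite⇒1or3 : odd x ≢ odd y → hamming x y ≤ 3 → hamming x y ≡ 1 ⊎ hamming x y ≡ 3
  opposite⇒1or3 neq d≤3 = go (hamming x y) d≤3 (opposite-parity neq)
    where
    go : ∀ d → d ≤ 3 → parity d ≡ true → d ≡ 1 ⊎ d ≡ 3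
    go 1 _ _ = inj₁ refl
    go 3 _ _ = inj₂ refl
    go (suc (suc (suc (suc _)))) (s≤s (s≤s (s≤s ()))) _

adjacent⇒opposite : {x y : Vertex n} → hamming x y ≡ 1 → odd x ≢ odd y
adjacent⇒opposite {x = x} {y} d≡1 eq =
  contradiction (trans (sym (cong parity d≡1)) (same-parity {x = x} {y} eq)) λ ()

-- The neighbour of `p` one step closer to both `a` and `b`, by the first coordinate at which both
-- differ from `p`; it is `p` itself if there is none. For `p` and `q` at distance 2, `step p q q`
-- and `step q p p` are their two common neighbours.
step : (p a b : Vertex n) → Vertex n
step []      []      []      = []
step (p ∷ x) (a ∷ y) (b ∷ z) = if (p xor a) ∧ (p xor b) then a ∷ x else p ∷ step x y z

step-values : (p a b : Vertex n) → ∀ j → lookup p j ≡ lookup (step p a b) j ⊎ lookup a j ≡ lookup (step p a b) j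
step-values (p ∷ x) (a ∷ y) (b ∷ z) j with (p xor a) ∧ (p xor b)
step-values (p ∷ x) (a ∷ y) (b ∷ z) zero    | true  = inj₂ refl
step-values (p ∷ x) (a ∷ y) (b ∷ z) (suc j) | true  = inj₁ refl
step-values (p ∷ x) (a ∷ y) (b ∷ z) zero    | false = inj₁ refl
step-values (p ∷ x) (a ∷ y) (b ∷ z) (suc j) | false = step-values x y z j

step-∈ᵖ : {σ : Tuple n} {p a : Vertex n} (b : Vertex n) → p ∈ σ → a ∈ σ → step p a b ∈ᵖ span σ
step-∈ᵖ {σ = σ} {p} {a} b p∈ a∈ j = takes⇒span σ j _ ([ lose p∈ , lose a∈ ]′ (step-values p a b j))

-- The hypothesis says that some coordinate is flipped.
step-dist : (p a b : Vertex n) → hamming a b < hamming p a + hamming p b →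
            hamming p (step p a b) ≡ 1 × suc (hamming (step p a b) a) ≡ hamming p a ×
            suc (hamming (step p a b) b) ≡ hamming p b
step-dist []          []          []          ()
step-dist (false ∷ x) (true ∷ y)  (true ∷ z)  _ = cong suc (hamming-refl x) , refl , refl
step-dist (true ∷ x)  (false ∷ y) (false ∷ z) _ = cong suc (hamming-refl x) , refl , refl
step-dist (false ∷ x) (false ∷ y) (false ∷ z) h = step-dist x y z h
step-dist (true ∷ x)  (true ∷ y)  (true ∷ z)  h = step-dist x y z h
step-dist (false ∷ x) (true ∷ y)  (false ∷ z) (s≤s h) =
  let e , f , g = step-dist x y z h in e , cong suc f , g
step-dist (true ∷ x)  (false ∷ y) (true ∷ z)  (s≤s h) =
  let e , f , g = step-dist x y z h in e , cong suc f , g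
step-dist (false ∷ x) (false ∷ y) (true ∷ z)  h =
  let e , f , g = step-dist x y z (ℕₚ.≤-pred (subst (suc (suc (hamming y z)) ≤_) (ℕₚ.+-suc (hamming x y) (hamming x z)) h))
  in  e , f , cong suc g
step-dist (true ∷ x)  (true ∷ y)  (false ∷ z) h =
  let e , f , g = step-dist x y z (ℕₚ.≤-pred (subst (suc (suc (hamming y z)) ≤_) (ℕₚ.+-suc (hamming x y) (hamming x z)) h))
  in  e , f , cong suc g

-- Both steps flip the same coordinate, the first at which `p` and `q` differ, so the two vertices
-- merely exchange their values there.
step-step : (p q : Vertex n) → hamming (step p q q) (step q p p) ≡ hamming p q
step-step []          []          = refl
step-step (false ∷ x) (false ∷ y) = step-step x y
step-step (true ∷ x)  (true ∷ y)  = step-step x y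
step-step (false ∷ x) (true ∷ y)  = refl
step-step (true ∷ x)  (false ∷ y) = refl

-- A 4-cycle of the cube with diagonals `p q` and `u v`.
record Square (p q u v : Vertex n) : Set where
  field
    pq : hamming p q ≡ 2
    pu : hamming p u ≡ 1
    qu : hamming q u ≡ 1
    pv : hamming p v ≡ 1
    qv : hamming q v ≡ 1
    uv : hamming u v ≡ 2

square : (p q : Vertex n) → hamming p q ≡ 2 → Square p q (step p q q) (step q p p)
square p q pq =
  let qp = trans (hamming-sym q p) pq
      pu , uq , _ = step-dist p q q (subst (λ z → hamming q q < z + z) (sym pq) (subst (_< 4) (sym (hamming-refl q)) (s≤s z≤n)))
      qv , vp , _ = step-dist q p p (subst (λ z → hamming p p < z + z) (sym qp) (subst (_< 4) (sym (hamming-refl p)) (s≤s z≤n)))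
  in record
    { pq = pq ; pu = pu ; qv = qv ; uv = trans (step-step p q) pq
    ; qu = trans (hamming-sym q _) (ℕₚ.suc-injective (trans uq pq))
    ; pv = trans (hamming-sym p _) (ℕₚ.suc-injective (trans vp qp)) }

flip-square : {p q u v : Vertex n} → Square p q u v → Square p q v u
flip-square {u = u} {v} s = record { pq = pq ; pu = pv ; qu = qv ; pv = pu ; qv = qu ; uv = trans (hamming-sym v u) uv }
  where open Square s

-- Simplices spanning at least five dimensions

fresh⇒≢ : (a b c z : Vertex n) → 1 ≤ fresh a b c z → z ≢ a × z ≢ b
fresh⇒≢ a b c z f =
  (λ { refl → ℕₚ.<⇒≱ f (subst (fresh a b c a ≤_) (hamming-refl a) (below₁ a)) }) ,
  (λ { refl → ℕₚ.<⇒≱ f (subst (fresh a b c b ≤_) (hamming-refl b) (below₂ b)) })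
  where
  below₁ : ∀ z → fresh a b c z ≤ hamming a z
  below₁ z = columnwise (frsh #0 #1 #2 #3) (dist #0 #3) _ (a ∷ b ∷ c ∷ z ∷ [])
  below₂ : ∀ z → fresh a b c z ≤ hamming b z
  below₂ z = columnwise (frsh #0 #1 #2 #3) (dist #1 #3) _ (a ∷ b ∷ c ∷ z ∷ [])

infixr 6 _⊹_
_⊹_ : ∀ {a b c d} → a ≤ b → c ≤ d → a + c ≤ b + d
_⊹_ = ℕₚ.+-mono-≤

2⋆_ : ∀ {a b} → a ≤ b → 2 * a ≤ 2 * b
2⋆_ = ℕₚ.*-monoʳ-≤ 2

reflexive≤ : ∀ {a b} → a ≡ b → a ≤ b
reflexive≤ = ℕₚ.≤-reflexive

reflexive≥ : ∀ {a b} → a ≡ b → b ≤ a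
reflexive≥ = ℕₚ.≤-reflexive ∘ sym

swap≤ : (x y : Vertex n) → ∀ {d} → hamming x y ≤ d → hamming y x ≤ d
swap≤ x y = subst (_≤ _) (hamming-sym x y)

-- `lo` and `hi` are numerals compared by evaluation; at the uses, the outer bounds are assembled
-- summand by summand along a certificate `l ≤ h`.
contradictory : ∀ {lo l h hi} → lo ≤ l → l ≤ h → h ≤ hi → {True (suc hi ≤? lo)} → ⊥
contradictory lo≤l l≤h h≤hi {hi<lo} =
  ℕₚ.<⇒≱ (toWitness hi<lo) (ℕₚ.≤-trans lo≤l (ℕₚ.≤-trans l≤h h≤hi))

odd-pigeonhole : (a b c : Bool) → a ≢ b → c ≡ a ⊎ c ≡ b
odd-pigeonhole false false c     a≢b = contradiction refl a≢b
odd-pigeonhole true  true  c     a≢b = contradiction refl a≢b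
odd-pigeonhole false true  false _   = inj₁ refl
odd-pigeonhole false true  true  _   = inj₂ refl
odd-pigeonhole true  false false _   = inj₂ refl
odd-pigeonhole true  false true  _   = inj₁ refl

even-dist⇒same : (x y : Vertex n) → parity (hamming x y) ≡ false → odd x ≡ odd y
even-dist⇒same x y eq = go (odd x) (odd y) (trans (sym (parity-hamming x y)) eq)
  where
  go : ∀ a b → a xor b ≡ false → a ≡ b
  go false false _ = refl
  go true  true  _ = refl

same-distinct⇒≥2 : (x y : Vertex n) → odd x ≡ odd y → x ≢ y → 2 ≤ hamming x y
same-distinct⇒≥2 x y eq x≢y = go (hamming x y) refl (same-parity {x = x} {y} eq)
  where
  go : ∀ d → hamming x y ≡ d → parity d ≡ false → 2 ≤ d
  go 0             d≡0 _ = contradiction (hamming-0 d≡0) x≢y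
  go (suc (suc d)) _   _ = s≤s (s≤s z≤n)

opposite-≥2⇒≥3 : (x y : Vertex n) → odd x ≢ odd y → 2 ≤ hamming x y → 3 ≤ hamming x y
opposite-≥2⇒≥3 x y neq = go (hamming x y) (opposite-parity {x = x} {y} neq)
  where
  go : ∀ d → parity d ≡ true → 2 ≤ d → 3 ≤ d
  go (suc (suc (suc d))) _ _ = s≤s (s≤s (s≤s z≤n))
  go (suc zero) _ (s≤s ())

wide : UpSet n
wide {n} = weighs (n + 5)

wide-remove : (u : Vertex n) {τ : Tuple n} → u ∈ᵖ span τ → Wide (u ∷ τ) → Wide τ
wide-remove u {τ} u∈ w = ℕₚ.≤-trans w (weight-mono {p = span (u ∷ τ)} {span τ} (span-∷ {σ = τ} {u} u∈))

allPairs : List (Vertex n × Vertex n)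
allPairs {n} = cartesianProduct (allVertices n) (allVertices n)

pairs-complete : (p : Vertex n × Vertex n) → p ∈ allPairs
pairs-complete (p , q) = ∈ₚ.∈-cartesianProduct⁺ (vertices-complete p) (vertices-complete q)

pair : Bool → Vertex n × Vertex n → UpSet n
pair b (p , q) = mkUp
  (λ σ → (odd p ≡ b × odd q ≡ b × p ≢ q) × p ∈ σ × q ∈ σ)
  (λ σ → ((odd p 𝔹.≟ b) ×-dec (odd q 𝔹.≟ b) ×-dec ¬? (p ≟ᵛ q)) ×-dec any? (p ≟ᵛ_) σ ×-dec any? (q ≟ᵛ_) σ)
  (λ s (h , p∈ , q∈) → h , s p∈ , s q∈)

any-tail : {A : Set} {P : A → Set} {x : A} {xs : List A} → ¬ P x → Any P (x ∷ xs) → Any P xs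
any-tail ¬p (here p)  = contradiction p ¬p
any-tail ¬p (there a) = a

remove-∈ : {u p : Vertex n} {τ : Tuple n} → p ≢ u → p ∈ (u ∷ τ) → p ∈ τ
remove-∈ = any-tail

-- A vertex of the other parity creates no pair, which keeps the pieces of a search closed under
-- toggling it.
pair-remove : ∀ {b} {i : Vertex n × Vertex n} {u : Vertex n} {τ} → odd u ≢ b →
              Holds (pair b i) (u ∷ τ) → Holds (pair b i) τ
pair-remove u≢b ((op , oq , p≢q) , p∈ , q∈) =
  (op , oq , p≢q) , remove-∈ (λ { refl → u≢b op }) p∈ , remove-∈ (λ { refl → u≢b oq }) q∈

pairs-remove : ∀ {b} {js : List (Vertex n × Vertex n)} {u : Vertex n} {τ} → odd u ≢ b →
               Holds (⋃ (pair b) js) (u ∷ τ) → Holds (⋃ (pair b) js) τ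
pairs-remove {b = b} u≢b = Any.map (λ {i} → pair-remove {b = b} {i} u≢b)

unique : ∀ {b} {σ : Tuple n} → ¬ Holds (⋃ (pair b) allPairs) σ → ∀ {x y} → x ∈ σ → y ∈ σ →
         odd x ≡ b → odd y ≡ b → x ≡ y
unique ¬pairs {x} {y} x∈ y∈ ox oy with x ≟ᵛ y
... | yes x≡y = x≡y
... | no  x≢y = contradiction (lose (pairs-complete (x , y)) ((ox , oy , x≢y) , x∈ , y∈)) ¬pairs

pair⇒square : ∀ {b} {τ : Tuple n} {p q : Vertex n} → ¬ Holds far τ → Holds (pair b (p , q)) τ →
              Square p q (step p q q) (step q p p)
pair⇒square {τ = τ} {p} {q} ¬f ((op , oq , p≢q) , p∈ , q∈) =
  square p q (same-distinct⇒2 {x = p} {q} (trans op (sym oq)) p≢q (close {σ = τ} ¬f p∈ q∈))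

module _ {p q u v : Vertex n} (s : Square p q u v) where
  open Square s

  square-opposite : odd u ≢ odd p
  square-opposite eq = adjacent⇒opposite {x = p} {u} pu (sym eq)

  private
    u≡v : odd u ≡ odd v
    u≡v = even-dist⇒same u v (cong parity uv)

  -- A wide clique containing p and q remains a clique after adding u or after adding v.
  fits-one : {τ : Tuple n} → Wide τ → ¬ Holds far τ → p ∈ τ → q ∈ τ →
             ∀ {x y} → x ∈ τ → y ∈ τ → 4 ≤ hamming x u → 4 ≤ hamming y v → ⊥
  fits-one {τ} wide ¬f p∈ q∈ {x} {y} x∈ y∈ xu yv =
    let z , z∈ , f = escape {σ = τ} wide ¬f p∈ q∈ x∈
    -- The left side is at least 28, the right side at most 26.
    in  contradictory
          (2⋆ reflexive≥ pq ⊹ 2⋆ reflexive≥ uv ⊹ 2⋆ xu ⊹ 2⋆ yv ⊹ 2⋆ 2⋆ f)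
          (square-inequality p q u v x y z)
          (2⋆ reflexive≤ pu ⊹ 2⋆ reflexive≤ qu ⊹ 2⋆ reflexive≤ pv ⊹ 2⋆ reflexive≤ qv ⊹ d y∈ p∈ ⊹ d y∈ q∈ ⊹
           same⇒≤2 {x = x} {y} (trans x≡u (trans u≡v (sym y≡v))) (d x∈ y∈) ⊹ sum z∈)
    where
    d : ∀ {x y} → x ∈ τ → y ∈ τ → hamming x y ≤ 3
    d = close {σ = τ} ¬f
    -- A neighbour `w` of `p` is at distance at most 3 + 1 from `x`, so the distance is exactly 4
    -- and the parities agree.
    four : ∀ x w → x ∈ τ → hamming p w ≡ 1 → 4 ≤ hamming x w → odd x ≡ odd w
    four x w x∈ pw xw = even-dist⇒same x w (cong parity (ℕₚ.≤-antisym
      (ℕₚ.≤-trans (hamming-triangle x p w) (d x∈ p∈ ⊹ reflexive≤ pw)) xw))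
    x≡u : odd x ≡ odd u
    x≡u = four x u x∈ pu xu
    y≡v : odd y ≡ odd v
    y≡v = four y v y∈ pv yv
    -- Either parity of `z` makes two of the four distances even, hence at most 2; this gives 10
    -- instead of 12.
    sum : ∀ {z} → z ∈ τ → hamming z p + (hamming z q + (hamming z x + hamming z y)) ≤ 10
    sum {z} z∈ with odd-pigeonhole (odd u) (odd p) (odd z) square-opposite
    ... | inj₂ z≡p = same⇒≤2 {x = z} {p} z≡p (d z∈ p∈)
                   ⊹ same⇒≤2 {x = z} {q} (trans z≡p (even-dist⇒same p q (cong parity pq))) (d z∈ q∈)
                   ⊹ d z∈ x∈ ⊹ d z∈ y∈
    ... | inj₁ z≡u = d z∈ p∈ ⊹ d z∈ q∈ ⊹ same⇒≤2 {x = z} {x} (trans z≡u (sym x≡u)) (d z∈ x∈)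
                   ⊹ same⇒≤2 {x = z} {y} (trans z≡u (trans u≡v (sym y≡v))) (d z∈ y∈)

misfit : Vertex n → UpSet n
misfit u = mkUp (Any (λ x → 4 ≤ hamming x u)) (any? (λ x → 4 ≤? hamming x u)) (λ s → ⊆ₚ.Any-resp-⊆ s)

-- Wide cliques with two distinct odd vertices p and q: toggle one of their common neighbours.
vanish-pair : (i : Vertex n × Vertex n) (js : List (Vertex n × Vertex n)) →
              Vanish (wide ∩ pair true i ∖ far ∪ ⋃ (pair true) js) k
vanish-pair {n} i@(p , q) js = vanish-split (wide ∩ pair true i) (far ∪ ⋃ (pair true) js) (misfit u)
  -- Here `u` does not fit, so `v` does by `fits-one`. Removing `v` keeps a witness against `u`,
  -- since `v` itself is only at distance 2 from `u`.
  (toggle {R = (wide ∩ pair true i) ∩ misfit u ∖ far ∪ ⋃ (pair true) js} v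
    (λ τ (((w , pr) , m) , ¬n) →
      ((mono wide {τ} {v ∷ τ} there w , mono (pair true i) there pr) , there m) ,
      [ close-∷ {σ = τ} (¬n ∘ inj₁) (λ y∈ → ℕₚ.≮⇒≥ λ yv → let x , x∈ , xu = find m in
          fits-one (sq τ (¬n ∘ inj₁) pr) w (¬n ∘ inj₁) (proj₁ (proj₂ pr)) (proj₂ (proj₂ pr)) x∈ y∈ xu yv)
      , ¬n ∘ inj₂ ∘ pairs-remove (v-even τ (¬n ∘ inj₁) pr) ]′)
    (λ τ (((w , pr) , m) , ¬n) →
      let ¬f  = ¬n ∘ inj₁
          pr′ = pair-remove {i = i} (v-even (v ∷ τ) ¬f pr) pr
          _ , p∈ , q∈ = pr′
      in ((wide-remove v {τ} (step-∈ᵖ {σ = τ} p q∈ p∈) w , pr′) ,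
           any-tail (λ vu → contradiction (subst (4 ≤_) (trans (hamming-sym v u) (Square.uv (sq (v ∷ τ) ¬f pr))) vu) λ { (s≤s (s≤s ())) }) m) ,
         λ { (inj₁ f) → ¬f (mono far there f) ; (inj₂ ps) → ¬n (inj₂ (mono (⋃ (pair true) js) there ps)) }))
  -- Here `u` is within distance 3 of every vertex.
  (toggle {R = wide ∩ pair true i ∖ (far ∪ ⋃ (pair true) js) ∪ misfit u} u
    (λ τ ((w , pr) , ¬n) →
      (mono wide {τ} {u ∷ τ} there w , mono (pair true i) there pr) ,
      λ { (inj₁ (inj₁ f)) → close-∷ {σ = τ} (¬n ∘ inj₁ ∘ inj₁) (λ y∈ → ℕₚ.≮⇒≥ λ yu → ¬n (inj₂ (lose y∈ yu))) f
        ; (inj₁ (inj₂ ps)) → ¬n (inj₁ (inj₂ (pairs-remove (u-even τ (¬n ∘ inj₁ ∘ inj₁) pr) ps)))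
        ; (inj₂ (here uu)) → contradiction (subst (4 ≤_) (hamming-refl u) uu) λ ()
        ; (inj₂ (there m)) → ¬n (inj₂ m) })
    (λ τ ((w , pr) , ¬n) →
      let pr′ = pair-remove {i = i} (u-even (u ∷ τ) (¬n ∘ inj₁ ∘ inj₁) pr) pr
          _ , p∈ , q∈ = pr′
      in (wide-remove u {τ} (step-∈ᵖ {σ = τ} q p∈ q∈) w , pr′) ,
         λ { (inj₁ (inj₁ f))  → ¬n (inj₁ (inj₁ (mono far there f)))
           ; (inj₁ (inj₂ ps)) → ¬n (inj₁ (inj₂ (mono (⋃ (pair true) js) there ps)))
           ; (inj₂ m)         → ¬n (inj₂ (there m)) }))
  where
  u v : Vertex n
  u = step p q q
  v = step q p p
  sq : ∀ τ → ¬ Holds far τ → Holds (pair true i) τ → Square p q u v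
  sq τ ¬f pr = pair⇒square {τ = τ} ¬f pr
  u-even : ∀ τ → ¬ Holds far τ → Holds (pair true i) τ → odd u ≢ true
  u-even τ ¬f pr u≡ = square-opposite (sq τ ¬f pr) (trans u≡ (sym (proj₁ (proj₁ pr))))
  v-even : ∀ τ → ¬ Holds far τ → Holds (pair true i) τ → odd v ≢ true
  v-even τ ¬f pr v≡ = square-opposite (flip-square (sq τ ¬f pr)) (trans v≡ (sym (proj₁ (proj₁ pr))))

Triple : ℕ → Set
Triple n = Vertex n × Vertex n × Vertex n

allTriples : List (Triple n)
allTriples {n} = cartesianProduct (allVertices n) allPairs

triples-complete : (t : Triple n) → t ∈ allTriples
triples-complete (p , o , r) = ∈ₚ.∈-cartesianProduct⁺ (vertices-complete p) (pairs-complete (o , r))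

IsTripod : Triple n → Set
IsTripod (p , o , r) = odd p ≡ true × odd o ≡ false × odd r ≡ false × o ≢ r × hamming p o ≡ 3 × hamming p r ≡ 3

tripod : Triple n → UpSet n
tripod (p , o , r) = mkUp
  (λ σ → IsTripod (p , o , r) × p ∈ σ × o ∈ σ × r ∈ σ)
  (λ σ → ((odd p 𝔹.≟ true) ×-dec (odd o 𝔹.≟ false) ×-dec (odd r 𝔹.≟ false) ×-dec ¬? (o ≟ᵛ r)
           ×-dec (hamming p o ℕₚ.≟ 3) ×-dec (hamming p r ℕₚ.≟ 3))
         ×-dec any? (p ≟ᵛ_) σ ×-dec any? (o ≟ᵛ_) σ ×-dec any? (r ≟ᵛ_) σ)
  (λ s (h , p∈ , o∈ , r∈) → h , s p∈ , s o∈ , s r∈)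

odd-pairs : UpSet n
odd-pairs = ⋃ (pair true) allPairs

-- Wide cliques with a single odd vertex p and two even vertices at distance 3 from it: toggle a
-- neighbour of p in the direction of these two vertices.
vanish-tripod : (i : Triple n) (js : List (Triple n)) →
                Vanish (wide ∩ tripod i ∖ (far ∪ odd-pairs) ∪ ⋃ tripod js) k
vanish-tripod {n} i@(p , o , r) js = toggle {R = wide ∩ tripod i ∖ (far ∪ odd-pairs) ∪ ⋃ tripod js} a
  (λ τ ((w , tr) , ¬n) →
    let ¬f = ¬n ∘ inj₁ ∘ inj₁
        ¬2 = ¬n ∘ inj₁ ∘ inj₂
    in (mono wide {τ} {a ∷ τ} there w , mono (tripod i) there tr) ,
       λ { (inj₁ (inj₁ f))  → close-∷ {σ = τ} ¬f (fits τ w ¬f ¬2 tr) f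
         ; (inj₁ (inj₂ ps)) → ¬2 (pairs-remove (a-even τ ¬f tr) ps)
         ; (inj₂ ts)        → ¬n (inj₂ (Any.map (λ {j} → keep τ ¬f ¬2 tr j) ts)) })
  (λ τ ((w , tr) , ¬n) →
    let ¬f  = ¬n ∘ inj₁ ∘ inj₁
        tr′ = keep₀ τ ¬f tr
        _ , p∈ , o∈ , _ = tr′
    in (wide-remove a {τ} (step-∈ᵖ {σ = τ} r p∈ o∈) w , tr′) ,
       λ { (inj₁ (inj₁ f))  → ¬f (mono far there f)
         ; (inj₁ (inj₂ ps)) → ¬n (inj₁ (inj₂ (mono odd-pairs {τ} {a ∷ τ} there ps)))
         ; (inj₂ ts)        → ¬n (inj₂ (mono (⋃ tripod js) there ts)) })
  where
  a : Vertex n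
  -- Some coordinate is flipped, because `o` and `r` are at distance 2, less than 3 + 3.
  a = step p o r
  module Facts (τ : Tuple n) (¬f : ¬ Holds far τ) (tr : Holds (tripod i) τ) where
    op = proj₁ (proj₁ tr)
    oo = proj₁ (proj₂ (proj₁ tr))
    or≡ = proj₁ (proj₂ (proj₂ (proj₁ tr)))
    o≢r = proj₁ (proj₂ (proj₂ (proj₂ (proj₁ tr))))
    po : hamming p o ≡ 3
    po = proj₁ (proj₂ (proj₂ (proj₂ (proj₂ (proj₁ tr)))))
    pr : hamming p r ≡ 3
    pr = proj₂ (proj₂ (proj₂ (proj₂ (proj₂ (proj₁ tr)))))
    p∈ = proj₁ (proj₂ tr)
    o∈ = proj₁ (proj₂ (proj₂ tr))
    r∈ = proj₂ (proj₂ (proj₂ tr))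
    or : hamming o r ≡ 2
    or = same-distinct⇒2 {x = o} {r} (trans oo (sym or≡)) o≢r (close {σ = τ} ¬f o∈ r∈)
    steps = step-dist p o r (subst (hamming o r <_) (sym (cong₂ _+_ po pr)) (subst (_< 6) (sym or) (s≤s (s≤s (s≤s z≤n)))))
    pa : hamming p a ≡ 1
    pa = proj₁ steps
    ao : hamming a o ≡ 2
    ao = ℕₚ.suc-injective (trans (proj₁ (proj₂ steps)) po)
    ar : hamming a r ≡ 2
    ar = ℕₚ.suc-injective (trans (proj₂ (proj₂ steps)) pr)
  a-even : ∀ τ → ¬ Holds far τ → Holds (tripod i) τ → odd a ≢ true
  a-even τ ¬f tr a≡ = adjacent⇒opposite {x = p} {a} (Facts.pa τ ¬f tr) (trans (Facts.op τ ¬f tr) (sym a≡))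
  3≢1 : ∀ {d} → d ≡ 3 → d ≢ 1
  3≢1 refl ()
  keep₀ : ∀ τ → ¬ Holds far (a ∷ τ) → Holds (tripod i) (a ∷ τ) → Holds (tripod i) τ
  keep₀ τ ¬f tr = proj₁ tr , remove-∈ (λ p≡a → a-even (a ∷ τ) ¬f tr (trans (cong odd (sym p≡a)) op)) p∈
                , remove-∈ (λ o≡a → 3≢1 po (trans (cong (hamming p) o≡a) pa)) o∈
                , remove-∈ (λ r≡a → 3≢1 pr (trans (cong (hamming p) r≡a) pa)) r∈
    where open Facts (a ∷ τ) ¬f tr
  -- No new tripod arises: `a` is even and adjacent to the only odd vertex `p`, while the even
  -- vertices of a tripod are at distance 3 from its odd one.
  keep : ∀ τ → ¬ Holds far τ → ¬ Holds odd-pairs τ → Holds (tripod i) τ →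
         ∀ j → Holds (tripod j) (a ∷ τ) → Holds (tripod j) τ
  keep τ ¬f ¬2 tr (p′ , o′ , r′) (h@(op′ , _ , _ , _ , po′ , pr′) , p′∈ , o′∈ , r′∈) =
    h , p′∈τ , remove-∈ (λ o′≡a → 3≢1 po′ (trans (cong₂ hamming p′≡p o′≡a) pa)) o′∈
             , remove-∈ (λ r′≡a → 3≢1 pr′ (trans (cong₂ hamming p′≡p r′≡a) pa)) r′∈
    where
    open Facts τ ¬f tr
    p′∈τ = remove-∈ (λ p′≡a → a-even τ ¬f tr (trans (cong odd (sym p′≡a)) op′)) p′∈
    p′≡p = unique ¬2 p′∈τ p∈ op′ op
  fits : ∀ τ → Wide τ → ¬ Holds far τ → ¬ Holds odd-pairs τ → Holds (tripod i) τ →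
         ∀ {x} → x ∈ τ → hamming x a ≤ 3
  fits τ w ¬f ¬2 tr {x} x∈ = ℕₚ.≮⇒≥ λ xa →
    let z , z∈ , f = escape {σ = τ} w ¬f p∈ o∈ r∈
        x-even = 𝔹.¬-not λ ox → contradiction (subst (4 ≤_) (trans (cong (λ y → hamming y a) (unique ¬2 x∈ p∈ ox op)) pa) xa) λ { (s≤s ()) }
        z-even = 𝔹.¬-not λ oz → proj₁ (fresh⇒≢ p o r z f) (unique ¬2 z∈ p∈ oz op)
    -- Again 28 against 26: by parity the distances between even vertices are at most 2.
    in  contradictory
          (2⋆ reflexive≥ po ⊹ 2⋆ reflexive≥ pr ⊹ 2⋆ reflexive≥ or ⊹ 2⋆ xa ⊹ 2⋆ 2⋆ f)
          (tripod-inequality p a o r x z)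
          (2⋆ reflexive≤ pa ⊹ 2⋆ reflexive≤ ao ⊹ 2⋆ reflexive≤ ar ⊹ d x∈ p∈ ⊹ even≤2 x∈ o∈ x-even oo ⊹
           even≤2 x∈ r∈ x-even or≡ ⊹ d z∈ p∈ ⊹ even≤2 z∈ o∈ z-even oo ⊹ even≤2 z∈ r∈ z-even or≡ ⊹
           even≤2 z∈ x∈ z-even x-even)
    where
    open Facts τ ¬f tr
    d : ∀ {x y} → x ∈ τ → y ∈ τ → hamming x y ≤ 3
    d = close {σ = τ} ¬f
    even≤2 : ∀ {x y} → x ∈ τ → y ∈ τ → odd x ≡ false → odd y ≡ false → hamming x y ≤ 2
    even≤2 {x} {y} x∈ y∈ ox oy = same⇒≤2 {x = x} {y} (trans ox (sym oy)) (d x∈ y∈)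

tripods : UpSet n
tripods = ⋃ tripod allTriples

-- The remaining wide cliques have at most one odd vertex, and it is adjacent to all even ones.

stray : Vertex n → UpSet n
stray u = mkUp (Any (λ x → odd x ≡ false × 2 ≤ hamming x u))
               (any? (λ x → (odd x 𝔹.≟ false) ×-dec (2 ≤? hamming x u))) (λ s → ⊆ₚ.Any-resp-⊆ s)

module Tame {τ : Tuple n} (w : Wide τ) (¬f : ¬ Holds far τ) (¬2 : ¬ Holds odd-pairs τ) (¬3 : ¬ Holds tripods τ) where

  private
    d : ∀ {x y} → x ∈ τ → y ∈ τ → hamming x y ≤ 3
    d = close {σ = τ} ¬f

    even≤2 : ∀ {x y} → x ∈ τ → y ∈ τ → odd x ≡ false → odd y ≡ false → hamming x y ≤ 2
    even≤2 {x} {y} x∈ y∈ ox oy = same⇒≤2 {x = x} {y} (trans ox (sym oy)) (d x∈ y∈)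

  -- Otherwise `p` and `o` are at distance 3, and an escaping vertex `z` is even. Either `p`, `o`,
  -- `z` form a tripod, or `z` is adjacent to `p` and within 2 of `o`, so it lies on a geodesic and
  -- cannot escape.
  odd-adjacent-even : ∀ {p o} → p ∈ τ → o ∈ τ → odd p ≡ true → odd o ≡ false → hamming p o ≡ 1
  odd-adjacent-even {p} {o} p∈ o∈ op oo = [ id , ⊥-elim ∘ impossible ]′ (1or3 p∈ o∈ op oo)
    where
    1or3 : ∀ {p o} → p ∈ τ → o ∈ τ → odd p ≡ true → odd o ≡ false → hamming p o ≡ 1 ⊎ hamming p o ≡ 3
    1or3 {p} {o} p∈ o∈ op oo = opposite⇒1or3 {x = p} {o} (λ eq → contradiction (trans (sym op) (trans eq oo)) λ ()) (d p∈ o∈)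
    impossible : hamming p o ≡ 3 → ⊥
    impossible po =
      let z , z∈ , f = escape {σ = τ} w ¬f p∈ o∈ o∈
          z≢p , z≢o  = fresh⇒≢ p o o z f
          oz         = 𝔹.¬-not λ oz → z≢p (unique ¬2 z∈ p∈ oz op)
      in case 1or3 p∈ z∈ op oz of λ
        { (inj₂ pz) → ¬3 (lose (triples-complete (p , o , z)) ((op , oo , oz , z≢o ∘ sym , po , pz) , p∈ , o∈ , z∈))
        ; (inj₁ pz) → contradictory (reflexive≥ po ⊹ 2⋆ f) (segment-inequality p o o z)
                        (swap≤ p z (reflexive≤ pz) ⊹ even≤2 z∈ o∈ oz oo) }

  module _ {o r u v : Vertex n} (s : Square o r u v) (o∈ : o ∈ τ) (r∈ : r ∈ τ)
           (oo : odd o ≡ false) (or : odd r ≡ false) where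
    open Square s

    square-odd : odd u ≡ true
    square-odd = 𝔹.¬-not λ ou → square-opposite s (trans ou (sym oo))

    -- Another odd vertex `p` would also be a common neighbour of `o` and `r`. An even escaping
    -- vertex would be adjacent to both `p` and `u`, an odd one to both `o` and `r`; in either case
    -- it would lie in the square.
    odd-is-corner : ¬ Holds (stray u) τ → ∀ {p} → p ∈ τ → odd p ≡ true → p ≡ u
    odd-is-corner ¬s {p} p∈ op with p ≟ᵛ u
    ... | yes p≡u = p≡u
    ... | no  p≢u = ⊥-elim (absurd (escape {σ = τ} w ¬f o∈ r∈ r∈))
      where
      po = odd-adjacent-even p∈ o∈ op oo
      pr = odd-adjacent-even p∈ r∈ op or
      absurd : (∃ λ z → z ∈ τ × 1 ≤ fresh o r r z) → ⊥
      absurd (z , z∈ , f) with odd z in oz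
      ... | false = contradictory
        (2⋆ reflexive≥ pq ⊹ same-distinct⇒≥2 p u (trans op (sym square-odd)) p≢u ⊹ 2⋆ f)
        (corner-inequality o r u p z)
        (reflexive≤ pu ⊹ reflexive≤ qu ⊹ reflexive≤ po ⊹ reflexive≤ pr ⊹ ℕₚ.≮⇒≥ (λ zu → ¬s (lose z∈ (oz , zu))) ⊹
         swap≤ p z (reflexive≤ (odd-adjacent-even p∈ z∈ op oz)))
      ... | true = contradictory (reflexive≥ pq ⊹ 2⋆ f) (segment-inequality o r r z)
        (reflexive≤ (odd-adjacent-even z∈ o∈ oz oo) ⊹ reflexive≤ (odd-adjacent-even z∈ r∈ oz or))

    -- The same certificate as for `fits-one`, with `o` and `r` as the diagonal. Parity raises the
    -- distance of a stray vertex from 2 to 3, and distances between even vertices are at most 2.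
    stray-one : Holds (stray u) τ → ¬ Holds (stray v) τ
    stray-one su sv with x , x∈ , ox , xu ← find su | y , y∈ , oy , yv ← find sv =
      absurd (escape {σ = τ} w ¬f o∈ r∈ x∈)
      where
      sum : ∀ {z} → z ∈ τ → hamming z o + (hamming z r + (hamming z x + hamming z y)) ≤ 8
      sum {z} z∈ with odd z in oz
      ... | false = even≤2 z∈ o∈ oz oo ⊹ even≤2 z∈ r∈ oz or ⊹ even≤2 z∈ x∈ oz ox ⊹ even≤2 z∈ y∈ oz oy
      ... | true  = ℕₚ.≤-trans (one o∈ oo ⊹ one r∈ or ⊹ one x∈ ox ⊹ one y∈ oy) (ℕₚ.m≤m+n 4 4)
        where
        one : ∀ {x} → x ∈ τ → odd x ≡ false → hamming z x ≤ 1
        one x∈ ox = reflexive≤ (odd-adjacent-even z∈ x∈ oz ox)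
      absurd : (∃ λ z → z ∈ τ × 1 ≤ fresh o r x z) → ⊥
      -- The left side is at least 24, the right side at most 22.
      absurd (z , z∈ , f) = contradictory
        (2⋆ reflexive≥ pq ⊹ 2⋆ reflexive≥ uv
         ⊹ 2⋆ opposite-≥2⇒≥3 x u (λ eq → square-opposite s (trans (sym eq) (trans ox (sym oo)))) xu
         ⊹ 2⋆ opposite-≥2⇒≥3 y v (λ eq → square-opposite (flip-square s) (trans (sym eq) (trans oy (sym oo)))) yv
         ⊹ 2⋆ 2⋆ f)
        (square-inequality o r u v x y z)
        (2⋆ reflexive≤ pu ⊹ 2⋆ reflexive≤ qu ⊹ 2⋆ reflexive≤ pv ⊹ 2⋆ reflexive≤ qv ⊹ even≤2 y∈ o∈ oy oo ⊹
         even≤2 y∈ r∈ oy or ⊹ even≤2 x∈ y∈ ox oy ⊹ sum z∈)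

    -- Without strays, every even vertex is adjacent to `u`, and `u` is the only possible odd
    -- vertex. Adding it therefore yields no large distance, no second odd vertex and no tripod.
    add-corner : ¬ Holds (stray u) τ → ¬ Holds ((far ∪ odd-pairs) ∪ tripods) (u ∷ τ)
    add-corner ¬s (inj₁ (inj₁ f)) = close-∷ {σ = τ} ¬f near f
      where
      near : ∀ {x} → x ∈ τ → hamming x u ≤ 3
      near {x} x∈ with odd x in ox
      ... | false = ℕₚ.≤-trans (ℕₚ.≮⇒≥ λ xu → ¬s (lose x∈ (ox , xu))) (s≤s z≤n)
      ... | true  = subst (λ y → hamming y u ≤ 3) (sym (odd-is-corner ¬s x∈ ox)) (subst (_≤ 3) (sym (hamming-refl u)) z≤n)
    add-corner ¬s (inj₁ (inj₂ ps)) = ¬2 (Any.map (λ {i} → keep i) ps)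
      where
      keep : ∀ i → Holds (pair true i) (u ∷ τ) → Holds (pair true i) τ
      keep (p , q) (h , there p∈ , there q∈) = h , p∈ , q∈
      keep (p , q) ((op , oq , p≢q) , here p≡u , here q≡u) = contradiction (trans p≡u (sym q≡u)) p≢q
      keep (p , q) ((op , oq , p≢q) , here p≡u , there q∈) = contradiction (trans p≡u (sym (odd-is-corner ¬s q∈ oq))) p≢q
      keep (p , q) ((op , oq , p≢q) , there p∈ , here q≡u) = contradiction (trans (odd-is-corner ¬s p∈ op) (sym q≡u)) p≢q
    add-corner ¬s (inj₂ ts) = ¬3 (Any.map (λ {i} → keep i) ts)
      where
      even∈ : ∀ {x} → odd x ≡ false → x ∈ (u ∷ τ) → x ∈ τ
      even∈ ox = remove-∈ λ { refl → contradiction (trans (sym ox) square-odd) λ () }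
      keep : ∀ i → Holds (tripod i) (u ∷ τ) → Holds (tripod i) τ
      keep (p , o′ , r′) (h@(op , oo′ , or′ , _ , po′ , _) , p∈ , o′∈ , r′∈) = h , p∈τ p∈ , even∈ oo′ o′∈ , even∈ or′ r′∈
        where
        p∈τ : p ∈ (u ∷ τ) → p ∈ τ
        p∈τ (there p∈) = p∈
        p∈τ (here p≡u) = contradiction (lose (even∈ oo′ o′∈) (oo′ ,
          ℕₚ.≤-trans (ℕₚ.m≤m+n 2 1) (swap≤′ (reflexive≥ (trans (cong (λ p → hamming p o′) (sym p≡u)) po′))))) ¬s
          where
          swap≤′ : 3 ≤ hamming u o′ → 3 ≤ hamming o′ u
          swap≤′ = subst (3 ≤_) (hamming-sym u o′)

-- If some even vertex strays from the corner `u`, none strays from `v` by `stray-one`, and `v` is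
-- toggled; otherwise `u` is. The corners are odd, so neither the even pairs nor the strays are
-- affected.
vanish-even-pair : (i : Vertex n × Vertex n) (js : List (Vertex n × Vertex n)) →
                   Vanish (wide ∩ pair false i ∖ ((far ∪ odd-pairs) ∪ tripods) ∪ ⋃ (pair false) js) k
vanish-even-pair {n} i@(o , r) js =
  vanish-split (wide ∩ pair false i) (((far ∪ odd-pairs) ∪ tripods) ∪ ⋃ (pair false) js) (stray u)
    (toggle {R = (wide ∩ pair false i) ∩ stray u ∖ ((far ∪ odd-pairs) ∪ tripods) ∪ ⋃ (pair false) js} v
      (λ τ (((w , pr) , m) , ¬n) →
        let T = λ {A : Set} (f : ¬ Holds far τ → ¬ Holds odd-pairs τ → ¬ Holds tripods τ → A) →
                  f (¬n ∘ inj₁ ∘ inj₁ ∘ inj₁) (¬n ∘ inj₁ ∘ inj₁ ∘ inj₂) (¬n ∘ inj₁ ∘ inj₂)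
            (oo , or , _) , o∈ , r∈ = pr
            s = pair⇒square {τ = τ} (¬n ∘ inj₁ ∘ inj₁ ∘ inj₁) pr
        in ((mono wide {τ} {v ∷ τ} there w , mono (pair false i) there pr) , there m) ,
           [ T (λ ¬f ¬2 ¬3 → Tame.add-corner w ¬f ¬2 ¬3 (flip-square s) o∈ r∈ oo or
                               (Tame.stray-one w ¬f ¬2 ¬3 s o∈ r∈ oo or m))
           , ¬n ∘ inj₂ ∘ pairs-remove (not-even (flip-square s) oo) ]′)
      (λ τ (((w , pr) , m) , ¬n) →
        let s   = pair⇒square {τ = v ∷ τ} (¬n ∘ inj₁ ∘ inj₁ ∘ inj₁) pr
            v≢  = not-even (flip-square s) (proj₁ (proj₁ pr))
            pr′ = pair-remove {i = i} v≢ pr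
            _ , o∈ , r∈ = pr′
        in ((wide-remove v {τ} (step-∈ᵖ {σ = τ} o r∈ o∈) w , pr′) ,
             any-tail (λ (ov , _) → v≢ ov) m) ,
           λ bad → ¬n (mono (((far ∪ odd-pairs) ∪ tripods) ∪ ⋃ (pair false) js) {τ} {v ∷ τ} there bad)))
    (toggle {R = wide ∩ pair false i ∖ (((far ∪ odd-pairs) ∪ tripods) ∪ ⋃ (pair false) js) ∪ stray u} u
      (λ τ ((w , pr) , ¬n) →
        let (oo , or , _) , o∈ , r∈ = pr
            ¬f = ¬n ∘ inj₁ ∘ inj₁ ∘ inj₁ ∘ inj₁
            s = pair⇒square {τ = τ} ¬f pr
        in (mono wide {τ} {u ∷ τ} there w , mono (pair false i) there pr) ,
           λ { (inj₁ (inj₁ bad)) → Tame.add-corner w ¬f (¬n ∘ inj₁ ∘ inj₁ ∘ inj₁ ∘ inj₂) (¬n ∘ inj₁ ∘ inj₁ ∘ inj₂) s o∈ r∈ oo or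
                                     (¬n ∘ inj₂) bad
             ; (inj₁ (inj₂ ps))  → ¬n (inj₁ (inj₂ (pairs-remove (not-even s oo) ps)))
             ; (inj₂ (here (ou , _))) → not-even s oo ou
             ; (inj₂ (there m))  → ¬n (inj₂ m) })
      (λ τ ((w , pr) , ¬n) →
        let s   = pair⇒square {τ = u ∷ τ} (¬n ∘ inj₁ ∘ inj₁ ∘ inj₁ ∘ inj₁) pr
            pr′ = pair-remove {i = i} (not-even s (proj₁ (proj₁ pr))) pr
            _ , o∈ , r∈ = pr′
        in (wide-remove u {τ} (step-∈ᵖ {σ = τ} r o∈ r∈) w , pr′) ,
           λ bad → ¬n (mono ((((far ∪ odd-pairs) ∪ tripods) ∪ ⋃ (pair false) js) ∪ stray u) {τ} {u ∷ τ} there bad)))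
  where
  u v : Vertex n
  u = step o r r
  v = step r o o
  not-even : ∀ {u v} → Square o r u v → odd o ≡ false → odd u ≢ false
  not-even s oo ou = square-opposite s (trans ou (sym oo))

-- Escaping twice produces three distinct vertices; two of them share their parity and form an
-- excluded pair.
no-lonely : (σ : Tuple n) → ¬ σ ∈ʳ (wide ∖ ((far ∪ odd-pairs) ∪ tripods) ∪ ⋃ (pair false) allPairs)
no-lonely {n} [] (w , _) = contradiction (subst (n + 5 ≤_) (weight-[] {n}) w)
  (ℕₚ.<⇒≱ (ℕₚ.≤-trans (s≤s z≤n) (ℕₚ.m≤n+m 5 n)))
no-lonely σ@(x ∷ _) (w , ¬n) =
  let z , z∈ , f  = escape {σ = σ} w ¬f (here refl) (here refl) (here refl)
      z≢x , _     = fresh⇒≢ x x x z f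
      t , t∈ , g  = escape {σ = σ} w ¬f (here refl) z∈ z∈
      t≢x , t≢z   = fresh⇒≢ x z z t g
  in  [ t≢x ∘ same t∈ (here refl) , t≢z ∘ same t∈ z∈ ]′
        (odd-pigeonhole (odd x) (odd z) (odd t) (λ eq → z≢x (same z∈ (here refl) (sym eq))))
  where
  ¬f = ¬n ∘ inj₁ ∘ inj₁ ∘ inj₁
  same : ∀ {a b} → a ∈ σ → b ∈ σ → odd a ≡ odd b → a ≡ b
  same {a} {b} a∈ b∈ eq with odd b in ob
  ... | true  = unique (¬n ∘ inj₁ ∘ inj₁ ∘ inj₂) a∈ b∈ eq ob
  ... | false = unique (¬n ∘ inj₂) a∈ b∈ eq ob

vanish-wide : Vanish (wide {n} ∖ far) k
vanish-wide = vanish-search (pair true) wide far allPairs vanish-pair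
  (vanish-search tripod wide (far ∪ odd-pairs) allTriples vanish-tripod
    (vanish-search (pair false) wide ((far ∪ odd-pairs) ∪ tripods) allPairs vanish-even-pair
      (vanish-empty {R = wide ∖ ((far ∪ odd-pairs) ∪ tripods) ∪ ⋃ (pair false) allPairs} λ σ _ → no-lonely σ)))

-- Cubes and cross-polytopes

stars : Pattern n → ℕ
stars []                 = 0
stars ((true , true) ∷ q) = suc (stars q)
stars (_ ∷ q)            = stars q

points : Pattern n → List (Vertex n)
points []                   = [] ∷ []
points ((true , true) ∷ q)   = map (false ∷_) (points q) ++ map (true ∷_) (points q)
points ((true , false) ∷ q)  = map (false ∷_) (points q)
points ((false , true) ∷ q)  = map (true ∷_) (points q)
points ((false , false) ∷ q) = []

-- One vertex from each antipodal pair of the cube.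
half : Pattern n → List (Vertex n)
half []                   = []
half ((true , true) ∷ q)   = map (true ∷_) (points q)
half ((true , false) ∷ q)  = map (false ∷_) (half q)
half ((false , true) ∷ q)  = map (true ∷_) (half q)
half ((false , false) ∷ q) = []

antipode : Pattern n → Vertex n → Vertex n
antipode []                  []      = []
antipode ((true , true) ∷ q) (x ∷ v) = not x ∷ antipode q v
antipode (_ ∷ q)             (x ∷ v) = x ∷ antipode q v

weight-stars : (q : Pattern n) (x : Vertex n) → x ∈ᵖ q → weight q ≡ n + stars q
weight-stars []                   _ _ = refl
weight-stars {suc n} ((true , true) ∷ q) (_ ∷ x) x∈ =
  trans (cong (2 +_) (weight-stars q x (x∈ ∘ suc))) (cong suc (sym (ℕₚ.+-suc n (stars q))))
weight-stars ((true , false) ∷ q)  (_ ∷ x)     x∈ = cong suc (weight-stars q x (x∈ ∘ suc))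
weight-stars ((false , true) ∷ q)  (_ ∷ x)     x∈ = cong suc (weight-stars q x (x∈ ∘ suc))
weight-stars ((false , false) ∷ q) (false ∷ _) x∈ = contradiction (x∈ zero) λ ()
weight-stars ((false , false) ∷ q) (true ∷ _)  x∈ = contradiction (x∈ zero) λ ()

private
  ∈ᵖ-∷ : ∀ {c b} {q : Pattern n} {x : Vertex n} → pick b c ≡ true → x ∈ᵖ q → (b ∷ x) ∈ᵖ (c ∷ q)
  ∈ᵖ-∷ on x∈ zero    = on
  ∈ᵖ-∷ on x∈ (suc j) = x∈ j

  ∈-map-∷ : ∀ {b} {x : Vertex (suc n)} {xs : List (Vertex n)} → x ∈ map (b ∷_) xs →
            ∃ λ y → y ∈ xs × x ≡ b ∷ y
  ∈-map-∷ = ∈ₚ.∈-map⁻ (_ ∷_)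

  uncons-∈ : ∀ {a b} {x : Vertex n} {xs : List (Vertex n)} → (a ∷ x) ∈ map (b ∷_) xs → a ≡ b × x ∈ xs
  uncons-∈ p with _ , y∈ , refl ← ∈-map-∷ p = refl , y∈

points-sound : (q : Pattern n) {x : Vertex n} → x ∈ points q → x ∈ᵖ q
points-sound []                   (here refl) = λ ()
points-sound ((true , true) ∷ q) p with ∈ₚ.∈-++⁻ (map (false ∷_) (points q)) p
... | inj₁ p₀ with _ , y∈ , refl ← ∈-map-∷ p₀ = ∈ᵖ-∷ {q = q} refl (points-sound q y∈)
... | inj₂ p₁ with _ , y∈ , refl ← ∈-map-∷ p₁ = ∈ᵖ-∷ {q = q} refl (points-sound q y∈)
points-sound ((true , false) ∷ q) p with _ , y∈ , refl ← ∈-map-∷ p = ∈ᵖ-∷ {q = q} refl (points-sound q y∈)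
points-sound ((false , true) ∷ q) p with _ , y∈ , refl ← ∈-map-∷ p = ∈ᵖ-∷ {q = q} refl (points-sound q y∈)

points-complete : (q : Pattern n) {x : Vertex n} → x ∈ᵖ q → x ∈ points q
points-complete []                   {[]}        _  = here refl
points-complete ((true , true) ∷ q)  {false ∷ x} x∈ = ∈ₚ.∈-++⁺ˡ (∈ₚ.∈-map⁺ (false ∷_) (points-complete q (x∈ ∘ suc)))
points-complete ((true , true) ∷ q)  {true ∷ x}  x∈ = ∈ₚ.∈-++⁺ʳ _ (∈ₚ.∈-map⁺ (true ∷_) (points-complete q (x∈ ∘ suc)))
points-complete ((true , false) ∷ q) {false ∷ x} x∈ = ∈ₚ.∈-map⁺ (false ∷_) (points-complete q (x∈ ∘ suc))
points-complete ((true , false) ∷ q) {true ∷ x}  x∈ = contradiction (x∈ zero) λ ()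
points-complete ((false , true) ∷ q) {false ∷ x} x∈ = contradiction (x∈ zero) λ ()
points-complete ((false , true) ∷ q) {true ∷ x}  x∈ = ∈ₚ.∈-map⁺ (true ∷_) (points-complete q (x∈ ∘ suc))
points-complete ((false , false) ∷ q) {false ∷ x} x∈ = contradiction (x∈ zero) λ ()
points-complete ((false , false) ∷ q) {true ∷ x}  x∈ = contradiction (x∈ zero) λ ()

half-sound : (q : Pattern n) {x : Vertex n} → x ∈ half q → x ∈ᵖ q
half-sound ((true , true) ∷ q)  p with _ , y∈ , refl ← ∈-map-∷ p = ∈ᵖ-∷ {q = q} refl (points-sound q y∈)
half-sound ((true , false) ∷ q) p with _ , y∈ , refl ← ∈-map-∷ p = ∈ᵖ-∷ {q = q} refl (half-sound q y∈)
half-sound ((false , true) ∷ q) p with _ , y∈ , refl ← ∈-map-∷ p = ∈ᵖ-∷ {q = q} refl (half-sound q y∈)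

antipode-∈ : (q : Pattern n) {x : Vertex n} → x ∈ᵖ q → antipode q x ∈ᵖ q
antipode-∈ []                    {[]}        _  = λ ()
antipode-∈ ((true , true) ∷ q)   {false ∷ x} x∈ = ∈ᵖ-∷ {q = q} refl (antipode-∈ q (x∈ ∘ suc))
antipode-∈ ((true , true) ∷ q)   {true ∷ x}  x∈ = ∈ᵖ-∷ {q = q} refl (antipode-∈ q (x∈ ∘ suc))
antipode-∈ ((true , false) ∷ q)  {x ∷ v}     x∈ = ∈ᵖ-∷ {q = q} (x∈ zero) (antipode-∈ q (x∈ ∘ suc))
antipode-∈ ((false , true) ∷ q)  {x ∷ v}     x∈ = ∈ᵖ-∷ {q = q} (x∈ zero) (antipode-∈ q (x∈ ∘ suc))
antipode-∈ ((false , false) ∷ q) {x ∷ v}     x∈ = ∈ᵖ-∷ {q = q} (x∈ zero) (antipode-∈ q (x∈ ∘ suc))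

antipode-involutive : (q : Pattern n) (x : Vertex n) → antipode q (antipode q x) ≡ x
antipode-involutive []                    []      = refl
antipode-involutive ((true , true) ∷ q)   (x ∷ v) = cong₂ _∷_ (𝔹.not-involutive x) (antipode-involutive q v)
antipode-involutive ((true , false) ∷ q)  (x ∷ v) = cong (x ∷_) (antipode-involutive q v)
antipode-involutive ((false , true) ∷ q)  (x ∷ v) = cong (x ∷_) (antipode-involutive q v)
antipode-involutive ((false , false) ∷ q) (x ∷ v) = cong (x ∷_) (antipode-involutive q v)

antipode-dist : (q : Pattern n) (x : Vertex n) → hamming x (antipode q x) ≡ stars q
antipode-dist []                    []          = refl
antipode-dist ((true , true) ∷ q)   (false ∷ v) = cong suc (antipode-dist q v)
antipode-dist ((true , true) ∷ q)   (true ∷ v)  = cong suc (antipode-dist q v)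
antipode-dist ((true , false) ∷ q)  (false ∷ v) = antipode-dist q v
antipode-dist ((true , false) ∷ q)  (true ∷ v)  = antipode-dist q v
antipode-dist ((false , true) ∷ q)  (false ∷ v) = antipode-dist q v
antipode-dist ((false , true) ∷ q)  (true ∷ v)  = antipode-dist q v
antipode-dist ((false , false) ∷ q) (false ∷ v) = antipode-dist q v
antipode-dist ((false , false) ∷ q) (true ∷ v)  = antipode-dist q v

diameter : (q : Pattern n) (x y : Vertex n) → x ∈ᵖ q → y ∈ᵖ q → hamming x y ≤ stars q
diameter []                   []        []        _  _  = z≤n
diameter ((true , true) ∷ q)  (false ∷ x) (false ∷ y) x∈ y∈ = ℕₚ.m≤n⇒m≤1+n (diameter q x y (x∈ ∘ suc) (y∈ ∘ suc))
diameter ((true , true) ∷ q)  (true ∷ x)  (true ∷ y)  x∈ y∈ = ℕₚ.m≤n⇒m≤1+n (diameter q x y (x∈ ∘ suc) (y∈ ∘ suc))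
diameter ((true , true) ∷ q)  (false ∷ x) (true ∷ y)  x∈ y∈ = s≤s (diameter q x y (x∈ ∘ suc) (y∈ ∘ suc))
diameter ((true , true) ∷ q)  (true ∷ x)  (false ∷ y) x∈ y∈ = s≤s (diameter q x y (x∈ ∘ suc) (y∈ ∘ suc))
diameter ((true , false) ∷ q) (false ∷ x) (false ∷ y) x∈ y∈ = diameter q x y (x∈ ∘ suc) (y∈ ∘ suc)
diameter ((true , false) ∷ q) (true ∷ x)  (_ ∷ y)     x∈ y∈ = contradiction (x∈ zero) λ ()
diameter ((true , false) ∷ q) (false ∷ x) (true ∷ y)  x∈ y∈ = contradiction (y∈ zero) λ ()
diameter ((false , true) ∷ q) (true ∷ x)  (true ∷ y)  x∈ y∈ = diameter q x y (x∈ ∘ suc) (y∈ ∘ suc)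
diameter ((false , true) ∷ q) (false ∷ x) (_ ∷ y)     x∈ y∈ = contradiction (x∈ zero) λ ()
diameter ((false , true) ∷ q) (true ∷ x)  (false ∷ y) x∈ y∈ = contradiction (y∈ zero) λ ()
diameter ((false , false) ∷ q) (false ∷ x) y x∈ y∈ = contradiction (x∈ zero) λ ()
diameter ((false , false) ∷ q) (true ∷ x)  y x∈ y∈ = contradiction (x∈ zero) λ ()

diametral⇒antipodal : (q : Pattern n) (x y : Vertex n) → x ∈ᵖ q → y ∈ᵖ q → stars q ≤ hamming x y →
                      x ≡ antipode q y
diametral⇒antipodal []                   []        []        _  _  _ = refl
diametral⇒antipodal ((true , true) ∷ q)  (false ∷ x) (false ∷ y) x∈ y∈ d = contradiction (diameter q x y (x∈ ∘ suc) (y∈ ∘ suc)) (ℕₚ.<⇒≱ d)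
diametral⇒antipodal ((true , true) ∷ q)  (true ∷ x)  (true ∷ y)  x∈ y∈ d = contradiction (diameter q x y (x∈ ∘ suc) (y∈ ∘ suc)) (ℕₚ.<⇒≱ d)
diametral⇒antipodal ((true , true) ∷ q)  (false ∷ x) (true ∷ y)  x∈ y∈ (s≤s d) = cong (false ∷_) (diametral⇒antipodal q x y (x∈ ∘ suc) (y∈ ∘ suc) d)
diametral⇒antipodal ((true , true) ∷ q)  (true ∷ x)  (false ∷ y) x∈ y∈ (s≤s d) = cong (true ∷_) (diametral⇒antipodal q x y (x∈ ∘ suc) (y∈ ∘ suc) d)
diametral⇒antipodal ((true , false) ∷ q) (false ∷ x) (false ∷ y) x∈ y∈ d = cong (false ∷_) (diametral⇒antipodal q x y (x∈ ∘ suc) (y∈ ∘ suc) d)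
diametral⇒antipodal ((true , false) ∷ q) (true ∷ x)  (_ ∷ y)     x∈ y∈ d = contradiction (x∈ zero) λ ()
diametral⇒antipodal ((true , false) ∷ q) (false ∷ x) (true ∷ y)  x∈ y∈ d = contradiction (y∈ zero) λ ()
diametral⇒antipodal ((false , true) ∷ q) (true ∷ x)  (true ∷ y)  x∈ y∈ d = cong (true ∷_) (diametral⇒antipodal q x y (x∈ ∘ suc) (y∈ ∘ suc) d)
diametral⇒antipodal ((false , true) ∷ q) (false ∷ x) (_ ∷ y)     x∈ y∈ d = contradiction (x∈ zero) λ ()
diametral⇒antipodal ((false , true) ∷ q) (true ∷ x)  (false ∷ y) x∈ y∈ d = contradiction (y∈ zero) λ ()
diametral⇒antipodal ((false , false) ∷ q) (false ∷ x) y x∈ y∈ d = contradiction (x∈ zero) λ ()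
diametral⇒antipodal ((false , false) ∷ q) (true ∷ x)  y x∈ y∈ d = contradiction (x∈ zero) λ ()

-- The first free coordinate is true at exactly one of `x` and its antipode; `suc s` guarantees that
-- such a coordinate exists.
half-or-antipode : (q : Pattern n) {x : Vertex n} {s : ℕ} → stars q ≡ suc s → x ∈ᵖ q →
                   x ∈ half q ⊎ antipode q x ∈ half q
half-or-antipode []                   () _
half-or-antipode ((true , true) ∷ q)  {true ∷ x}  _ x∈ = inj₁ (∈ₚ.∈-map⁺ (true ∷_) (points-complete q (x∈ ∘ suc)))
half-or-antipode ((true , true) ∷ q)  {false ∷ x} _ x∈ = inj₂ (∈ₚ.∈-map⁺ (true ∷_) (points-complete q (antipode-∈ q (x∈ ∘ suc))))
half-or-antipode ((true , false) ∷ q) {false ∷ x} eq x∈ =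
  [ inj₁ ∘ ∈ₚ.∈-map⁺ (false ∷_) , inj₂ ∘ ∈ₚ.∈-map⁺ (false ∷_) ]′ (half-or-antipode q eq (x∈ ∘ suc))
half-or-antipode ((true , false) ∷ q) {true ∷ x}  eq x∈ = contradiction (x∈ zero) λ ()
half-or-antipode ((false , true) ∷ q) {true ∷ x}  eq x∈ =
  [ inj₁ ∘ ∈ₚ.∈-map⁺ (true ∷_) , inj₂ ∘ ∈ₚ.∈-map⁺ (true ∷_) ]′ (half-or-antipode q eq (x∈ ∘ suc))
half-or-antipode ((false , true) ∷ q) {false ∷ x} eq x∈ = contradiction (x∈ zero) λ ()
half-or-antipode ((false , false) ∷ q) {true ∷ x}  eq x∈ = contradiction (x∈ zero) λ ()
half-or-antipode ((false , false) ∷ q) {false ∷ x} eq x∈ = contradiction (x∈ zero) λ ()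

half-no-antipodes : (q : Pattern n) {x : Vertex n} → x ∈ half q → antipode q x ∉ half q
half-no-antipodes ((true , true) ∷ q)  {x ∷ v} x∈ a∈ with refl , _ ← uncons-∈ x∈ =
  contradiction (proj₁ (uncons-∈ a∈)) λ ()
half-no-antipodes ((true , false) ∷ q) {x ∷ v} x∈ a∈ = half-no-antipodes q (proj₂ (uncons-∈ x∈)) (proj₂ (uncons-∈ a∈))
half-no-antipodes ((false , true) ∷ q) {x ∷ v} x∈ a∈ = half-no-antipodes q (proj₂ (uncons-∈ x∈)) (proj₂ (uncons-∈ a∈))

points-unique : (q : Pattern n) → Unique (points q)
points-unique []                   = [] ∷ []
points-unique ((true , true) ∷ q)  = Uniqueₚ.++⁺ (Uniqueₚ.map⁺ Vecₚ.∷-injectiveʳ (points-unique q))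
  (Uniqueₚ.map⁺ Vecₚ.∷-injectiveʳ (points-unique q)) λ { {x ∷ v} (p , p′) →
    contradiction (trans (sym (proj₁ (uncons-∈ p))) (proj₁ (uncons-∈ p′))) λ () }
points-unique ((true , false) ∷ q)  = Uniqueₚ.map⁺ Vecₚ.∷-injectiveʳ (points-unique q)
points-unique ((false , true) ∷ q)  = Uniqueₚ.map⁺ Vecₚ.∷-injectiveʳ (points-unique q)
points-unique ((false , false) ∷ q) = []

half-unique : (q : Pattern n) → Unique (half q)
half-unique []                   = []
half-unique ((true , true) ∷ q)   = Uniqueₚ.map⁺ Vecₚ.∷-injectiveʳ (points-unique q)
half-unique ((true , false) ∷ q)  = Uniqueₚ.map⁺ Vecₚ.∷-injectiveʳ (half-unique q)
half-unique ((false , true) ∷ q)  = Uniqueₚ.map⁺ Vecₚ.∷-injectiveʳ (half-unique q)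
half-unique ((false , false) ∷ q) = []

2^ : ℕ → ℕ
2^ zero    = 1
2^ (suc s) = 2^ s + 2^ s

points-length : (q : Pattern n) (x : Vertex n) → x ∈ᵖ q → length (points q) ≡ 2^ (stars q)
points-length []                   _ _  = refl
points-length ((true , true) ∷ q)  (_ ∷ x) x∈ = trans (Listₚ.length-++ (map (false ∷_) (points q)))
  (cong₂ _+_ (trans (Listₚ.length-map _ (points q)) (points-length q x (x∈ ∘ suc)))
             (trans (Listₚ.length-map _ (points q)) (points-length q x (x∈ ∘ suc))))
points-length ((true , false) ∷ q) (_ ∷ x) x∈ = trans (Listₚ.length-map _ (points q)) (points-length q x (x∈ ∘ suc))
points-length ((false , true) ∷ q) (_ ∷ x) x∈ = trans (Listₚ.length-map _ (points q)) (points-length q x (x∈ ∘ suc))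
points-length ((false , false) ∷ q) (true ∷ _)  x∈ = contradiction (x∈ zero) λ ()
points-length ((false , false) ∷ q) (false ∷ _) x∈ = contradiction (x∈ zero) λ ()

half-length : (q : Pattern n) (x : Vertex n) {s : ℕ} → stars q ≡ suc s → x ∈ᵖ q → length (half q) ≡ 2^ s
half-length []                   _ ()
half-length ((true , true) ∷ q)  (_ ∷ x) refl x∈ = trans (Listₚ.length-map _ (points q)) (points-length q x (x∈ ∘ suc))
half-length ((true , false) ∷ q) (_ ∷ x) eq x∈ = trans (Listₚ.length-map _ (half q)) (half-length q x eq (x∈ ∘ suc))
half-length ((false , true) ∷ q) (_ ∷ x) eq x∈ = trans (Listₚ.length-map _ (half q)) (half-length q x eq (x∈ ∘ suc))
half-length ((false , false) ∷ q) (true ∷ _)  eq x∈ = contradiction (x∈ zero) λ ()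
half-length ((false , false) ∷ q) (false ∷ _) eq x∈ = contradiction (x∈ zero) λ ()

unique-⊆-length : {xs ys : Tuple n} → Unique xs → xs ⊆ ys → length xs ≤ length ys
unique-⊆-length []       _ = z≤n
unique-⊆-length {xs = x ∷ xs} {ys} (x∉ ∷ u) s with a , b , refl ← ∈ₚ.∈-∃++ (s (here refl)) =
  subst (suc (length xs) ≤_) (sym (trans (Listₚ.length-++ a) (trans (ℕₚ.+-suc (length a) (length b)) (cong suc (sym (Listₚ.length-++ a))))))
    (s≤s (unique-⊆-length u λ {z} z∈ → avoid a (All.lookup x∉ z∈) (s (there z∈))))
  where
  avoid : ∀ a {b z} → x ≢ z → z ∈ (a ++ x ∷ b) → z ∈ (a ++ b)
  avoid []      x≢z (here z≡x) = contradiction (sym z≡x) x≢z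
  avoid []      x≢z (there p)  = p
  avoid (_ ∷ a) x≢z (here p)   = here p
  avoid (_ ∷ a) x≢z (there p)  = there (avoid a x≢z p)

containsAll : Tuple n → UpSet n
containsAll ds = mkUp (λ σ → All (_∈ σ) ds) (λ σ → all? (λ d → any? (d ≟ᵛ_) σ) ds) (λ s → All.map s)

contains : Vertex n → UpSet n
contains v = mkUp (v ∈_) (λ σ → any? (v ≟ᵛ_) σ) (λ s → s)

-- The cliques in a 4-cube form the boundary of the cross-polytope with vertices half q and their antipodes.
module CrossPolytope (q : Pattern n) (4-stars : stars q ≡ 4) (x₀ : Vertex n) (x₀∈q : x₀ ∈ᵖ q) where

  -- The up-set that is excluded: the cliques of the cube are the tuples in its complement.
  cliques : UpSet n
  cliques = outside q ∪ far

  private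
    ∈q : {σ : Tuple n} → ¬ Holds cliques σ → ∀ {x} → x ∈ σ → x ∈ᵖ q
    ∈q ¬n = ¬outside⇒ {q = q} (¬n ∘ inj₁)

    antipodal : {x y : Vertex n} → x ∈ᵖ q → y ∈ᵖ q → 4 ≤ hamming x y → x ≡ antipode q y
    antipodal {x} {y} x∈ y∈ d = diametral⇒antipodal q x y x∈ y∈ (subst (_≤ _) (sym 4-stars) d)

  -- In a 4-cube only `h` is at distance 4 from the antipode of `h`, so that antipode fits any
  -- clique avoiding `h`. It is not among `ds`, since `half q` contains no antipodal pair.
  vanish-missing : (h : Vertex n) (ds : Tuple n) → h ∈ half q → ds ⊆ half q →
                   Vanish (containsAll ds ∖ cliques ∪ contains h) k
  vanish-missing h ds h∈ ds⊆ = toggle {R = containsAll ds ∖ cliques ∪ contains h} (antipode q h)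
    (λ τ (c , ¬n) → All.map there c ,
      [ [ ⇒¬outside {q = q} (λ { (here refl) → a∈q ; (there p) → ∈q (¬n ∘ inj₁) p })
        , close-∷ {σ = τ} (¬n ∘ inj₁ ∘ inj₂) (λ {x} x∈ → ℕₚ.≮⇒≥ λ d → ¬n (inj₂ (subst (_∈ τ)
            (trans (antipodal (∈q (¬n ∘ inj₁) x∈) a∈q d) (antipode-involutive q h)) x∈))) ]′
      , (λ { (here h≡a) → half-no-antipodes q h∈ (subst (_∈ half q) h≡a h∈) ; (there h∈τ) → ¬n (inj₂ h∈τ) }) ]′)
    (λ τ (c , ¬n) →
      All.tabulate (λ {d} d∈ → any-tail (λ d≡a → half-no-antipodes q h∈ (subst (_∈ half q) d≡a (ds⊆ d∈))) (All.lookup c d∈)) ,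
      λ bad → ¬n (mono (cliques ∪ contains h) {τ} {antipode q h ∷ τ} there bad))
    where
    a∈q : antipode q h ∈ᵖ q
    a∈q = antipode-∈ q (half-sound q h∈)

  private
    missing-resp : ∀ {h ds} σ → σ ∈ʳ (containsAll (h ∷ ds) ∖ cliques) → σ ∈ʳ (containsAll ds ∩ contains h ∖ cliques)
    missing-resp σ (h∈ ∷ c , ¬n) = (c , h∈) , ¬n
    missing-resp′ : ∀ {h ds} σ → σ ∈ʳ (containsAll ds ∩ contains h ∖ cliques) → σ ∈ʳ (containsAll (h ∷ ds) ∖ cliques)
    missing-resp′ σ ((c , h∈) , ¬n) = h∈ ∷ c , ¬n

  -- Cliques missing a vertex of `half q` contribute nothing by `vanish-missing`, so the vertices of
  -- `half q` can be required one after another.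
  vanish-peel : (ds : Tuple n) → ds ⊆ half q → Vanish (containsAll ds ∖ cliques) k → Vanish (everything ∖ cliques) k
  vanish-peel []       _   V = vanish-resp {R = containsAll [] ∖ cliques} {everything ∖ cliques} (λ _ (_ , ¬n) → tt , ¬n) (λ _ (_ , ¬n) → [] , ¬n) V
  vanish-peel (h ∷ ds) ds⊆ V = vanish-peel ds (ds⊆ ∘ there)
    (vanish-split (containsAll ds) cliques (contains h)
      (vanish-resp {R = containsAll (h ∷ ds) ∖ cliques} {containsAll ds ∩ contains h ∖ cliques} missing-resp missing-resp′ V)
      (vanish-missing h ds (ds⊆ (here refl)) (ds⊆ ∘ there)))

  nonvanish-peel : (ds : Tuple n) → ds ⊆ half q → NonVanish (containsAll ds ∖ cliques) (suc k) →
                   NonVanish (everything ∖ cliques) (suc k)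
  nonvanish-peel []       _   V = nonvanish-resp {R = containsAll [] ∖ cliques} {everything ∖ cliques} (λ _ (_ , ¬n) → tt , ¬n) (λ _ (_ , ¬n) → [] , ¬n) V
  nonvanish-peel (h ∷ ds) ds⊆ V = nonvanish-peel ds (ds⊆ ∘ there)
    (nonvanish-from-up (containsAll ds) cliques (contains h)
      (vanish-missing h ds (ds⊆ (here refl)) (ds⊆ ∘ there))
      (nonvanish-resp {R = containsAll (h ∷ ds) ∖ cliques} {containsAll ds ∩ contains h ∖ cliques} missing-resp missing-resp′ V))

  -- A vertex outside `half q` would meet its antipode, which is required, at distance 4.
  top-⊆ : (σ : Tuple n) → σ ∈ʳ (containsAll (half q) ∖ cliques) → σ ⊆ half q
  top-⊆ σ (c , ¬n) {x} x∈ with half-or-antipode q 4-stars (∈q ¬n x∈)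
  ... | inj₁ x∈h = x∈h
  ... | inj₂ a∈h = contradiction (lose x∈ (lose (All.lookup c a∈h) (ℕₚ.≤-reflexive (sym (trans (antipode-dist q x) 4-stars))))) (¬n ∘ inj₂)

  top-length : (σ : Tuple n) → σ ∈ʳ (containsAll (half q) ∖ cliques) → Unique σ → length σ ≡ 8
  top-length σ σ∈ u = ℕₚ.≤-antisym
    (subst (length σ ≤_) 8≡ (unique-⊆-length u (top-⊆ σ σ∈)))
    (subst (_≤ length σ) 8≡ (unique-⊆-length (half-unique q) (All.lookup (proj₁ σ∈))))
    where
    8≡ : length (half q) ≡ 8
    8≡ = half-length q x₀ 4-stars x₀∈q

  -- After peeling only the facet `half q` of the cross-polytope is left, and it has 8 vertices, one
  -- from each antipodal pair.
  vanish-cliques : k ≢ 8 → Vanish (everything ∖ cliques) k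
  vanish-cliques {k} k≢8 = vanish-peel (half q) (λ p → p) (vanish-null {R = containsAll (half q) ∖ cliques} null)
    where
    null : (c : Alt n k) → On (containsAll (half q) ∖ cliques) c → ∀ σ → σ ∈ʳ (containsAll (half q) ∖ cliques) → fun c σ ≡ 0ℤ
    null c c-on σ σ∈ with length σ ℕₚ.≟ k
    ... | no  ≢k = grade c σ ≢k
    ... | yes ≡k = alt-nonunique (fun c) (alt c) σ λ u → k≢8 (trans (sym ≡k) (top-length σ σ∈ u))

  vanish-cube : Vanish (everything ∖ outside q) k
  vanish-cube = toggle {R = everything ∖ outside q} x₀
    (λ τ (_ , ¬o) → tt , ⇒¬outside {q = q} (λ { (here refl) → x₀∈q ; (there p) → ¬outside⇒ {q = q} ¬o p }))
    (λ τ (_ , ¬o) → tt , ¬o ∘ there)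

  -- All subsets of the cube form an acyclic complex, so the connecting map moves degree 8 of the
  -- cliques to degree 9 of the non-cliques.
  vanish-far-in-cube : suc k ≢ 9 → Vanish (far ∖ outside q) (suc k)
  vanish-far-in-cube ≢9 = vanish-resp {R = everything ∩ far ∖ outside q} {far ∖ outside q}
    (λ _ ((_ , f) , ¬o) → f , ¬o) (λ _ (f , ¬o) → (tt , f) , ¬o)
    (vanish-upper everything (outside q) far vanish-cube (vanish-cliques (≢9 ∘ cong suc)))

-- Simplices spanning at most four dimensions

-- Among tuples of weight `w` a coface has the same span, so the level falls apart into the regions
-- `exactly q`.
vanish-level : ∀ w → suc w ≢ n + suc k → Vanish (weighs {n} w ∖ weighs (suc w)) (suc k)
vanish-level {n} {k} w w≢ = vanish-fibres span (weighs w ∖ weighs (suc w)) fibre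
  (λ σ (w≤ , ¬w<) → (w≤ , λ j b on → on) , [ ¬w< , ⇒¬outside {q = span σ} ∈⇒∈ᵖspan ]′)
  (λ q σ ((w≤ , c) , ¬n) → (w≤ , ¬n ∘ inj₁) , exactly⇒≡ {q = q} (c , ¬n ∘ inj₂))
  (λ v τ (w≤ , _) (_ , ¬w<) → sym (⊑-weight⇒≡ {p = span τ} {span (v ∷ τ)} (span-mono {σ = τ} {v ∷ τ} there) (ℕₚ.≤-trans (ℕₚ.≮⇒≥ ¬w<) w≤)))
  vanish-fibre
  where
  fibre : Pattern n → Region n
  fibre q = weighs w ∩ covers q ∖ weighs (suc w) ∪ outside q
  vanish-fibre : ∀ q → Vanish (fibre q) (suc k)
  vanish-fibre q with weight q ℕₚ.≟ w
  ... | yes wq = vanish-resp {R = exactly q} {fibre q}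
    (λ σ σ∈ → let eq = trans (cong weight (exactly⇒≡ {q = q} σ∈)) wq in
      (ℕₚ.≤-reflexive (sym eq) , proj₁ σ∈) , [ ℕₚ.≤⇒≯ (ℕₚ.≤-reflexive eq) , proj₂ σ∈ ]′)
    (λ σ ((_ , c) , ¬n) → c , ¬n ∘ inj₂)
    (vanish-exactly w q wq w≢)
  ... | no wq = vanish-empty {R = fibre q} λ σ _ ((w≤ , c) , ¬n) →
    wq (trans (cong weight (sym (exactly⇒≡ {q = q} (c , ¬n ∘ inj₂)))) (ℕₚ.≤-antisym (ℕₚ.≮⇒≥ (¬n ∘ inj₁)) w≤))

-- Every level below `n + 5` contributes at most in dimension 4, whereas the dimension here is
-- `k ≥ 5`.
vanish-narrow-high : ∀ w → w ≤ n + 5 → 5 ≤ k → Vanish (everything ∖ weighs {n} w) (suc k)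
vanish-narrow-high     zero    _  _   = vanish-empty {R = everything ∖ weighs 0} λ σ _ (_ , ¬n) → ¬n z≤n
vanish-narrow-high {n} {k} (suc w) w< 5≤k =
  vanish-split everything (weighs (suc w)) (weighs w)
    (vanish-resp {R = weighs w ∖ weighs (suc w)} {everything ∩ weighs w ∖ weighs (suc w)}
      (λ _ (w≤ , ¬n) → (tt , w≤) , ¬n) (λ _ ((_ , w≤) , ¬n) → w≤ , ¬n)
      (vanish-level w λ eq → ℕₚ.<⇒≱ (ℕₚ.≤-<-trans (ℕₚ.≤-trans (ℕₚ.≤-reflexive (sym eq)) w<) (ℕₚ.+-monoʳ-< n (s≤s 5≤k))) ℕₚ.≤-refl))
    (vanish-resp {R = everything ∖ weighs w} {everything ∖ weighs (suc w) ∪ weighs w}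
      (λ _ (_ , ¬n) → tt , [ ¬n ∘ ℕₚ.<⇒≤ , ¬n ]′) (λ _ (_ , ¬n) → tt , ¬n ∘ inj₂)
      (vanish-narrow-high w (ℕₚ.<⇒≤ w<) 5≤k))

-- Levels from `n + 5` on contribute only from dimension 5 on. `m` is fuel: at zero the weight would
-- exceed its maximum `n + n`.
vanish-above : ∀ m w → n + n < w + m → n + 5 ≤ w → suc k ≤ 5 → Vanish (weighs {n} w ∖ nothing) (suc k)
vanish-above {n} zero w 2n<w _ _ = vanish-empty {R = weighs w ∖ nothing} λ σ _ (w≤ , _) →
  ℕₚ.<⇒≱ (subst (n + n <_) (ℕₚ.+-identityʳ w) 2n<w) (ℕₚ.≤-trans w≤ (weight≤2n (span σ)))
vanish-above {n} {k} (suc m) w 2n<w 5≤w k≤ =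
  vanish-split (weighs w) nothing (weighs (suc w))
    (vanish-resp {R = weighs (suc w) ∖ nothing} {weighs w ∩ weighs (suc w) ∖ nothing}
      (λ _ (w≤ , ¬n) → (ℕₚ.<⇒≤ w≤ , w≤) , ¬n) (λ _ ((_ , w≤) , ¬n) → w≤ , ¬n)
      (vanish-above m (suc w) (subst (n + n <_) (ℕₚ.+-suc w m) 2n<w) (ℕₚ.m≤n⇒m≤1+n 5≤w) k≤))
    (vanish-resp {R = weighs w ∖ weighs (suc w)} {weighs w ∖ nothing ∪ weighs (suc w)}
      (λ _ (w≤ , ¬n) → w≤ , [ (λ ()) , ¬n ]′) (λ _ (w≤ , ¬n) → w≤ , ¬n ∘ inj₂)
      (vanish-level w λ eq → ℕₚ.<⇒≱ (s≤s (ℕₚ.≤-trans (ℕₚ.+-monoʳ-≤ n k≤) 5≤w)) (ℕₚ.≤-reflexive eq)))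

vanish-all : Vanish (everything {n} ∖ nothing) k
vanish-all {n} = toggle {R = everything ∖ nothing} (Vec.replicate n false) (λ _ _ → tt , λ ()) (λ _ _ → tt , λ ())

-- Below dimension 4 the narrow tuples have the homology of all tuples, which is zero; the wide ones
-- would interfere one degree higher, where they contribute nothing yet.
vanish-narrow-low : suc (suc k) ≤ 5 → Vanish (everything ∖ wide {n}) (suc k)
vanish-narrow-low {n = n} k≤ = vanish-resp {R = everything ∖ nothing ∪ wide} {everything ∖ wide}
  (λ _ (_ , ¬n) → tt , ¬n ∘ inj₂) (λ _ (_ , ¬n) → tt , [ (λ ()) , ¬n ]′)
  (vanish-lower everything nothing wide vanish-all
    (vanish-resp {R = wide ∖ nothing} {everything ∩ wide ∖ nothing}
      (λ _ (w , ¬n) → (tt , w) , ¬n) (λ _ ((_ , w) , ¬n) → w , ¬n)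
      (vanish-above n (n + 5) (s≤s′ n) ℕₚ.≤-refl k≤)))
  where
  s≤s′ : ∀ n → n + n < n + 5 + n
  s≤s′ n = ℕₚ.+-monoˡ-< n (ℕₚ.m<m+n n (s≤s z≤n))

vanish-narrow : suc k ≢ 5 → Vanish (everything ∖ wide {n}) (suc k)
vanish-narrow {k} {n} k≢ with suc k ≤? 5
... | yes k≤ = vanish-narrow-low (ℕₚ.≤∧≢⇒< k≤ k≢)
... | no  k≰ = vanish-narrow-high (n + 5) ℕₚ.≤-refl (ℕₚ.≤-pred (ℕₚ.≰⇒> k≰))

-- A distance of 4 forces weight at least `n + 4`, narrowness at most `n + 4`. All these tuples have
-- equal weight, so `span` separates them into 4-cubes.
vanish-far-narrow : suc k ≢ 9 → Vanish (far ∖ wide {n}) (suc k)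
vanish-far-narrow {k} {n} ≢9 = vanish-fibres span (far ∖ wide) fibre
  (λ σ (f , ¬w) → (f , λ j b on → on) , [ ¬w , ⇒¬outside {q = span σ} ∈⇒∈ᵖspan ]′)
  (λ q σ ((f , c) , ¬n) → (f , ¬n ∘ inj₁) , exactly⇒≡ {q = q} (c , ¬n ∘ inj₂))
  (λ v τ (f , _) (_ , ¬w) → sym (⊑-weight⇒≡ {p = span τ} {span (v ∷ τ)} (span-mono {σ = τ} {v ∷ τ} there)
    (ℕₚ.≤-trans (upper {v ∷ τ} ¬w) (lower τ f))))
  vanish-fibre
  where
  fibre : Pattern n → Region n
  fibre q = far ∩ covers q ∖ wide ∪ outside q
  lower : ∀ σ → Holds far σ → n + 4 ≤ weight (span σ)
  lower σ f with x , x∈ , g ← find f with y , y∈ , d ← find g =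
    ℕₚ.≤-trans (ℕₚ.+-monoʳ-≤ n d) (far-weight {σ = σ} x∈ y∈)
  upper : ∀ {σ} → ¬ Wide σ → weight (span σ) ≤ n + 4
  upper {σ} ¬w = ℕₚ.≤-pred (subst (weight (span σ) <_) (ℕₚ.+-suc n 4) (ℕₚ.≰⇒> ¬w))
  vanish-fibre : ∀ q → Vanish (fibre q) (suc k)
  vanish-fibre q with weight q ℕₚ.≟ n + 4 | any? (_∈ᵖ? q) (allVertices n)
  ... | no wq | _ = vanish-empty {R = fibre q} λ σ _ ((f , c) , ¬n) →
    wq (trans (cong weight (sym (exactly⇒≡ {q = q} (c , ¬n ∘ inj₂)))) (ℕₚ.≤-antisym (upper {σ} (¬n ∘ inj₁)) (lower σ f)))
  ... | yes wq | no empty = vanish-empty {R = fibre q} λ σ _ ((f , c) , ¬n) →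
    let x , x∈ , _ = find f in empty (lose (vertices-complete x) (¬outside⇒ {q = q} (¬n ∘ inj₂) x∈))
  ... | yes wq | yes some with x₀ , _ , x₀∈q ← find some =
    -- A non-clique inside the 4-cube `q` already spans all of `q`.
    vanish-resp {R = far ∖ outside q} {fibre q}
      (λ σ (f , ¬o) →
        let ⊑q = span⊑ {σ = σ} {q} (¬outside⇒ {q = q} ¬o)
            eq = ⊑-weight⇒≡ {p = span σ} {q} ⊑q (ℕₚ.≤-trans (ℕₚ.≤-reflexive wq) (lower σ f))
        in (f , subst (_⊑ span σ) eq (λ j b on → on)) ,
           [ (λ w → ℕₚ.<⇒≱ (ℕₚ.+-monoʳ-< n (ℕₚ.n<1+n 4)) (ℕₚ.≤-trans w (ℕₚ.≤-reflexive (trans (cong weight eq) wq)))) , ¬o ]′)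
      (λ σ ((f , _) , ¬n) → f , ¬n ∘ inj₂)
      (CrossPolytope.vanish-far-in-cube q
        (ℕₚ.+-cancelˡ-≡ n (stars q) 4 (trans (sym (weight-stars q x₀ x₀∈q)) wq)) x₀ x₀∈q ≢9)

rips : Region n
rips = everything ∖ far

-- Wide cliques drop out. The narrow cliques sit below the narrow non-cliques inside all narrow
-- tuples: degree 5 comes from the latter, degree 8 from degree 9 of the non-cliques.
vanish-rips : suc k ≢ 5 → suc k ≢ 8 → Vanish (rips {n}) (suc k)
vanish-rips {k} {n} ≢5 ≢8 = vanish-split everything far wide
  (vanish-resp {R = wide ∖ far} {everything ∩ wide ∖ far}
    (λ _ (w , ¬f) → (tt , w) , ¬f) (λ _ ((_ , w) , ¬f) → w , ¬f) vanish-wide)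
  (vanish-resp {R = everything ∖ wide ∪ far} {everything ∖ far ∪ wide}
    (λ _ (_ , ¬n) → tt , [ ¬n ∘ inj₂ , ¬n ∘ inj₁ ]′) (λ _ (_ , ¬n) → tt , [ ¬n ∘ inj₂ , ¬n ∘ inj₁ ]′)
    (vanish-lower everything wide far (vanish-narrow ≢5)
      (vanish-resp {R = far ∖ wide} {everything ∩ far ∖ wide}
        (λ _ (f , ¬w) → (tt , f) , ¬w) (λ _ ((_ , f) , ¬w) → f , ¬w)
        (vanish-far-narrow (≢8 ∘ ℕₚ.suc-injective)))))

-- Nonvanishing homology in small dimensions

1ᴬ : Alt n 0
1ᴬ {n} = mkAlt unit (λ { [] _ _ _ → refl ; (_ ∷ _) _ _ _ → refl })
                    (λ { [] ≢0 → contradiction refl ≢0 ; (_ ∷ _) _ → refl })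
  where
  unit : Tuple n → ℤ
  unit []      = 1ℤ
  unit (_ ∷ _) = 0ℤ

-- The exterior product of the vertices of `hs`, that is, the oriented simplex as an elementary
-- chain.
simplex : (hs : Tuple n) → Alt n (length hs)
simplex []       = 1ᴬ
simplex (h ∷ hs) = coneᴬ h (simplex hs)

simplex-support : (hs σ : Tuple n) → ¬ (σ ⊆ hs × hs ⊆ σ) → fun (simplex hs) σ ≡ 0ℤ
simplex-support []       []      ¬s = ⊥-elim (¬s ((λ p → p) , (λ p → p)))
simplex-support []       (_ ∷ _) _  = refl
simplex-support (h ∷ hs) σ       ¬s = cone-zero h (fun (simplex hs)) σ λ ρ τ eq →
  simplex-support hs (ρ ++ τ) λ (s , t) → ¬s
    ( (λ p → case move-front ρ h τ (subst (_ ∈_) eq p) of λ { (here q) → here q ; (there q) → there (s q) })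
    , (λ p → subst (_ ∈_) (sym eq) (move-back ρ h τ (case p of λ { (here q) → here q ; (there q) → there (t q) }))))

simplex-self : {hs : Tuple n} → Unique hs → fun (simplex hs) hs ≡ 1ℤ
simplex-self []       = refl
simplex-self {hs = h ∷ hs} (h∉ ∷ u) = cong₂ (λ a b → a ⊕ ⊖ b)
  (trans (δ-yes {v = h} refl) (simplex-self u))
  (cone-zero h (λ σ → fun (simplex hs) (h ∷ σ)) hs λ ρ τ eq →
    contradiction refl (All.lookup h∉ (subst (h ∈_) (sym eq) (∈ₚ.∈-++⁺ʳ ρ (here refl)))))

-- Only the vertex set of `hs` occurs in the region, so the region holds no nondegenerate coface
-- that could fill the elementary chain.
nonvanish-single : {R : Region n} {hs : Tuple n} → Unique hs → hs ∈ʳ R →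
                   (∀ σ → σ ∈ʳ R → σ ⊆ hs) → (∀ σ → σ ∈ʳ R → hs ⊆ σ) → NonVanish R (length hs)
nonvanish-single {n} {R} {hs} u hs∈R below above =
  simplex hs ,
  (λ σ σ∉R → simplex-support hs σ λ (s , t) → σ∉R (∈ʳ-resp R t s hs∈R)) ,
  (λ τ τ∈R → Σᵛ-0 {n} λ v → grade (simplex hs) (v ∷ τ) λ eq →
    ℕₚ.<⇒≱ (ℕₚ.≤-reflexive eq) (unique-⊆-length u (above τ τ∈R))) ,
  λ (e , e-on , ∂e) → contradiction
    (trans (sym (simplex-self u)) (trans (sym (∂e hs hs∈R)) (Σᵛ-0 {n} (zero-coface e e-on)))) λ ()
  where
  zero-coface : (e : Alt n (suc (length hs))) → On R e → ∀ v → fun e (v ∷ hs) ≡ 0ℤ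
  zero-coface e e-on v with (v ∷ hs) ∈ʳ? R
  ... | no  vhs∉R = e-on _ vhs∉R
  ... | yes vhs∈R = alt-nonunique (fun e) (alt e) (v ∷ hs)
    λ { (v∉ ∷ _) → All.lookup v∉ (below _ vhs∈R (here refl)) refl }

update-∈ᵖ : (q : Pattern n) (i : Fin n) → Star q i → {x : Vertex n} → x ∈ᵖ q → (x [ i ]≔ true) ∈ᵖ q
update-∈ᵖ q i star {x} x∈q j with j Finₚ.≟ i
... | no  j≢i  = subst (λ b → allows q j b ≡ true) (sym (Vecₚ.lookup∘updateAt′ j i j≢i x)) (x∈q j)
... | yes refl = subst (λ b → allows q i b ≡ true) (sym (Vecₚ.lookup∘updateAt i x)) (proj₂ star)

-- The induction of `vanish-exactly`, now carrying a class upwards from the facet. The ambient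
-- dimension is positive so that a spanning tuple is nonempty in the base case.
nonvanish-exactly : ∀ s (q : Pattern (suc n)) (x : Vertex (suc n)) → x ∈ᵖ q → weight q ≡ suc n + s →
                    NonVanish (exactly q) (suc s)
nonvanish-exactly {n} s q x x∈q wq with star? q
nonvanish-exactly {n} s q x x∈q wq | yes (i , star) = go s wq
  where
  x′ = x [ i ]≔ true
  x′∈ : x′ ∈ᵖ facet q i
  x′∈ = ∈facet q i star x′ (update-∈ᵖ q i star {x} x∈q) (Vecₚ.lookup∘updateAt i x)
  go : ∀ s → weight q ≡ suc n + s → NonVanish (exactly q) (suc s)
  go zero wq = contradiction
    (ℕₚ.≤-trans (ℕₚ.≤-reflexive (sym (weight-vertex x′))) (weight-mono {p = span (x′ ∷ [])} {facet q i}
      (span⊑ {σ = x′ ∷ []} {facet q i} λ { (here refl) → x′∈ })))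
    (ℕₚ.<⇒≱ (ℕₚ.≤-reflexive (trans (sym (facet-weight q i star)) (trans wq (ℕₚ.+-identityʳ (suc n))))))
  go (suc s) wq = nonvanish-resp {R = covers (facet q i) ∩ covers q ∖ outside q} {exactly q}
    (upper⇒exactly q i star) (exactly⇒upper q i star)
    (nonvanish-up-from-lo (covers (facet q i)) (outside q) (covers q) (vanish-cube∪facet q i star)
      (nonvanish-resp {R = exactly (facet q i)} {covers (facet q i) ∖ outside q ∪ covers q}
        (exactly⇒lower q i star) (lower⇒exactly q i star)
        (nonvanish-exactly s (facet q i) x′ x′∈
          (ℕₚ.suc-injective (trans (sym (facet-weight q i star)) (trans wq (ℕₚ.+-suc (suc n) s)))))))
nonvanish-exactly {n} s q x x∈q wq | no ¬star = subst (λ s → NonVanish (exactly q) (suc s)) s≡0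
  (nonvanish-single {R = exactly q} {x ∷ []} ([] ∷ []) (≡⇒exactly {q = q} {x ∷ []} span≡q)
    (λ σ σ∈ {y} y∈ → here (only y (¬outside⇒ {q = q} (proj₂ σ∈) y∈)))
    (λ σ σ∈ → λ { (here refl) → x∈σ σ σ∈ }))
  where
  only : ∀ y → y ∈ᵖ q → y ≡ x
  only y y∈q = no-star⇒≡ {q = q} ¬star y x y∈q x∈q
  span≡q : span (x ∷ []) ≡ q
  span≡q = ⊑-antisym {p = span (x ∷ [])} {q} (span⊑ {σ = x ∷ []} {q} λ { (here refl) → x∈q })
    λ j b on → takes⇒span (x ∷ []) j b (here (decidable-stable (lookup x j 𝔹.≟ b) λ ≢b →
      ¬star (j , both j b on (x∈q j) ≢b)))
    where
    both : ∀ j b → allows q j b ≡ true → allows q j (lookup x j) ≡ true → lookup x j ≢ b → Star q j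
    both j b on xon ≢b with lookup x j
    both j false on xon ≢b | false = contradiction refl ≢b
    both j true  on xon ≢b | false = xon , on
    both j false on xon ≢b | true  = on , xon
    both j true  on xon ≢b | true  = contradiction refl ≢b
  s≡0 : 0 ≡ s
  s≡0 = ℕₚ.+-cancelˡ-≡ (suc n) 0 s (trans (ℕₚ.+-identityʳ (suc n)) (trans (sym (weight-vertex x)) (trans (cong weight span≡q) wq)))
  x∈σ : ∀ σ → σ ∈ʳ exactly q → x ∈ σ
  x∈σ σ (c , ¬o) with y , y∈ , _ ← find (span⇒takes σ zero (lookup x zero) (c zero (lookup x zero) (x∈q zero))) =
    subst (_∈ σ) (only y (¬outside⇒ {q = q} ¬o y∈)) y∈

whole : ∀ n → Pattern n
whole n = Vec.replicate n (true , true)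

∈-whole : (x : Vertex n) → x ∈ᵖ whole n
∈-whole x j = trans (cong (pick (lookup x j)) (Vecₚ.lookup-replicate j (true , true))) (on (lookup x j))
  where
  on : ∀ b → pick b (true , true) ≡ true
  on false = refl
  on true  = refl

inside-whole : (σ : Tuple n) → ¬ Holds (outside (whole n)) σ
inside-whole {n} σ = ⇒¬outside {q = whole n} (λ {x} _ → ∈-whole x)

-- In the 5-cube, wide means spanning everything. The class of degree 6 on the spanning tuples
-- descends to degree 5 on the narrow ones and lifts to the narrow cliques; it survives among all
-- cliques because the wide ones are acyclic.
nonvanish-rips₅ : NonVanish (rips {5}) 5
nonvanish-rips₅ = nonvanish-from-lo everything far wide
  (vanish-resp {R = wide ∖ far} {everything ∩ wide ∖ far}
    (λ _ (w , ¬f) → (tt , w) , ¬f) (λ _ ((_ , w) , ¬f) → w , ¬f) vanish-wide)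
  (nonvanish-resp {R = everything ∖ wide ∪ far} {everything ∖ far ∪ wide}
    (λ _ (_ , ¬n) → tt , [ ¬n ∘ inj₂ , ¬n ∘ inj₁ ]′) (λ _ (_ , ¬n) → tt , [ ¬n ∘ inj₂ , ¬n ∘ inj₁ ]′)
    (nonvanish-to-lo everything wide far
      (vanish-resp {R = far ∖ wide} {everything ∩ far ∖ wide}
        (λ _ (f , ¬w) → (tt , f) , ¬w) (λ _ ((_ , f) , ¬w) → f , ¬w) (vanish-far-narrow λ ()))
      (nonvanish-resp {R = everything ∖ nothing ∪ covers (whole 5)} {everything ∖ wide}
        (λ σ (_ , ¬n) → tt , ¬n ∘ inj₂ ∘ wide⇒covers σ)
        (λ σ (_ , ¬w) → tt , [ (λ ()) , ¬w ∘ weight-mono {p = whole 5} {span σ} ]′)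
        (nonvanish-lo-from-up everything nothing (covers (whole 5)) vanish-all
          (nonvanish-resp {R = exactly (whole 5)} {everything ∩ covers (whole 5) ∖ nothing}
            (λ _ (c , _) → (tt , c) , λ ()) (λ σ ((_ , c) , _) → c , inside-whole σ)
            (nonvanish-exactly 5 (whole 5) (Vec.replicate 5 false) (∈-whole (Vec.replicate 5 false)) refl))))))
  where
  wide⇒covers : (σ : Tuple 5) → Wide σ → whole 5 ⊑ span σ
  wide⇒covers σ w = subst (_⊑ span σ)
    (⊑-weight⇒≡ {p = span σ} {whole 5} (span⊑ {σ = σ} {whole 5} (λ {x} _ → ∈-whole x)) w) (λ j b on → on)

-- The elementary chain on the facet `half q` is nontrivial relative to the other cliques; peeling
-- backwards extends it to an absolute cycle, the fundamental class of the 7-sphere up to sign.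
nonvanish-rips₄ : NonVanish (rips {4}) 8
nonvanish-rips₄ = nonvanish-resp {R = everything ∖ cliques} {rips}
  (λ _ (_ , ¬n) → tt , ¬n ∘ inj₂) (λ σ (_ , ¬f) → tt , [ inside-whole σ , ¬f ]′)
  (nonvanish-peel (half q) (λ p → p) (nonvanish-single {R = containsAll (half q) ∖ cliques} (half-unique q)
    (All.tabulate (λ p → p) , [ inside-whole (half q) , close⇒¬far (λ {x} {y} x∈ y∈ → ℕₚ.≮⇒≥ λ d →
      half-no-antipodes q y∈ (subst (_∈ half q) (diametral⇒antipodal q x y (∈-whole x) (∈-whole y) d) x∈)) ]′)
    top-⊆ (λ σ σ∈ → All.lookup (proj₁ σ∈))))
  where
  q = whole 4
  open CrossPolytope q refl (Vec.replicate 4 false) (∈-whole (Vec.replicate 4 false))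

-- Functoriality

variable
  m : ℕ

δ-sym : (v w : Vertex n) (a : ℤ) → δ v w a ≡ δ w v a
δ-sym v w a with v ≟ᵛ w
... | yes v≡w = sym (δ-yes {v = w} {v} (sym v≡w))
... | no  v≢w = sym (δ-no {v = w} {v} (v≢w ∘ sym))

δ-Σᵛ : (a b : Vertex n) (f : Vertex m → ℤ) → δ a b (Σᵛ f) ≡ Σᵛ (λ w → δ a b (f w))
δ-Σᵛ {m = m} a b f with does (a ≟ᵛ b)
... | true  = refl
... | false = sym (Σᵛ-0 {m} λ _ → refl)

δ-δ : (a b : Vertex n) (c d : Vertex m) (z : ℤ) → δ a b (δ c d z) ≡ δ c d (δ a b z)
δ-δ a b c d z with does (a ≟ᵛ b) | does (c ≟ᵛ d)
... | true  | _     = refl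
... | false | true  = refl
... | false | false = refl

module _ (f : Vertex m → Vertex n) where

  -- The pushforward: the sum of `c` over all tuples that `f` maps to the given one.
  push : (Tuple m → ℤ) → Tuple n → ℤ
  push c []      = c []
  push c (v ∷ τ) = Σᵛ λ w → δ (f w) v (push (λ σ → c (w ∷ σ)) τ)

  push-cong : {c d : Tuple m → ℤ} → (∀ σ → c σ ≡ d σ) → ∀ τ → push c τ ≡ push d τ
  push-cong c≗d []      = c≗d []
  push-cong c≗d (v ∷ τ) = Σᵛ-cong λ w → cong (δ (f w) v) (push-cong (λ σ → c≗d (w ∷ σ)) τ)

  push-⊖ : (c : Tuple m → ℤ) (τ : Tuple n) → push (λ σ → ⊖ c σ) τ ≡ ⊖ push c τ
  push-⊖ c []      = refl
  push-⊖ c (v ∷ τ) = trans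
    (Σᵛ-cong λ w → trans (cong (δ (f w) v) (push-⊖ (λ σ → c (w ∷ σ)) τ)) (δ-⊖ (f w) v _))
    (Σᵛ-⊖ (λ w → δ (f w) v (push (λ σ → c (w ∷ σ)) τ)))

  push-Σᵛ : ∀ {l} (c : Vertex l → Tuple m → ℤ) (τ : Tuple n) →
            push (λ σ → Σᵛ (λ u → c u σ)) τ ≡ Σᵛ (λ u → push (c u) τ)
  push-Σᵛ c []      = refl
  push-Σᵛ c (v ∷ τ) = trans
    (Σᵛ-cong λ w → trans (cong (δ (f w) v) (push-Σᵛ (λ u σ → c u (w ∷ σ)) τ))
                         (δ-Σᵛ (f w) v (λ u → push (λ σ → c u (w ∷ σ)) τ)))
    (Σᵛ-swap (λ w u → δ (f w) v (push (λ σ → c u (w ∷ σ)) τ)))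

  push-zero : (c : Tuple m → ℤ) (τ : Tuple n) → (∀ σ → map f σ ≡ τ → c σ ≡ 0ℤ) → push c τ ≡ 0ℤ
  push-zero c []      h = h [] refl
  push-zero c (v ∷ τ) h = Σᵛ-0 term
    where
    term : ∀ w → δ (f w) v (push (λ σ → c (w ∷ σ)) τ) ≡ 0ℤ
    term w with f w ≟ᵛ v
    ... | yes fw≡v = push-zero (λ σ → c (w ∷ σ)) τ λ σ fσ≡τ → h (w ∷ σ) (cong₂ _∷_ fw≡v fσ≡τ)
    ... | no  _    = refl

  push-alt : (c : Tuple m → ℤ) → Alternating c → Alternating (push c)
  push-alt c a []      x y τ = begin
    Σᵛ (λ w → δ (f w) x (Σᵛ λ u → δ (f u) y (P w u)))          ≡⟨ Σᵛ-cong (λ w → δ-Σᵛ (f w) x (λ u → δ (f u) y (P w u))) ⟩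
    Σᵛ (λ w → Σᵛ λ u → δ (f w) x (δ (f u) y (P w u)))          ≡⟨ Σᵛ-swap (λ w u → δ (f w) x (δ (f u) y (P w u))) ⟩
    Σᵛ (λ u → Σᵛ λ w → δ (f w) x (δ (f u) y (P w u)))          ≡⟨ Σᵛ-cong (λ u → Σᵛ-cong (λ w → swapped u w)) ⟩
    Σᵛ (λ u → Σᵛ λ w → ⊖ δ (f u) y (δ (f w) x (P u w)))        ≡⟨ Σᵛ-cong (λ u → Σᵛ-⊖ (λ w → δ (f u) y (δ (f w) x (P u w)))) ⟩
    Σᵛ (λ u → ⊖ Σᵛ λ w → δ (f u) y (δ (f w) x (P u w)))        ≡⟨ Σᵛ-⊖ (λ u → Σᵛ λ w → δ (f u) y (δ (f w) x (P u w))) ⟩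
    ⊖ Σᵛ (λ u → Σᵛ λ w → δ (f u) y (δ (f w) x (P u w)))        ≡⟨ cong ⊖_ (Σᵛ-cong (λ u → δ-Σᵛ (f u) y (λ w → δ (f w) x (P u w)))) ⟨
    ⊖ Σᵛ (λ u → δ (f u) y (Σᵛ λ w → δ (f w) x (P u w)))        ∎
    where
    open ≡-Reasoning
    P : Vertex m → Vertex m → ℤ
    P w u = push (λ σ → c (w ∷ u ∷ σ)) τ
    swapped : ∀ u w → δ (f w) x (δ (f u) y (P w u)) ≡ ⊖ δ (f u) y (δ (f w) x (P u w))
    swapped u w = begin
      δ (f w) x (δ (f u) y (P w u))     ≡⟨ δ-δ (f w) x (f u) y (P w u) ⟩
      δ (f u) y (δ (f w) x (P w u))     ≡⟨ cong (λ z → δ (f u) y (δ (f w) x z)) (trans (push-cong (λ σ → a [] w u σ) τ) (push-⊖ (λ σ → c (u ∷ w ∷ σ)) τ)) ⟩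
      δ (f u) y (δ (f w) x (⊖ P u w))   ≡⟨ cong (δ (f u) y) (δ-⊖ (f w) x (P u w)) ⟩
      δ (f u) y (⊖ δ (f w) x (P u w))   ≡⟨ δ-⊖ (f u) y (δ (f w) x (P u w)) ⟩
      ⊖ δ (f u) y (δ (f w) x (P u w))   ∎
  push-alt c a (z ∷ ρ) x y τ = trans
    (Σᵛ-cong λ w → trans (cong (δ (f w) z) (push-alt (λ σ → c (w ∷ σ)) (λ ρ′ → a (w ∷ ρ′)) ρ x y τ))
                         (δ-⊖ (f w) z (push (λ σ → c (w ∷ σ)) (ρ ++ y ∷ x ∷ τ))))
    (Σᵛ-⊖ (λ w → δ (f w) z (push (λ σ → c (w ∷ σ)) (ρ ++ y ∷ x ∷ τ))))

  bd-push : (c : Tuple m → ℤ) (τ : Tuple n) → bd (push c) τ ≡ push (bd c) τ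
  bd-push c τ = begin
    Σᵛ (λ v → Σᵛ λ w → δ (f w) v (P w))   ≡⟨ Σᵛ-swap (λ v w → δ (f w) v (P w)) ⟩
    Σᵛ (λ w → Σᵛ λ v → δ (f w) v (P w))   ≡⟨ Σᵛ-cong (λ w → trans (Σᵛ-cong (λ v → δ-sym (f w) v (P w))) (Σᵛ-δ (f w) (λ _ → P w))) ⟩
    Σᵛ P                                  ≡⟨ push-Σᵛ (λ w σ → c (w ∷ σ)) τ ⟨
    push (bd c) τ                         ∎
    where
    open ≡-Reasoning
    P : Vertex m → ℤ
    P w = push (λ σ → c (w ∷ σ)) τ

  pushᴬ : Alt m k → Alt n k
  pushᴬ (mkAlt c a g) = mkAlt (push c) (push-alt c a) λ τ τ≢k →
    push-zero c τ λ σ fσ≡τ → g σ λ σ≡k → τ≢k (trans (cong length (sym fσ≡τ)) (trans (Listₚ.length-map f σ) σ≡k))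

push-δ : (f : Vertex m → Vertex n) {l : ℕ} (a b : Vertex l) (c : Tuple m → ℤ) (τ : Tuple n) →
         push f (λ σ → δ a b (c σ)) τ ≡ δ a b (push f c τ)
push-δ f a b c τ with does (a ≟ᵛ b)
... | true  = refl
... | false = push-zero f (λ _ → 0ℤ) τ λ _ _ → refl

push-retract : (i : Vertex m → Vertex n) (r : Vertex n → Vertex m) → (∀ x → r (i x) ≡ x) →
               (c : Tuple m → ℤ) (τ : Tuple m) → push r (push i c) τ ≡ c τ
push-retract i r ri c []      = refl
push-retract i r ri c (v ∷ τ) = begin
  Σᵛ (λ w → δ (r w) v (push r (λ σ → Σᵛ λ x → δ (i x) w (push i (cₓ x) σ)) τ))   ≡⟨ Σᵛ-cong (λ w → cong (δ (r w) v) (inner w)) ⟩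
  Σᵛ (λ w → δ (r w) v (Σᵛ λ x → δ (i x) w (c (x ∷ τ))))                          ≡⟨ Σᵛ-cong (λ w → δ-Σᵛ (r w) v (λ x → δ (i x) w (c (x ∷ τ)))) ⟩
  Σᵛ (λ w → Σᵛ λ x → δ (r w) v (δ (i x) w (c (x ∷ τ))))                          ≡⟨ Σᵛ-swap (λ w x → δ (r w) v (δ (i x) w (c (x ∷ τ)))) ⟩
  Σᵛ (λ x → Σᵛ λ w → δ (r w) v (δ (i x) w (c (x ∷ τ))))                          ≡⟨ Σᵛ-cong (λ x → Σᵛ-cong (λ w → trans (δ-δ (r w) v (i x) w _) (δ-sym (i x) w _))) ⟩
  Σᵛ (λ x → Σᵛ λ w → δ w (i x) (δ (r w) v (c (x ∷ τ))))                          ≡⟨ Σᵛ-cong (λ x → Σᵛ-δ (i x) (λ w → δ (r w) v (c (x ∷ τ)))) ⟩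
  Σᵛ (λ x → δ (r (i x)) v (c (x ∷ τ)))                                           ≡⟨ Σᵛ-cong (λ x → cong (λ z → δ z v (c (x ∷ τ))) (ri x)) ⟩
  Σᵛ (λ x → δ x v (c (x ∷ τ)))                                                   ≡⟨ Σᵛ-δ v (λ x → c (x ∷ τ)) ⟩
  c (v ∷ τ)                                                                      ∎
  where
  open ≡-Reasoning
  cₓ = λ x σ → c (x ∷ σ)
  inner : ∀ w → push r (λ σ → Σᵛ λ x → δ (i x) w (push i (cₓ x) σ)) τ ≡ Σᵛ (λ x → δ (i x) w (c (x ∷ τ)))
  inner w = trans (push-Σᵛ r (λ x σ → δ (i x) w (push i (cₓ x) σ)) τ)
    (Σᵛ-cong λ x → trans (push-δ r (i x) w (push i (cₓ x)) τ) (cong (δ (i x) w) (push-retract i r ri (cₓ x) τ)))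

Nonexpanding : (Vertex m → Vertex n) → Set
Nonexpanding f = ∀ x y → hamming (f x) (f y) ≤ hamming x y

far-map : {f : Vertex m → Vertex n} → Nonexpanding f → (σ : Tuple m) → Holds far (map f σ) → Holds far σ
far-map {f = f} ne σ g with x′ , x′∈ , h ← find g with y′ , y′∈ , d ← find h
                       with x , x∈ , refl ← ∈ₚ.∈-map⁻ f x′∈ with y , y∈ , refl ← ∈ₚ.∈-map⁻ f y′∈ =
  lose x∈ (lose y∈ (ℕₚ.≤-trans d (ne x y)))

push-on : {f : Vertex m → Vertex n} → Nonexpanding f → (c : Alt m k) → On rips c → On rips (pushᴬ f c)
push-on {f = f} ne c c-on τ τ∉ = push-zero f (fun c) τ λ { σ refl → c-on σ λ (_ , ¬f) → τ∉ (tt , ¬f ∘ far-map ne σ) }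

-- Nothing depends on the restriction to rips, since boundaries of chains on rips are chains on rips.
rips-cycle : (c : Alt n k) → On rips c → CycleOn rips c → ∀ τ → bd (fun c) τ ≡ 0ℤ
rips-cycle {n} c c-on c-cyc τ with holds? far τ
... | no ¬f = c-cyc τ (tt , ¬f)
... | yes f = Σᵛ-0 {n} λ v → c-on (v ∷ τ) λ (_ , ¬f) → ¬f (mono far there f)

rips-fill : (c : Alt n k) → On rips c → (e : Alt n (suc k)) → On rips e →
            (∀ τ → τ ∈ʳ rips → bd (fun e) τ ≡ fun c τ) → ∀ τ → bd (fun e) τ ≡ fun c τ
rips-fill {n} c c-on e e-on ∂e τ with holds? far τ
... | no ¬f = ∂e τ (tt , ¬f)
... | yes f = trans (Σᵛ-0 {n} λ v → e-on (v ∷ τ) λ (_ , ¬f) → ¬f (mono far there f))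
                    (sym (c-on τ λ (_ , ¬f) → ¬f f))

-- A filling of the embedded cycle would be mapped by `r` to a filling of the original one.
nonvanish-retract : (i : Vertex m → Vertex n) (r : Vertex n → Vertex m) → (∀ x → r (i x) ≡ x) →
                    Nonexpanding i → Nonexpanding r → NonVanish (rips {m}) k → NonVanish (rips {n}) k
nonvanish-retract i r ri i-ne r-ne (c , c-on , c-cyc , ¬b) =
  pushᴬ i c , push-on i-ne c c-on ,
  (λ τ _ → trans (bd-push i (fun c) τ) (push-zero i _ τ λ σ _ → rips-cycle c c-on c-cyc σ)) ,
  λ (e , e-on , ∂e) → ¬b (pushᴬ r e , push-on r-ne e e-on , λ τ _ → trans (bd-push r (fun e) τ)
    (trans (push-cong r (rips-fill (pushᴬ i c) (push-on i-ne c c-on) e e-on ∂e) τ) (push-retract i r ri (fun c) τ)))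

embed : ∀ m → Vertex m → Vertex (m + n)
embed m v = v Vec.++ Vec.replicate _ false

project : ∀ m → Vertex (m + n) → Vertex m
project m = Vec.take m

project-embed : (x : Vertex m) → project {n} m (embed m x) ≡ x
project-embed []      = refl
project-embed (b ∷ x) = cong (b ∷_) (project-embed x)

embed-nonexpanding : Nonexpanding (embed {n} m)
embed-nonexpanding {n} []      []          = ℕₚ.≤-reflexive (hamming-refl (embed {n} 0 []))
embed-nonexpanding (true ∷ x)  (true ∷ y)  = embed-nonexpanding x y
embed-nonexpanding (false ∷ x) (false ∷ y) = embed-nonexpanding x y
embed-nonexpanding (true ∷ x)  (false ∷ y) = s≤s (embed-nonexpanding x y)
embed-nonexpanding (false ∷ x) (true ∷ y)  = s≤s (embed-nonexpanding x y)

project-nonexpanding : ∀ m → Nonexpanding (project {n} m)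
project-nonexpanding zero    _           _           = z≤n
project-nonexpanding (suc m) (true ∷ x)  (true ∷ y)  = project-nonexpanding m x y
project-nonexpanding (suc m) (false ∷ x) (false ∷ y) = project-nonexpanding m x y
project-nonexpanding (suc m) (true ∷ x)  (false ∷ y) = s≤s (project-nonexpanding m x y)
project-nonexpanding (suc m) (false ∷ x) (true ∷ y)  = s≤s (project-nonexpanding m x y)

nonvanish-embed : m ≤ n → NonVanish (rips {m}) k → NonVanish (rips {n}) k
nonvanish-embed {m} {n} {k} m≤n V = subst (λ n → NonVanish (rips {n}) k) (ℕₚ.m+[n∸m]≡n m≤n)
  (nonvanish-retract (embed m) (project m) project-embed embed-nonexpanding (project-nonexpanding m) V)

-- Comparison with simplicial chains oriented by the order of the vertices

Face : ℕ → ℕ → Set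
Face n k = Vec (Vertex n) k → ℤ

-- ins v c τ is the contribution of the cofaces of τ containing v to the boundary of c at τ.
ins : Vertex n → Face n (suc k) → Face n k
ins {k = k} v c τ = sumℤ (map (λ j → sign j ⊛ c (insertAt τ j v)) (allFin (suc k)))

sumℤ-++ : (xs ys : List ℤ) → sumℤ (xs ++ ys) ≡ sumℤ xs ⊕ sumℤ ys
sumℤ-++ []       ys = sym (ℤₚ.+-identityˡ _)
sumℤ-++ (x ∷ xs) ys = trans (cong (x ⊕_) (sumℤ-++ xs ys)) (sym (ℤₚ.+-assoc x (sumℤ xs) (sumℤ ys)))

sumℤ-concatMap : {A : Set} (g : A → List ℤ) (xs : List A) → sumℤ (concatMap g xs) ≡ sumℤ (map (sumℤ ∘ g) xs)
sumℤ-concatMap g []       = refl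
sumℤ-concatMap g (x ∷ xs) = trans (sumℤ-++ (g x) (concatMap g xs)) (cong (sumℤ (g x) ⊕_) (sumℤ-concatMap g xs))

sumℤ-allVertices : (f : Vertex n → ℤ) → sumℤ (map f (allVertices n)) ≡ Σᵛ f
sumℤ-allVertices {zero}  f = ℤₚ.+-identityʳ (f [])
sumℤ-allVertices {suc n} f = trans (pairs (allVertices n)) (sumℤ-allVertices (λ v → f (false ∷ v) ⊕ f (true ∷ v)))
  where
  pairs : ∀ vs → sumℤ (map f (concatMap (λ v → (false ∷ v) ∷ (true ∷ v) ∷ []) vs)) ≡
                 sumℤ (map (λ v → f (false ∷ v) ⊕ f (true ∷ v)) vs)
  pairs []       = refl
  pairs (v ∷ vs) = trans (cong (λ z → f (false ∷ v) ⊕ (f (true ∷ v) ⊕ z)) (pairs vs)) (sym (ℤₚ.+-assoc (f (false ∷ v)) _ _))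

∂≡Σins : (c : Face n (suc (suc k))) (τ : Vec (Vertex n) (suc k)) → ∂ n c τ ≡ Σᵛ (λ v → ins v c τ)
∂≡Σins {n} {k} c τ = trans
  (sumℤ-concatMap (λ v → map (λ j → sign j ⊛ c (insertAt τ j v)) (allFin (suc (suc k)))) (allVertices n))
  (sumℤ-allVertices (λ v → ins v c τ))

sumℤ-⊖ : {A : Set} (g : A → ℤ) (xs : List A) → sumℤ (map (λ x → ⊖ g x) xs) ≡ ⊖ sumℤ (map g xs)
sumℤ-⊖ g []       = refl
sumℤ-⊖ g (x ∷ xs) = trans (cong (⊖ g x ⊕_) (sumℤ-⊖ g xs)) (sym (ℤₚ.neg-distrib-+ (g x) (sumℤ (map g xs))))

sign-suc : ∀ {m} (j : Fin m) → sign (suc j) ≡ ⊖ sign j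
sign-suc zero          = refl
sign-suc (suc zero)    = refl
sign-suc (suc (suc j)) = sign-suc j

ins-[] : (v : Vertex n) (c : Face n 1) → ins v c [] ≡ c (v ∷ [])
ins-[] v c = trans (ℤₚ.+-identityʳ _) (ℤₚ.*-identityˡ (c (v ∷ [])))

-- Either `v` is inserted in front of `x`, or behind it with all positions shifted by one and hence
-- all signs reversed.
ins-∷ : (v x : Vertex n) (c : Face n (suc (suc k))) (τ : Vec (Vertex n) k) →
        ins v c (x ∷ τ) ≡ c (v ∷ x ∷ τ) ⊕ ⊖ ins v (λ σ → c (x ∷ σ)) τ
ins-∷ {k = k} v x c τ = cong₂ _⊕_ (ℤₚ.*-identityˡ (c (v ∷ x ∷ τ)))
  (trans (cong sumℤ (trans (sym (Listₚ.map-∘ {g = λ j → sign j ⊛ c (insertAt (x ∷ τ) j v)} {suc} (allFin (suc k)))) (Listₚ.map-cong negated (allFin (suc k)))))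
         (sumℤ-⊖ (λ j → sign j ⊛ c (x ∷ insertAt τ j v)) (allFin (suc k))))
  where
  negated : ∀ j → sign (suc j) ⊛ c (x ∷ insertAt τ j v) ≡ ⊖ (sign j ⊛ c (x ∷ insertAt τ j v))
  negated j = trans (cong (_⊛ c (x ∷ insertAt τ j v)) (sign-suc j)) (sym (ℤₚ.neg-distribˡ-* (sign j) _))

ins-cong : (v : Vertex n) {c d : Face n (suc k)} → (∀ σ → c σ ≡ d σ) → ∀ τ → ins v c τ ≡ ins v d τ
ins-cong {k = k} v c≗d τ = cong sumℤ (Listₚ.map-cong (λ j → cong (sign j ⊛_) (c≗d (insertAt τ j v))) (allFin (suc k)))

ins-zero : (v : Vertex n) (c : Face n (suc k)) (τ : Vec (Vertex n) k) →
           (∀ j → c (insertAt τ j v) ≡ 0ℤ) → ins v c τ ≡ 0ℤ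
ins-zero {k = k} v c τ h = zeros (allFin (suc k))
  where
  zeros : ∀ js → sumℤ (map (λ j → sign j ⊛ c (insertAt τ j v)) js) ≡ 0ℤ
  zeros []       = refl
  zeros (j ∷ js) = cong₂ _⊕_ (trans (cong (sign j ⊛_) (h j)) (ℤₚ.*-zeroʳ (sign j))) (zeros js)

ins-linear : (v : Vertex n) (a b : Face n (suc k)) (τ : Vec (Vertex n) k) →
             ins v (λ σ → a σ ⊕ ⊖ b σ) τ ≡ ins v a τ ⊕ ⊖ ins v b τ
ins-linear v a b []      = trans (ins-[] v (λ σ → a σ ⊕ ⊖ b σ)) (sym (cong₂ (λ p q → p ⊕ ⊖ q) (ins-[] v a) (ins-[] v b)))
ins-linear v a b (x ∷ τ) = begin
  ins v (λ σ → a σ ⊕ ⊖ b σ) (x ∷ τ)                                       ≡⟨ ins-∷ v x (λ σ → a σ ⊕ ⊖ b σ) τ ⟩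
  (a′ ⊕ ⊖ b′) ⊕ ⊖ ins v (λ σ → a (x ∷ σ) ⊕ ⊖ b (x ∷ σ)) τ                 ≡⟨ cong (λ z → (a′ ⊕ ⊖ b′) ⊕ ⊖ z) (ins-linear v (λ σ → a (x ∷ σ)) (λ σ → b (x ∷ σ)) τ) ⟩
  (a′ ⊕ ⊖ b′) ⊕ ⊖ (ins v (λ σ → a (x ∷ σ)) τ ⊕ ⊖ ins v (λ σ → b (x ∷ σ)) τ) ≡⟨ arith a′ b′ _ _ ⟩
  (a′ ⊕ ⊖ ins v (λ σ → a (x ∷ σ)) τ) ⊕ ⊖ (b′ ⊕ ⊖ ins v (λ σ → b (x ∷ σ)) τ) ≡⟨ cong₂ (λ p q → p ⊕ ⊖ q) (ins-∷ v x a τ) (ins-∷ v x b τ) ⟨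
  ins v a (x ∷ τ) ⊕ ⊖ ins v b (x ∷ τ)                                     ∎
  where
  open ≡-Reasoning
  a′ = a (v ∷ x ∷ τ)
  b′ = b (v ∷ x ∷ τ)
  arith : ∀ p q r s → (p ⊕ ⊖ q) ⊕ ⊖ (r ⊕ ⊖ s) ≡ (p ⊕ ⊖ r) ⊕ ⊖ (q ⊕ ⊖ s)
  arith = ℤ-Solver.solve-∀

-- Inserting two vertices in either order reaches the same tuples with opposite signs; this is why
-- `ext` alternates.
ins-anticomm : (v w : Vertex n) (c : Face n (suc (suc k))) (τ : Vec (Vertex n) k) →
               ins w (ins v c) τ ≡ ⊖ ins v (ins w c) τ
ins-anticomm v w c [] = begin
  ins w (ins v c) []                       ≡⟨ trans (ins-[] w (ins v c)) (one v w) ⟩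
  c (v ∷ w ∷ []) ⊕ ⊖ c (w ∷ v ∷ [])        ≡⟨ arith (c (v ∷ w ∷ [])) (c (w ∷ v ∷ [])) ⟩
  ⊖ (c (w ∷ v ∷ []) ⊕ ⊖ c (v ∷ w ∷ []))    ≡⟨ cong ⊖_ (trans (ins-[] v (ins w c)) (one w v)) ⟨
  ⊖ ins v (ins w c) []                     ∎
  where
  open ≡-Reasoning
  one : ∀ v w → ins v c (w ∷ []) ≡ c (v ∷ w ∷ []) ⊕ ⊖ c (w ∷ v ∷ [])
  one v w = trans (ins-∷ v w c []) (cong (λ z → c (v ∷ w ∷ []) ⊕ ⊖ z) (ins-[] v (λ σ → c (w ∷ σ))))
  arith : ∀ a b → a ⊕ ⊖ b ≡ ⊖ (b ⊕ ⊖ a)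
  arith = ℤ-Solver.solve-∀
ins-anticomm v w c (x ∷ τ) = begin
  ins w (ins v c) (x ∷ τ)                                                         ≡⟨ expand v w ⟩
  (C v w ⊕ ⊖ (C w v ⊕ ⊖ J v w)) ⊕ ⊖ (J w v ⊕ ⊖ ins w (ins v cₓ) τ)                ≡⟨ cong (λ z → (C v w ⊕ ⊖ (C w v ⊕ ⊖ J v w)) ⊕ ⊖ (J w v ⊕ ⊖ z)) (ins-anticomm v w cₓ τ) ⟩
  (C v w ⊕ ⊖ (C w v ⊕ ⊖ J v w)) ⊕ ⊖ (J w v ⊕ ⊖ ⊖ ins v (ins w cₓ) τ)              ≡⟨ arith (C v w) (C w v) (J v w) (J w v) _ ⟩
  ⊖ ((C w v ⊕ ⊖ (C v w ⊕ ⊖ J w v)) ⊕ ⊖ (J v w ⊕ ⊖ ins v (ins w cₓ) τ))            ≡⟨ cong ⊖_ (expand w v) ⟨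
  ⊖ ins v (ins w c) (x ∷ τ)                                                       ∎
  where
  open ≡-Reasoning
  cₓ = λ σ → c (x ∷ σ)
  C J : (v w : Vertex _) → ℤ
  C v w = c (v ∷ w ∷ x ∷ τ)
  J v w = ins v (λ σ → c (w ∷ x ∷ σ)) τ
  expand : ∀ v w → ins w (ins v c) (x ∷ τ) ≡ (C v w ⊕ ⊖ (C w v ⊕ ⊖ J v w)) ⊕ ⊖ (J w v ⊕ ⊖ ins w (ins v cₓ) τ)
  expand v w = trans (ins-∷ w x (ins v c) τ) (cong₂ (λ p q → p ⊕ ⊖ q)
    (trans (ins-∷ v w c (x ∷ τ)) (cong (λ z → C v w ⊕ ⊖ z) (ins-∷ v x (λ σ → c (w ∷ σ)) τ)))
    (trans (ins-cong w (ins-∷ v x c) τ) (ins-linear w (λ σ → c (v ∷ x ∷ σ)) (ins v cₓ) τ)))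
  arith : ∀ a b c d e → (a ⊕ ⊖ (b ⊕ ⊖ c)) ⊕ ⊖ (d ⊕ ⊖ ⊖ e) ≡ ⊖ ((b ⊕ ⊖ (a ⊕ ⊖ d)) ⊕ ⊖ (c ⊕ ⊖ e))
  arith = ℤ-Solver.solve-∀

-- ext is the alternating extension of an oriented chain, restr its inverse.
ext : Face n k → Tuple n → ℤ
ext {k = zero}  c []      = c []
ext {k = zero}  c (_ ∷ _) = 0ℤ
ext {k = suc k} c []      = 0ℤ
ext {k = suc k} c (v ∷ τ) = ext (ins v c) τ

ext-cong : {c d : Face n k} → (∀ σ → c σ ≡ d σ) → ∀ τ → ext c τ ≡ ext d τ
ext-cong {k = zero}  c≗d []      = c≗d []
ext-cong {k = zero}  c≗d (_ ∷ _) = refl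
ext-cong {k = suc k} c≗d []      = refl
ext-cong {k = suc k} c≗d (v ∷ τ) = ext-cong (ins-cong v c≗d) τ

ins-⊖ : (v : Vertex n) (c : Face n (suc k)) (τ : Vec (Vertex n) k) → ins v (λ σ → ⊖ c σ) τ ≡ ⊖ ins v c τ
ins-⊖ {k = k} v c τ = trans
  (cong sumℤ (Listₚ.map-cong (λ j → sym (ℤₚ.neg-distribʳ-* (sign j) (c (insertAt τ j v)))) (allFin (suc k))))
  (sumℤ-⊖ (λ j → sign j ⊛ c (insertAt τ j v)) (allFin (suc k)))

ext-⊖ : (c : Face n k) (τ : Tuple n) → ext (λ σ → ⊖ c σ) τ ≡ ⊖ ext c τ
ext-⊖ {k = zero}  c []      = refl
ext-⊖ {k = zero}  c (_ ∷ _) = refl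
ext-⊖ {k = suc k} c []      = refl
ext-⊖ {k = suc k} c (v ∷ τ) = trans (ext-cong (ins-⊖ v c) τ) (ext-⊖ (ins v c) τ)

ins-Σᵛ : (v : Vertex n) (c : Vertex n → Face n (suc k)) (τ : Vec (Vertex n) k) →
         ins v (λ σ → Σᵛ (λ u → c u σ)) τ ≡ Σᵛ (λ u → ins v (c u) τ)
ins-Σᵛ v c []      = trans (ins-[] v (λ σ → Σᵛ (λ u → c u σ))) (Σᵛ-cong λ u → sym (ins-[] v (c u)))
ins-Σᵛ v c (x ∷ τ) = trans (ins-∷ v x (λ σ → Σᵛ (λ u → c u σ)) τ) (trans
  (cong (λ z → Σᵛ (λ u → c u (v ∷ x ∷ τ)) ⊕ ⊖ z) (ins-Σᵛ v (λ u σ → c u (x ∷ σ)) τ))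
  (trans (cong (Σᵛ (λ u → c u (v ∷ x ∷ τ)) ⊕_) (sym (Σᵛ-⊖ (λ u → ins v (λ σ → c u (x ∷ σ)) τ))))
  (trans (sym (Σᵛ-⊕ (λ u → c u (v ∷ x ∷ τ)) (λ u → ⊖ ins v (λ σ → c u (x ∷ σ)) τ)))
         (Σᵛ-cong λ u → sym (ins-∷ v x (c u) τ)))))

ext-Σᵛ : (c : Vertex n → Face n k) (τ : Tuple n) → ext (λ σ → Σᵛ (λ u → c u σ)) τ ≡ Σᵛ (λ u → ext (c u) τ)
ext-Σᵛ         {k = zero}  c []      = refl
ext-Σᵛ {n = n} {k = zero}  c (_ ∷ _) = sym (Σᵛ-0 {n} λ _ → refl)
ext-Σᵛ {n = n} {k = suc k} c []      = sym (Σᵛ-0 {n} λ _ → refl)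
ext-Σᵛ         {k = suc k} c (v ∷ τ) = trans (ext-cong (ins-Σᵛ v c) τ) (ext-Σᵛ (λ u → ins v (c u)) τ)

bd-ext : (c : Face n (suc k)) (τ : Tuple n) → bd (ext c) τ ≡ ext (λ σ → Σᵛ (λ v → ins v c σ)) τ
bd-ext c τ = sym (ext-Σᵛ (λ v → ins v c) τ)

ext-alt : (c : Face n k) → Alternating (ext c)
ext-alt {k = zero}        c []      x y τ = refl
ext-alt {k = zero}        c (_ ∷ _) x y τ = refl
ext-alt {k = suc zero}    c []      x y τ = refl
ext-alt {k = suc (suc k)} c []      x y τ = trans (ext-cong (ins-anticomm x y c) τ) (ext-⊖ (ins x (ins y c)) τ)
ext-alt {k = suc k}       c (z ∷ ρ) x y τ = ext-alt (ins z c) ρ x y τ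

ext-grade : (c : Face n k) → Graded k (ext c)
ext-grade {k = zero}  c []      ≢k = contradiction refl ≢k
ext-grade {k = zero}  c (_ ∷ _) ≢k = refl
ext-grade {k = suc k} c []      ≢k = refl
ext-grade {k = suc k} c (v ∷ τ) ≢k = ext-grade (ins v c) τ (≢k ∘ cong suc)

insert-⊆ : (σ : Vec (Vertex n) k) (j : Fin (suc k)) (v : Vertex n) → (v ∷ toList σ) ⊆ toList (insertAt σ j v)
insert-⊆ σ       zero    v p                 = p
insert-⊆ (x ∷ σ) (suc j) v (here p)          = there (insert-⊆ σ j v (here p))
insert-⊆ (x ∷ σ) (suc j) v (there (here p))  = here p
insert-⊆ (x ∷ σ) (suc j) v (there (there p)) = there (insert-⊆ σ j v (there p))

-- `π` collects the vertices already consumed by the recursion, so that the distance condition keeps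
-- referring to the whole tuple.
ext-far : (π : Tuple n) (c : Face n k) → (∀ σ → Holds far (π ++ toList σ) → c σ ≡ 0ℤ) →
          ∀ τ → Holds far (π ++ τ) → ext c τ ≡ 0ℤ
ext-far {k = zero}  π c h []      f = h [] f
ext-far {k = zero}  π c h (_ ∷ _) f = refl
ext-far {k = suc k} π c h []      f = refl
ext-far {k = suc k} π c h (v ∷ τ) f = ext-far (v ∷ π) (ins v c)
  (λ σ g → ins-zero v c σ λ j → h (insertAt σ j v)
    (mono far (λ p → ⊆ₚ.++⁺ʳ π (insert-⊆ σ j v) (move-back π v (toList σ) p)) g))
  τ (mono far (move-front π v τ) f)

_<ᵛ?_ : (v w : Vertex n) → Dec (v <ᵛ w)
[]      <ᵛ? []      = no λ ()
(x ∷ v) <ᵛ? (y ∷ w) = ((x 𝔹.≟ false) ×-dec (y 𝔹.≟ true)) ⊎-dec ((x 𝔹.≟ y) ×-dec (v <ᵛ? w))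

<ᵛ-irrefl : (v : Vertex n) → ¬ v <ᵛ v
<ᵛ-irrefl (false ∷ v) (inj₁ (_ , ()))
<ᵛ-irrefl (true ∷ v)  (inj₁ (() , _))
<ᵛ-irrefl (x ∷ v)     (inj₂ (_ , v<v)) = <ᵛ-irrefl v v<v

<ᵛ-trans : {u v w : Vertex n} → u <ᵛ v → v <ᵛ w → u <ᵛ w
<ᵛ-trans {u = []}    {[]}    {[]}    ()
<ᵛ-trans {u = _ ∷ _} {_ ∷ _} {_ ∷ _} (inj₁ (refl , refl)) (inj₂ (refl , _))    = inj₁ (refl , refl)
<ᵛ-trans {u = _ ∷ _} {_ ∷ _} {_ ∷ _} (inj₂ (refl , _))    (inj₁ (refl , refl)) = inj₁ (refl , refl)
<ᵛ-trans {u = _ ∷ _} {_ ∷ _} {_ ∷ _} (inj₂ (refl , u<v))  (inj₂ (refl , v<w))  = inj₂ (refl , <ᵛ-trans u<v v<w)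

<ᵛ-compare : (v w : Vertex n) → v <ᵛ w ⊎ v ≡ w ⊎ w <ᵛ v
<ᵛ-compare []          []          = inj₂ (inj₁ refl)
<ᵛ-compare (false ∷ v) (true ∷ w)  = inj₁ (inj₁ (refl , refl))
<ᵛ-compare (true ∷ v)  (false ∷ w) = inj₂ (inj₂ (inj₁ (refl , refl)))
<ᵛ-compare (false ∷ v) (false ∷ w) with <ᵛ-compare v w
... | inj₁ v<w        = inj₁ (inj₂ (refl , v<w))
... | inj₂ (inj₁ v≡w) = inj₂ (inj₁ (cong (false ∷_) v≡w))
... | inj₂ (inj₂ w<v) = inj₂ (inj₂ (inj₂ (refl , w<v)))
<ᵛ-compare (true ∷ v)  (true ∷ w) with <ᵛ-compare v w
... | inj₁ v<w        = inj₁ (inj₂ (refl , v<w))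
... | inj₂ (inj₁ v≡w) = inj₂ (inj₁ (cong (true ∷_) v≡w))
... | inj₂ (inj₂ w<v) = inj₂ (inj₂ (inj₂ (refl , w<v)))

does⇒ : {A : Set} (a? : Dec A) → does a? ≡ true → A
does⇒ (yes a) _ = a

-- The predicate p bounds the first vertex from below; it is needed to restrict under a binder.
restr : (p : Vertex n → Bool) → (Tuple n → ℤ) → Face n k
restr p f []      = f []
restr p f (x ∷ σ) = if p x then restr (λ y → does (x <ᵛ? y)) (λ τ → f (x ∷ τ)) σ else 0ℤ

if-zero : ∀ b {z : ℤ} → z ≡ 0ℤ → (if b then z else 0ℤ) ≡ 0ℤ
if-zero false _  = refl
if-zero true  eq = eq

restr-cong : (p : Vertex n → Bool) {f g : Tuple n → ℤ} → (∀ τ → f τ ≡ g τ) →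
             (σ : Vec (Vertex n) k) → restr p f σ ≡ restr p g σ
restr-cong p f≗g []      = f≗g []
restr-cong p f≗g (x ∷ σ) = cong (if p x then_else 0ℤ) (restr-cong _ (λ τ → f≗g (x ∷ τ)) σ)

restr-⊖ : (p : Vertex n → Bool) (f : Tuple n → ℤ) (σ : Vec (Vertex n) k) →
          restr p (λ τ → ⊖ f τ) σ ≡ ⊖ restr p f σ
restr-⊖ p f []      = refl
restr-⊖ p f (x ∷ σ) with p x
... | true  = restr-⊖ _ (λ τ → f (x ∷ τ)) σ
... | false = refl

restr-zero : (p : Vertex n → Bool) (f : Tuple n → ℤ) (σ : Vec (Vertex n) k) →
             f (toList σ) ≡ 0ℤ → restr p f σ ≡ 0ℤ
restr-zero p f []      eq = eq
restr-zero p f (x ∷ σ) eq = if-zero (p x) (restr-zero _ (λ τ → f (x ∷ τ)) σ eq)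

restr-Σᵛ : (p : Vertex n → Bool) (f : Vertex n → Tuple n → ℤ) (σ : Vec (Vertex n) k) →
           restr p (λ τ → Σᵛ (λ u → f u τ)) σ ≡ Σᵛ (λ u → restr p (f u) σ)
restr-Σᵛ         p f []      = refl
restr-Σᵛ {n = n} p f (x ∷ σ) with p x
... | true  = restr-Σᵛ _ (λ u τ → f u (x ∷ τ)) σ
... | false = sym (Σᵛ-0 {n} λ _ → refl)

-- Compare `v` with the head `x`. If `v` is smaller, only the front position counts; if larger,
-- moving `v` past `x` cancels the sign of `ins-∷`; if equal, the right side vanishes by repetition.
ins-restr : (v : Vertex n) (p : Vertex n → Bool) → (∀ x y → x <ᵛ y → p x ≡ true → p y ≡ true) →
            (f : Tuple n → ℤ) → Alternating f → (τ : Vec (Vertex n) k) →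
            ins v (restr p f) τ ≡ (if p v then restr p (λ σ → f (v ∷ σ)) τ else 0ℤ)
ins-restr v p up f a []      = ins-[] v (restr p f)
ins-restr {n} v p up f a (x ∷ τ) = trans (ins-∷ v x (restr p f) τ)
  (trans (cong (λ z → restr p f (v ∷ x ∷ τ) ⊕ ⊖ z) inner) (outer (<ᵛ-compare v x)))
  where
  X : ℤ
  X = restr (λ y → does (x <ᵛ? y)) (λ σ → f (v ∷ x ∷ σ)) τ
  inner : ins v (λ σ → restr p f (x ∷ σ)) τ ≡ (if p x then (if does (x <ᵛ? v) then ⊖ X else 0ℤ) else 0ℤ)
  inner with p x
  ... | false = ins-zero v _ τ λ _ → refl
  ... | true  = trans
    (ins-restr v (λ y → does (x <ᵛ? y))
      (λ y z y<z x<y → dec-true (x <ᵛ? z) (<ᵛ-trans (does⇒ (x <ᵛ? y) x<y) y<z))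
      (λ σ → f (x ∷ σ)) (λ ρ → a (x ∷ ρ)) τ)
    (cong (if does (x <ᵛ? v) then_else 0ℤ) (trans (restr-cong _ (λ σ → a [] x v σ) τ) (restr-⊖ _ (λ σ → f (v ∷ x ∷ σ)) τ)))
  outer : v <ᵛ x ⊎ v ≡ x ⊎ x <ᵛ v →
    (if p v then (if does (v <ᵛ? x) then X else 0ℤ) else 0ℤ) ⊕ ⊖ (if p x then (if does (x <ᵛ? v) then ⊖ X else 0ℤ) else 0ℤ)
    ≡ (if p v then (if p x then X else 0ℤ) else 0ℤ)
  outer (inj₁ v<x)
    rewrite dec-true (v <ᵛ? x) v<x | dec-false (x <ᵛ? v) (λ x<v → <ᵛ-irrefl v (<ᵛ-trans v<x x<v)) =
    trans (cong (λ z → (if p v then X else 0ℤ) ⊕ ⊖ z) (if-zero (p x) refl)) (trans (ℤₚ.+-identityʳ _) (below (p v) (p x) (up v x v<x)))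
    where
    below : ∀ b c → (b ≡ true → c ≡ true) → (if b then X else 0ℤ) ≡ (if b then (if c then X else 0ℤ) else 0ℤ)
    below false c _ = refl
    below true  c h rewrite h refl = refl
  outer (inj₂ (inj₂ x<v))
    rewrite dec-true (x <ᵛ? v) x<v | dec-false (v <ᵛ? x) (λ v<x → <ᵛ-irrefl v (<ᵛ-trans v<x x<v)) =
    trans (cong (_⊕ ⊖ (if p x then ⊖ X else 0ℤ)) (if-zero (p v) refl)) (trans (ℤₚ.+-identityˡ _) (above (p v) (p x) (up x v x<v)))
    where
    above : ∀ b c → (c ≡ true → b ≡ true) → ⊖ (if c then ⊖ X else 0ℤ) ≡ (if b then (if c then X else 0ℤ) else 0ℤ)
    above b true  h rewrite h refl = ℤₚ.neg-involutive X
    above b false _ = sym (if-zero b refl)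
  outer (inj₂ (inj₁ refl)) rewrite dec-false (x <ᵛ? x) (<ᵛ-irrefl x) =
    trans (cong₂ (λ s t → s ⊕ ⊖ t) (if-zero (p x) refl) (if-zero (p x) refl))
          (sym (if-zero (p x) (if-zero (p x) (restr-zero _ _ τ (alt-repeat f a [] x [] (toList τ))))))

orient : (Tuple n → ℤ) → Face n k
orient = restr (λ _ → true)

ins-orient : (v : Vertex n) (f : Tuple n → ℤ) → Alternating f → (τ : Vec (Vertex n) k) →
             ins v (orient f) τ ≡ orient (λ σ → f (v ∷ σ)) τ
ins-orient v = ins-restr v (λ _ → true) (λ _ _ _ _ → refl)

Σins-orient : (f : Tuple n → ℤ) → Alternating f → (τ : Vec (Vertex n) k) →
              Σᵛ (λ v → ins v (orient f) τ) ≡ orient (bd f) τ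
Σins-orient f a τ = trans (Σᵛ-cong λ v → ins-orient v f a τ) (sym (restr-Σᵛ _ (λ v σ → f (v ∷ σ)) τ))

ext-orient : (f : Tuple n → ℤ) → Alternating f → Graded k f → ∀ τ → ext {k = k} (orient f) τ ≡ f τ
ext-orient {k = zero}  f a g []      = refl
ext-orient {k = zero}  f a g (v ∷ τ) = sym (g (v ∷ τ) λ ())
ext-orient {k = suc k} f a g []      = sym (g [] λ ())
ext-orient {k = suc k} f a g (v ∷ τ) = trans (ext-cong {k = k} (ins-orient v f a) τ)
  (ext-orient (λ σ → f (v ∷ σ)) (λ ρ → a (v ∷ ρ)) (λ σ ≢k → g (v ∷ σ) (≢k ∘ ℕₚ.suc-injective)) τ)

restr-increasing : (p : Vertex n → Bool) (f : Tuple n → ℤ) (x : Vertex n) (σ : Vec (Vertex n) k) →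
                   Increasing (x ∷ σ) → p x ≡ true → restr p f (x ∷ σ) ≡ f (x ∷ toList σ)
restr-increasing p f x []      _          px rewrite px = refl
restr-increasing p f x (y ∷ σ) (x<y , inc) px rewrite px =
  restr-increasing (λ z → does (x <ᵛ? z)) (λ τ → f (x ∷ τ)) y σ inc (dec-true (x <ᵛ? y) x<y)

restr-not-increasing : (p : Vertex n → Bool) (f : Tuple n → ℤ) (x : Vertex n) (σ : Vec (Vertex n) k) →
                       ¬ Increasing (x ∷ σ) → restr p f (x ∷ σ) ≡ 0ℤ
restr-not-increasing p f x []      ¬inc = contradiction tt ¬inc
restr-not-increasing p f x (y ∷ σ) ¬inc with x <ᵛ? y
... | no  _   = if-zero (p x) refl
... | yes x<y = if-zero (p x)
  (restr-not-increasing (λ _ → true) (λ τ → f (x ∷ τ)) y σ λ inc → ¬inc (x<y , inc))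

increasing-tail : (x : Vertex n) (σ : Vec (Vertex n) k) → Increasing (x ∷ σ) → Increasing σ
increasing-tail x []      _       = tt
increasing-tail x (y ∷ σ) (_ , i) = i

increasing-below : (x : Vertex n) (σ : Vec (Vertex n) k) → Increasing (x ∷ σ) → ∀ {y} → y ∈ toList σ → x <ᵛ y
increasing-below x (z ∷ σ) (x<z , _)   (here refl) = x<z
increasing-below x (z ∷ σ) (x<z , inc) (there y∈)  = <ᵛ-trans x<z (increasing-below z σ inc y∈)

increasing-insert : (σ : Vec (Vertex n) k) (j : Fin (suc k)) (v : Vertex n) → Increasing (insertAt σ j v) → Increasing σ
increasing-insert σ           zero    v inc = increasing-tail v σ inc
increasing-insert (x ∷ [])    (suc j) v inc = tt
increasing-insert (x ∷ y ∷ σ) (suc j) v inc =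
  increasing-below x (insertAt (y ∷ σ) j v) inc (insert-⊆ (y ∷ σ) j v (there (here refl))) ,
  increasing-insert (y ∷ σ) j v (increasing-tail x (insertAt (y ∷ σ) j v) inc)

-- In an increasing tuple the head precedes the rest, so among all insertions of it only the front
-- position yields an increasing tuple.
orient-ext : (c : Face n k) → (∀ σ → ¬ Increasing σ → c σ ≡ 0ℤ) → (σ : Vec (Vertex n) k) → Increasing σ →
             ext c (toList σ) ≡ c σ
orient-ext c h []      inc = refl
orient-ext c h (v ∷ τ) inc = trans
  (orient-ext (ins v c) (λ σ ¬inc → ins-zero v c σ λ j → h _ (¬inc ∘ increasing-insert σ j v)) τ (increasing-tail v τ inc))
  (first τ inc)
  where
  first : ∀ τ → Increasing (v ∷ τ) → ins v c τ ≡ c (v ∷ τ)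
  first []      _   = ins-[] v c
  first (x ∷ τ) inc = trans (ins-∷ v x c τ) (trans
    (cong (λ z → c (v ∷ x ∷ τ) ⊕ ⊖ z) (ins-zero v (λ σ → c (x ∷ σ)) τ λ j → h _ λ inc′ →
      <ᵛ-irrefl v (<ᵛ-trans (proj₁ inc) (increasing-below x (insertAt τ j v) inc′ (insert-⊆ τ j v (here refl))))))
    (ℤₚ.+-identityʳ _))

∈-toList : (σ : Vec (Vertex n) k) (a : Fin k) → lookup σ a ∈ toList σ
∈-toList (x ∷ σ) zero    = here refl
∈-toList (x ∷ σ) (suc a) = there (∈-toList σ a)

∈-toList⁻ : (σ : Vec (Vertex n) k) {x : Vertex n} → x ∈ toList σ → ∃ λ a → x ≡ lookup σ a
∈-toList⁻ (y ∷ σ) (here x≡y) = zero , x≡y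
∈-toList⁻ (y ∷ σ) (there x∈) with a , x≡ ← ∈-toList⁻ σ x∈ = suc a , x≡

increasing? : (σ : Vec (Vertex n) k) → Dec (Increasing σ)
increasing? []          = yes tt
increasing? (x ∷ [])    = yes tt
increasing? (x ∷ y ∷ σ) = (x <ᵛ? y) ×-dec increasing? (y ∷ σ)

-- A simplex of dimension k has k + 1 vertices, hence the shift in grading.

toAlt : Chain n 3 k → Alt n (suc k)
toAlt (c , _) = mkAlt (ext c) (ext-alt c) (ext-grade c)

toAlt-on : (c : Chain n 3 k) → On rips (toAlt c)
toAlt-on (c , c-on) τ τ∉ with holds? far τ
... | no ¬f = contradiction (tt , ¬f) τ∉
... | yes f = ext-far [] c (λ σ g → c-on σ λ (_ , d) → close⇒¬far {σ = toList σ} (λ x∈ y∈ → near σ d x∈ y∈) g) τ f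
  where
  near : (σ : Vec (Vertex _) (suc _)) → (∀ a b → hamming (lookup σ a) (lookup σ b) ≤ 3) →
         ∀ {x y} → x ∈ toList σ → y ∈ toList σ → hamming x y ≤ 3
  near σ d x∈ y∈ with a , refl ← ∈-toList⁻ σ x∈ | b , refl ← ∈-toList⁻ σ y∈ = d a b

fromAlt : (c : Alt n (suc k)) → On rips c → Chain n 3 k
fromAlt c c-on = orient (fun c) , zero-off
  where
  zero-off : ∀ σ → ¬ IsVRSimplex _ 3 σ → orient (fun c) σ ≡ 0ℤ
  zero-off (x ∷ σ) ¬vr with increasing? (x ∷ σ)
  ... | no ¬inc = restr-not-increasing _ (fun c) x σ ¬inc
  ... | yes inc = restr-zero _ (fun c) (x ∷ σ) (c-on _ λ (_ , ¬f) →
    ¬vr (inc , λ a b → close {σ = toList (x ∷ σ)} ¬f (∈-toList (x ∷ σ) a) (∈-toList (x ∷ σ) b)))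

bd-toAlt : (d : Chain n 3 (suc k)) (τ : Tuple n) → bd (fun (toAlt d)) τ ≡ ext (∂ n (proj₁ d)) τ
bd-toAlt (d , _) τ = trans (bd-ext d τ) (ext-cong (λ σ → sym (∂≡Σins d σ)) τ)

toAlt-cycle : (c : Chain n 3 k) → IsReducedCycle n 3 k c → ∀ τ → bd (fun (toAlt c)) τ ≡ 0ℤ
toAlt-cycle {n} {zero} (c , _) cyc τ = trans (bd-ext c τ) (trans (ext-cong aug τ) (zeros τ))
  where
  aug : ∀ σ → Σᵛ (λ v → ins v c σ) ≡ 0ℤ
  aug [] = trans (Σᵛ-cong λ v → ins-[] v c) (trans (sym (sumℤ-allVertices (λ v → c (v ∷ [])))) cyc)
  zeros : ∀ τ → ext {n} {0} (λ _ → 0ℤ) τ ≡ 0ℤ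
  zeros []      = refl
  zeros (_ ∷ _) = refl
toAlt-cycle {n} {suc k} c cyc τ = trans (bd-toAlt c τ) (trans (ext-cong cyc τ) (zeros (suc k) τ))
  where
  zeros : ∀ k τ → ext {n} {k} (λ _ → 0ℤ) τ ≡ 0ℤ
  zeros zero    []      = refl
  zeros zero    (_ ∷ _) = refl
  zeros (suc k) []      = refl
  zeros (suc k) (v ∷ τ) = trans (ext-cong {k = k} (λ σ → ins-zero v (λ _ → 0ℤ) σ λ _ → refl) τ) (zeros k τ)

orient-0 : (f : Tuple n → ℤ) → (∀ τ → f τ ≡ 0ℤ) → (σ : Vec (Vertex n) k) → orient f σ ≡ 0ℤ
orient-0 f h σ = restr-zero _ f σ (h (toList σ))

-- `rips-fill` turns the relative filling of the alternating extension into an equation at every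
-- tuple, which restriction to increasing tuples then preserves.
vanish⇒boundary : Vanish (rips {n}) (suc k) → (c : Chain n 3 k) → IsReducedCycle n 3 k c → IsBoundary n 3 k c
vanish⇒boundary {n} {k} V c cyc
  with e , e-on , ∂e ← V (toAlt c) (toAlt-on c) (λ τ _ → toAlt-cycle c cyc τ) =
  fromAlt e e-on , λ τ → trans (∂≡Σins (orient (fun e)) τ) (trans (Σins-orient (fun e) (alt e) τ)
    (trans (restr-cong _ (rips-fill (toAlt c) (toAlt-on c) e e-on ∂e) τ) (orient-toAlt τ)))
  where
  orient-toAlt : ∀ τ → orient (ext (proj₁ c)) τ ≡ proj₁ c τ
  orient-toAlt (x ∷ τ) with increasing? (x ∷ τ)
  ... | no ¬inc = trans (restr-not-increasing _ (ext (proj₁ c)) x τ ¬inc) (sym (proj₂ c (x ∷ τ) (¬inc ∘ proj₁)))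
  ... | yes inc = trans (restr-increasing _ (ext (proj₁ c)) x τ inc refl)
                        (orient-ext (proj₁ c) (λ σ ¬inc → proj₂ c σ (¬inc ∘ proj₁)) (x ∷ τ) inc)

nonvanish⇒nonzero : NonVanish (rips {n}) (suc k) → ReducedHomologyNonzero n 3 k
nonvanish⇒nonzero {n} {k} (c , c-on , c-cyc , ¬b) = fromAlt c c-on , cycle k c c-on c-cyc , λ (D , ∂D) →
  ¬b (toAlt D , toAlt-on D , λ τ _ → trans (bd-toAlt D τ)
    (trans (ext-cong ∂D τ) (ext-orient (fun c) (alt c) (grade c) τ)))
  where
  cycle : ∀ k (c : Alt n (suc k)) (c-on : On rips c) → CycleOn rips c → IsReducedCycle n 3 k (fromAlt c c-on)
  cycle zero    c c-on c-cyc = trans (sumℤ-allVertices (λ v → fun c (v ∷ []))) (rips-cycle c c-on c-cyc [])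
  cycle (suc k) c c-on c-cyc τ = trans (∂≡Σins (orient (fun c)) τ)
    (trans (Σins-orient (fun c) (alt c) τ) (orient-0 (bd (fun c)) (rips-cycle c c-on c-cyc) τ))

theorem1p2 : (n : ℕ) → 5 ≤ n → (i : ℕ) →
    ReducedHomologyNonzero n 3 i ⇔ (i ≡ 4 ⊎ i ≡ 7)
theorem1p2 n 5≤n i = mk⇔ only-4-7 λ
  { (inj₁ refl) → nonvanish⇒nonzero (nonvanish-embed 5≤n nonvanish-rips₅)
  ; (inj₂ refl) → nonvanish⇒nonzero (nonvanish-embed (ℕₚ.<⇒≤ 5≤n) nonvanish-rips₄) }
  where
  only-4-7 : ReducedHomologyNonzero n 3 i → i ≡ 4 ⊎ i ≡ 7
  only-4-7 (c , cyc , ¬b) with i ℕₚ.≟ 4 | i ℕₚ.≟ 7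
  ... | yes i≡4 | _       = inj₁ i≡4
  ... | no  _   | yes i≡7 = inj₂ i≡7
  ... | no  i≢4 | no  i≢7 = contradiction
    (vanish⇒boundary (vanish-rips (i≢4 ∘ ℕₚ.suc-injective) (i≢7 ∘ ℕₚ.suc-injective)) c cyc) ¬b
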